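{- Let $k\ge 5$ and let $\mathcal{C}$ be a $k$-dense family of cycles. Then for every $n$, \[\mathrm{sat}_g(n,\mathcal{C})\leq \tfrac{1}{2}(k-1)(n-1)+1.\]
   Context: $C_\ell$ denotes the cycle of length $\ell$. For $k\geq 5$, a family of cycles $\mathcal{C}$ is $k$-dense if: (1) $C_k,C_{k+1}\in\mathcal{C}$, except that when $k=5$ only $C_5\in\mathcal{C}$ is required; (2) $C_\ell\notin\mathcal{C}$ for all $\ell<k$; (3) for every $s\geq 3$ there exists $\ell$ with $s+2\leq \ell\leq 3+(k-2)(s-2)$ and $C_\ell\in\mathcal{C}$. For a family of graphs $\mathcal{F}$, the $\mathcal{F}$-saturation game on $n$ vertices is played by two players, Max and Mini. Starting with Max, they alternately add edges to an initially empty graph on $n$ vertices, subject only to the constraint that no player may add an edge creating a subgraph isomorphic to a member of $\mathcal{F}$. The game ends when the graph is $\mathcal{F}$-saturated (contains no member of $\mathcal{F}$, but adding any edge creates one). Max wants the final graph to have as many edges as possible, Mini as few as possible. $\mathrm{sat}_g(n,\mathcal{F})$ denotes the number of edges in the final graph when both play optimally. -}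

module Defs where

open import Data.Nat using (ℕ; zero; suc; _+_; _*_; _∸_; _≤_; _<_)
open import Data.Fin using (Fin; zero; suc; inject₁; fromℕ)
open import Data.Product using (Σ; _×_; _,_; ∃)
open import Data.Sum using (_⊎_)
open import Data.List using (List; _∷_; []; length)
open import Data.List.Membership.Propositional using (_∈_)
open import Relation.Binary.PropositionalEquality using (_≡_; _≢_)
open import Relation.Nullary using (¬_)
open import Function.Definitions using (Injective)

-- A (simple) graph on vertex set Fin n, given by its list of edges.
-- The game only ever adds non-edges between distinct vertices, so the
-- list never has repeated (unordered) edges or loops along a play,
-- and its length is the number of edges.
Graph : ℕ → Set
Graph n = List (Fin n × Fin n)

emptyGraph : ∀ {n} → Graph n
emptyGraph = []

numEdges : ∀ {n} → Graph n → ℕ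
numEdges = length

Adj : ∀ {n} → Graph n → Fin n → Fin n → Set
Adj G u v = ((u , v) ∈ G) ⊎ ((v , u) ∈ G)

addEdge : ∀ {n} → Fin n → Fin n → Graph n → Graph n
addEdge u v G = (u , v) ∷ G

HasCycle : ∀ {n} → Graph n → ℕ → Set
HasCycle {n} G zero = Data.Empty.⊥
  where import Data.Empty
HasCycle {n} G (suc m) =
  (2 ≤ m) ×
  Σ (Fin (suc m) → Fin n) λ f →
    Injective _≡_ _≡_ f ×
    (∀ (i : Fin m) → Adj G (f (inject₁ i)) (f (suc i))) ×
    Adj G (f (fromℕ m)) (f zero)

-- A family of cycles is given by the set of its lengths: C ℓ means C_ℓ ∈ 𝒞.
CycleFamily : Set₁
CycleFamily = ℕ → Set

ContainsMember : ∀ {n} → CycleFamily → Graph n → Set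
ContainsMember 𝒞 G = Σ ℕ λ ℓ → 𝒞 ℓ × HasCycle G ℓ

-- k-dense families (k ≥ 5 is assumed separately in the theorem)
KDense : ℕ → CycleFamily → Set
KDense k 𝒞 =
  (𝒞 k × (k ≢ 5 → 𝒞 (suc k))) ×
  (∀ ℓ → 3 ≤ ℓ → ℓ < k → ¬ 𝒞 ℓ) ×
  (∀ s → 3 ≤ s → Σ ℕ λ ℓ → (s + 2 ≤ ℓ) × (ℓ ≤ 3 + (k ∸ 2) * (s ∸ 2)) × 𝒞 ℓ)

Legal : ∀ {n} → CycleFamily → Graph n → Fin n → Fin n → Set
Legal 𝒞 G u v = (u ≢ v) × ¬ Adj G u v × ¬ ContainsMember 𝒞 (addEdge u v G)

-- the game is over: no legal move remains (G is 𝒞-saturated; along a play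
-- G never contains a member of 𝒞)
Saturated : ∀ {n} → CycleFamily → Graph n → Set
Saturated 𝒞 G = ∀ u v → ¬ Legal 𝒞 G u v

data Player : Set where
  Max Mini : Player

-- MiniForces 𝒞 b G p : from position G with player p to move, Mini has a
-- strategy guaranteeing that the final (saturated) graph has ≤ b edges,
-- whatever Max does.  Since the game is finite, this says exactly that the
-- value of the game from this position under optimal play is ≤ b.
data MiniForces {n : ℕ} (𝒞 : CycleFamily) (b : ℕ) : Graph n → Player → Set where
  done     : ∀ {G p} → Saturated 𝒞 G → numEdges G ≤ b → MiniForces 𝒞 b G p
  miniMove : ∀ {G} u v → Legal 𝒞 G u v →
             MiniForces 𝒞 b (addEdge u v G) Max → MiniForces 𝒞 b G Mini
  maxMove  : ∀ {G} → ¬ Saturated 𝒞 G →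
             (∀ u v → Legal 𝒞 G u v → MiniForces 𝒞 b (addEdge u v G) Mini) →
             MiniForces 𝒞 b G Max

SatGameAtMost : CycleFamily → ℕ → ℕ → Set
SatGameAtMost 𝒞 n b = MiniForces {n} 𝒞 b emptyGraph Max

{-# OPTIONS --safe #-}
-- Mini keeps the graph inside a rooted tree structure: every edge joins a vertex to its
-- parent or to a sibling. A cycle then lives on a vertex p and its children, and C_k ∈ 𝒞
-- forbids paths on k - 1 vertices among the children of p, so by Erdős–Gallai there are
-- at most (k - 3)/2 sibling edges and one parent edge per non-root vertex. Only "closed"
-- vertices x may have children: x starts a path on k - 2 vertices among its siblings.
-- Travelling through closed vertices one can realise every number of vertices between
-- the extremes, so (3) makes every edge between distant vertices illegal.
--
-- Max can only disturb this by hanging a new vertex y on a non-closed x, and Mini answers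
-- with the edge from y to the parent of x, legal precisely because x is not closed. When
-- Max joins two isolated vertices, Mini can attach only one of them to the root, so each
-- component of the graph on the children of the root may contain one vertex not yet
-- adjacent to the root. If Max merges two such components, one of their unattached
-- vertices can be attached: were the path blocking an unattached v to pass through the
-- other one, a second neighbour of v would extend or rotate this path into a cycle of
-- length k or k + 1. For k = 5 this case does not arise, since it needs a 5-cycle.
module Submission where

open import Defs
open import Data.Nat using (ℕ; zero; suc; _+_; _*_; _∸_; _≤_; _<_; z≤n; s≤s; s≤s⁻¹; _≤?_; _/_)
open import Data.Nat.Properties hiding (_≟_)
open import Data.Nat.DivMod using (m*n/n≡m; /-monoˡ-≤)
open import Data.Nat.Solver using (module +-*-Solver)
open import Data.Fin using (Fin; zero; suc; inject₁; fromℕ)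
open import Data.Fin.Properties using (_≟_; any?)
open import Data.Maybe using (Maybe; just; nothing; maybe′)
open import Data.Product using (Σ; _×_; _,_; ∃; ∃₂; proj₁; proj₂)
open import Data.Product.Properties using (≡-dec)
open import Data.Sum using (_⊎_; inj₁; inj₂; [_,_]′)
open import Data.Empty using (⊥; ⊥-elim)
open import Data.List using (List; []; _∷_; _++_; length; lookup; tabulate; allFin)
open import Data.List.Properties using (length-++; ++-assoc; ++-identityʳ; length-tabulate; ∷-injectiveʳ)
open import Data.List.Membership.Propositional using (_∈_; _∉_; find; lose)
open import Data.List.Membership.Propositional.Properties using (∈-++⁺ˡ; ∈-++⁺ʳ; ∈-++⁻; ∈-∃++; ∈-allFin; ∈-lookup)
import Data.List.Membership.DecPropositional as DecMembership
open import Data.List.Relation.Unary.Any as Any using (here; there)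
open import Data.List.Relation.Unary.All as All using (All; []; _∷_)
import Data.List.Relation.Unary.All.Properties as All
open import Data.List.Relation.Unary.AllPairs using ([]; _∷_)
open import Data.List.Relation.Unary.Unique.Propositional using (Unique)
import Data.List.Relation.Unary.Unique.Propositional.Properties as Unique
open import Data.List.Relation.Binary.Permutation.Propositional as ↭ using (_↭_; ↭-refl; ↭-sym; ↭-trans; prep; swap; ↭⇒↭ₛ)
open import Data.List.Relation.Binary.Permutation.Propositional.Properties using (∈-resp-↭; All-resp-↭; ↭-length; shift; ++⁺ˡ; ++⁺ʳ; ++-comm)
import Data.List.Relation.Binary.Permutation.Setoid.Properties as Permₛ
open import Relation.Binary.Definitions using (DecidableEquality; tri<; tri≈; tri>)
open import Relation.Binary.PropositionalEquality as ≡ using (_≡_; _≢_; refl; sym; trans; cong; cong₂; subst; setoid)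
open import Relation.Nullary using (¬_; Dec; yes; no)
open import Relation.Nullary.Decidable using (¬?; _×-dec_; _⊎-dec_; map′)

-- Paths

-- The interval in (3) is exactly what a single edge closes. If a lies i + 1 levels below c, and b
-- lies j + 1 levels below d, for distinct siblings c and d, then ab lies on cycles of all lengths
-- from 5 + i + j to 3 + (i + j + 1)(k - 2), which is (3) for s = i + j + 3. The other distant pairs
-- give intervals that contain k or an interval of this kind. The family is an arbitrary predicate,
-- so legality is undecidable and Mini cannot search for a legal move. Her choices rest on decidable
-- properties: whether a vertex is attached, whether it has two neighbours, whether an edge closes a
-- cycle of length exactly k. Legality must then be derived, by turning a forbidden cycle of unknown
-- length into one of length k or into a closed vertex. The tree is revised during play. A neighbour
-- c of an unattached v can become closed, and then the edge from v to the root would close a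
-- k-cycle. As v has no further neighbour, it is declared a child of c; after this normalisation no
-- unattached vertex has a closed neighbour.

unique-resp-↭ : ∀ {A : Set} {xs ys : List A} → xs ↭ ys → Unique xs → Unique ys
unique-resp-↭ {A} p = Permₛ.Unique-resp-↭ (setoid A) (↭⇒↭ₛ p)

unique-∷ : ∀ {A : Set} {x : A} {xs} → x ∉ xs → Unique xs → Unique (x ∷ xs)
unique-∷ x∉ u = All.¬Any⇒All¬ _ x∉ ∷ u

unique-head : ∀ {A : Set} {x : A} {xs} → Unique (x ∷ xs) → x ∉ xs
unique-head = Unique.Unique[x∷xs]⇒x∉xs

unique-tail : ∀ {A : Set} {x : A} {xs} → Unique (x ∷ xs) → Unique xs
unique-tail (_ ∷ u) = u

unique-++ : ∀ {A : Set} {xs ys : List A} → Unique xs → Unique ys →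
            (∀ {x} → x ∈ xs → x ∈ ys → ⊥) → Unique (xs ++ ys)
unique-++ u v d = Unique.++⁺ u v (λ (p , q) → d p q)

unique-++ˡ : ∀ {A : Set} (xs : List A) {ys} → Unique (xs ++ ys) → Unique xs
unique-++ˡ [] u = []
unique-++ˡ (x ∷ xs) u = unique-∷ (λ x∈ → unique-head u (∈-++⁺ˡ x∈)) (unique-++ˡ xs (unique-tail u))

unique-++ʳ : ∀ {A : Set} (xs : List A) {ys} → Unique (xs ++ ys) → Unique ys
unique-++ʳ [] u = u
unique-++ʳ (x ∷ xs) u = unique-++ʳ xs (unique-tail u)

unique-disjoint : ∀ {A : Set} (xs : List A) {ys} → Unique (xs ++ ys) → ∀ {x} → x ∈ xs → x ∈ ys → ⊥
unique-disjoint (x ∷ xs) u (here refl) q = unique-head u (∈-++⁺ʳ xs q)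
unique-disjoint (x ∷ xs) u (there p) q = unique-disjoint xs (unique-tail u) p q

-- xs lists the vertices of a walk from a to b, excluding b; a cycle is then
-- a path from a vertex to itself, and it can be rotated by splitting.
data Path {V : Set} (E : V → V → Set) : V → List V → V → Set where
  ε   : ∀ {a} → Path E a [] a
  _◅_ : ∀ {a b c xs} → E a b → Path E b xs c → Path E a (a ∷ xs) c

infixr 5 _◅_

module _ {V : Set} {E : V → V → Set} where

  infixr 5 _◅◅_
  _◅◅_ : ∀ {a b c xs ys} → Path E a xs b → Path E b ys c → Path E a (xs ++ ys) c
  ε ◅◅ q = q
  (e ◅ p) ◅◅ q = e ◅ (p ◅◅ q)

  path-split : ∀ xs {ys a c} → Path E a (xs ++ ys) c → ∃ λ b → Path E a xs b × Path E b ys c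
  path-split [] p = _ , ε , p
  path-split (x ∷ xs) (e ◅ p) with path-split xs p
  ... | b , q , r = b , e ◅ q , r

  path-head : ∀ {a x xs b} → Path E a (x ∷ xs) b → a ≡ x
  path-head (_ ◅ _) = refl

  path-splitAt : ∀ xs {y ys a c} → Path E a (xs ++ y ∷ ys) c → Path E a xs y × Path E y (y ∷ ys) c
  path-splitAt xs p with path-split xs p
  ... | b , q , r with path-head r
  ... | refl = q , r

  path-rotate : ∀ xs {y ys a} → Path E a (xs ++ y ∷ ys) a → Path E y (y ∷ ys ++ xs) y
  path-rotate xs p with path-splitAt xs p
  ... | q , r = r ◅◅ q

  path-start : ∀ {a xs b} → Path E a xs b → a ≢ b → a ∈ xs
  path-start ε a≢b = ⊥-elim (a≢b refl)
  path-start (_ ◅ _) _ = here refl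

  -- Only the last edge is replaced; this is how a piece of a path leaves for the centre of a fan.
  retarget : ∀ {a x xs b p} → Path E a (x ∷ xs) b → All (λ y → E y p) (x ∷ xs) → Path E a (x ∷ xs) p
  retarget (_ ◅ ε) (e ∷ []) = e ◅ ε
  retarget (e ◅ p@(_ ◅ _)) (_ ∷ es) = e ◅ retarget p es

  path-last : ∀ {a x xs b} → Path E a (x ∷ xs) b → ∃ λ y → y ∈ (x ∷ xs) × E y b
  path-last (e ◅ ε) = _ , here refl , e
  path-last (_ ◅ p@(_ ◅ _)) with path-last p
  ... | y , y∈ , e = y , there y∈ , e

  -- The second path accumulates what is already reversed. Since a path does not list its end,
  -- reversal shifts the list by one place; only membership, uniqueness and length matter later, so
  -- the list is tracked up to permutation.
  path-reverse : (∀ {x y} → E x y → E y x) → ∀ {a b d xs ys} → Path E b xs d → Path E b (b ∷ ys) a →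
                 ∃ λ zs → Path E d (d ∷ zs) a × (zs ↭ (xs ++ ys))
  path-reverse symE ε q = _ , q , ↭-refl
  path-reverse symE {b = b} {ys = ys} (_◅_ {xs = xs} e p) q with path-reverse symE p (symE e ◅ q)
  ... | zs , r , σ = zs , r , ↭-trans σ (shift b xs ys)

  path-flip : (∀ {x y} → E x y → E y x) → ∀ {a b xs} → Path E a (a ∷ xs) b →
              ∃ λ zs → Path E b (b ∷ zs) a × (zs ↭ xs)
  path-flip symE {xs = xs} (e ◅ p) with path-reverse symE p (symE e ◅ ε)
  ... | zs , r , σ = zs , r , subst (zs ↭_) (++-identityʳ xs) σ

path-map : ∀ {V : Set} {E F : V → V → Set} {a xs b} →
           (∀ {x y} → x ∈ xs → (y ∈ xs ⊎ y ≡ b) → E x y → F x y) → Path E a xs b → Path F a xs b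
path-map f ε = ε
path-map f (e ◅ ε) = f (here refl) (inj₂ refl) e ◅ ε
path-map f (e ◅ p@(_ ◅ _)) = f (here refl) (inj₁ (there (here refl))) e ◅
  path-map (λ x∈ y∈ → f (there x∈) ([ (λ q → inj₁ (there q)) , inj₂ ]′ y∈)) p

-- Paths of prescribed length inside a fan

take-split : ∀ {A : Set} m (xs : List A) → m ≤ length xs → ∃₂ λ ys zs → xs ≡ ys ++ zs × length ys ≡ m
take-split zero xs _ = [] , xs , refl , refl
take-split (suc m) (x ∷ xs) (s≤s m≤) with take-split m xs m≤
... | ys , zs , refl , refl = x ∷ ys , zs , refl , refl

-- Sums of two intervals leave no gaps: the second summand stays at its minimum `c` until the first
-- has reached `b`, and only then grows.
between-sum : ∀ {a b c d m} → a ≤ b → c ≤ d → a + c ≤ m → m ≤ b + d →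
              ∃₂ λ i j → i + j ≡ m × (a ≤ i × i ≤ b) × (c ≤ j × j ≤ d)
between-sum {a} {b} {c} {d} {m} a≤b c≤d lo hi with ≤-total (m ∸ c) b
... | inj₁ le = m ∸ c , c , m∸n+n≡m (≤-trans (m≤n+m c a) lo) , (m+n≤o⇒m≤o∸n a lo , le) , ≤-refl , c≤d
... | inj₂ ge = b , m ∸ b , m+[n∸m]≡n b≤m , (a≤b , ≤-refl) , c≤ , m≤n+o⇒m∸n≤o m b hi
  where
  b≤m : b ≤ m
  b≤m = ≤-trans ge (m∸n≤m m c)
  c≤m : c ≤ m
  c≤m = ≤-trans (m≤n+m c a) lo
  c≤ : c ≤ m ∸ b
  c≤ = m+n≤o⇒m≤o∸n c (subst (_≤ m) (+-comm b c) (subst (b + c ≤_) (m∸n+n≡m c≤m) (+-monoˡ-≤ c ge)))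

module _ {V : Set} {E : V → V → Set} where

  fan-prefix : ∀ {c p e xs m} → Path E c xs e → All (λ y → E y p) xs → 1 ≤ m → m ≤ length xs →
               ∃₂ λ ys zs → xs ≡ ys ++ zs × length ys ≡ m × Path E c ys p
  fan-prefix {xs = xs} {m} P es 1≤m m≤ with take-split m xs m≤
  fan-prefix P es () m≤ | [] , zs , refl , refl
  ... | y ∷ ys , zs , refl , refl with path-split (y ∷ ys) P
  ... | _ , Q , _ = y ∷ ys , zs , refl , refl , retarget Q (All.++⁻ˡ (y ∷ ys) es)

  -- If `d` lies off the path, a prefix followed by `p` leads to `d`. If `d` lies on it, the route
  -- leaves the path before `d`, jumps through `p` to `d` or to a vertex beyond it, and walks back
  -- to `d`. The numbers of vertices used before and after `d` are independent, so no length is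
  -- skipped.
  fan-cross : (∀ {x y} → E x y → E y x) → ∀ {c p e d xs m} → Path E c xs e → All (λ y → E y p) xs →
              Unique xs → p ∉ xs → E p d → d ≢ c → d ≢ p → Dec (d ∈ xs) → 2 ≤ m → m ≤ length xs →
              ∃ λ ys → Path E c ys d × Unique ys × d ∉ ys × All (λ y → y ≡ p ⊎ y ∈ xs) ys × length ys ≡ m
  fan-cross symE {p = p} {d = d} {m = suc m} P es u p∉ pd d≢c d≢p (no d∉) (s≤s 1≤m) m≤
    with fan-prefix P es 1≤m (≤-trans (n≤1+n m) m≤)
  ... | ys , zs , refl , refl , Q =
    ys ++ p ∷ [] , Q ◅◅ (pd ◅ ε) ,
    unique-++ (unique-++ˡ ys u) ([] ∷ []) (λ { x∈ (here refl) → p∉ (∈-++⁺ˡ x∈) }) ,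
    d∉ys , All.++⁺ (All.tabulate (λ x∈ → inj₂ (∈-++⁺ˡ x∈))) (inj₁ refl ∷ []) ,
    trans (length-++ ys) (+-comm (length ys) 1)
    where
    d∉ys : d ∉ ys ++ p ∷ []
    d∉ys d∈ with ∈-++⁻ ys d∈
    ... | inj₁ q = d∉ (∈-++⁺ˡ q)
    ... | inj₂ (here q) = d≢p q
  fan-cross symE {p = p} {d = d} {m = suc m} P es u p∉ pd d≢c d≢p (yes d∈) (s≤s 1≤m) m≤ with ∈-∃++ d∈
  ... | [] , bs , refl = ⊥-elim (d≢c (sym (path-head P)))
  ... | as@(a ∷ as₀) , bs , refl
    with between-sum {1} {length as} {0} {length bs} (s≤s z≤n) z≤n 1≤m
           (s≤s⁻¹ (subst (suc m ≤_) (trans (length-++ as) (+-suc (length as) (length bs))) m≤))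
       | path-splitAt as P
  ... | i , j , refl , (1≤i , i≤) , _ , j≤ | P₁ , P₂
    with fan-prefix P₁ (All.++⁻ˡ as es) 1≤i i≤ | fan-prefix P₂ (All.++⁻ʳ as es) (s≤s (z≤n {j})) (s≤s j≤)
  ... | as₁ , as₂ , eq₁ , refl , Q₁ | [] , bs₂ , eq₂ , () , Q₂
  ... | as₁ , as₂ , eq₁ , refl , Q₁ | _ ∷ bs₁ , bs₂ , refl , refl , Q₂ with path-flip symE Q₂
  ... | zs , R , σ =
    as₁ ++ p ∷ zs , Q₁ ◅◅ R ,
    unique-++ (unique-++ˡ as₁ (subst Unique eq₁ (unique-++ˡ as u)))
      (unique-∷ (λ q → p∉ (∈-++⁺ʳ as (there (in-bs q))))
        (unique-resp-↭ (↭-sym σ) (unique-++ˡ bs₁ (unique-tail (unique-++ʳ as u)))))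
      (λ { x∈ (here refl) → p∉ (∈-++⁺ˡ (in-as x∈))
         ; x∈ (there q) → unique-disjoint as u (in-as x∈) (there (in-bs q)) }) ,
    d∉ , All.++⁺ (All.tabulate (λ x∈ → inj₂ (∈-++⁺ˡ (in-as x∈))))
                 (inj₁ refl ∷ All.tabulate (λ q → inj₂ (∈-++⁺ʳ as (there (in-bs q))))) ,
    trans (length-++ as₁) (trans (+-suc (length as₁) (length zs)) (cong (λ l → suc (length as₁ + l)) (↭-length σ)))
    where
    in-as : ∀ {x} → x ∈ as₁ → x ∈ as
    in-as x∈ = subst (_ ∈_) (sym eq₁) (∈-++⁺ˡ x∈)
    in-bs : ∀ {x} → x ∈ zs → x ∈ bs₁ ++ bs₂
    in-bs x∈ = ∈-++⁺ˡ (∈-resp-↭ σ x∈)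
    d∉ : d ∉ as₁ ++ p ∷ zs
    d∉ q with ∈-++⁻ as₁ q
    ... | inj₁ r = unique-disjoint as u (in-as r) (here refl)
    ... | inj₂ (here r) = d≢p r
    ... | inj₂ (there r) = unique-head (unique-++ʳ as u) (in-bs r)

-- Cycles through a new edge

SamePair : {V : Set} → V → V → V → V → Set
SamePair a b x y = (x ≡ a × y ≡ b) ⊎ (x ≡ b × y ≡ a)

module NewEdge {V : Set} {E F : V → V → Set} {a b : V} (a≢b : a ≢ b)
               (symE : ∀ {x y} → E x y → E y x)
               (F⊆ : ∀ {x y} → F x y → E x y ⊎ SamePair a b x y) where

  first-new : ∀ {x z xs} → Path F x xs z → Path E x xs z ⊎
    (∃₂ λ p q → ∃₂ λ ps qs → xs ≡ ps ++ p ∷ qs × SamePair a b p q × Path F x ps p × Path F q qs z)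
  first-new ε = inj₁ ε
  first-new {x} (_◅_ {b = y} f P) with F⊆ f
  ... | inj₂ new = inj₂ (x , y , [] , _ , refl , new , ε , P)
  ... | inj₁ e with first-new P
  ... | inj₁ Q = inj₁ (e ◅ Q)
  ... | inj₂ (p , q , ps , qs , refl , new , Q , R) = inj₂ (p , q , x ∷ ps , qs , refl , new , f ◅ Q , R)

  pair-left : ∀ {p q x y} → SamePair a b p q → SamePair a b x y → x ≡ p ⊎ x ≡ q
  pair-left (inj₁ (refl , refl)) (inj₁ (refl , refl)) = inj₁ refl
  pair-left (inj₁ (refl , refl)) (inj₂ (refl , refl)) = inj₂ refl
  pair-left (inj₂ (refl , refl)) (inj₁ (refl , refl)) = inj₂ refl
  pair-left (inj₂ (refl , refl)) (inj₂ (refl , refl)) = inj₁ refl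

  pair-right : ∀ {p q y} → SamePair a b p q → SamePair a b q y → y ≡ p
  pair-right (inj₁ (refl , refl)) (inj₁ (e , refl)) = e
  pair-right (inj₁ (refl , refl)) (inj₂ (refl , refl)) = refl
  pair-right (inj₂ (refl , refl)) (inj₁ (refl , refl)) = refl
  pair-right (inj₂ (refl , refl)) (inj₂ (e , refl)) = e

  old-path : ∀ {p q y z ys} → SamePair a b p q → p ∉ ys → q ∉ ys → Path F y ys z → Path E y ys z
  old-path {p} {q} {ys = ys} new p∉ q∉ = path-map old
    where
    old : ∀ {x y z} → x ∈ ys → (y ∈ ys ⊎ y ≡ z) → F x y → E x y
    old x∈ _ f with F⊆ f
    ... | inj₁ e = e
    ... | inj₂ new′ with pair-left new new′
    ... | inj₁ refl = ⊥-elim (p∉ x∈)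
    ... | inj₂ refl = ⊥-elim (q∉ x∈)

  -- After one traversal from `p` to `q` the new edge cannot recur: from `q` it leads to `p`, which
  -- is not listed, and no later listed vertex is one of its ends. The bound `2 ≤ length qs` rules
  -- out stepping straight back.
  old-return : ∀ {p q qs} → SamePair a b p q → 2 ≤ length qs → Unique qs → p ∉ qs → Path F q qs p → Path E q qs p
  old-return new (s≤s ()) u p∉ (f ◅ ε)
  old-return new _ u p∉ (f ◅ P@(_ ◅ _)) with F⊆ f
  ... | inj₁ e = e ◅ old-path new (λ r → p∉ (there r)) (unique-head u) P
  ... | inj₂ new′ = ⊥-elim (p∉ (there (here (sym (pair-right new new′)))))

  -- Cutting the cycle at its first new edge leaves a path of old edges between the two ends, turned
  -- if necessary to run from `a` to `b`. The end `b` is not listed, hence the `suc`.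
  cycle-through : ∀ {x xs} → Path F x xs x → Unique xs → 3 ≤ length xs → Path E x xs x ⊎
                  (∃ λ ys → Path E a ys b × Unique ys × b ∉ ys × suc (length ys) ≡ length xs)
  cycle-through P u 3≤ with first-new P
  ... | inj₁ Q = inj₁ Q
  ... | inj₂ (p , q , ps , qs , refl , new , Q , R) = inj₂ (orient new)
    where
    σ : ps ++ p ∷ qs ↭ p ∷ qs ++ ps
    σ = ↭-trans (shift p ps qs) (prep p (++-comm ps qs))
    u′ : Unique (p ∷ qs ++ ps)
    u′ = unique-resp-↭ σ u
    S : Path E q (qs ++ ps) p
    S = old-return new (s≤s⁻¹ (subst (3 ≤_) (↭-length σ) 3≤)) (unique-tail u′) (unique-head u′) (R ◅◅ Q)
    flipped : ∀ {ys} → Path E q ys p → q ≢ p → Unique ys → p ∉ ys →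
              ∃ λ zs → Path E p zs q × Unique zs × q ∉ zs × length zs ≡ length ys
    flipped ε q≢p _ _ = ⊥-elim (q≢p refl)
    flipped S@(_ ◅ _) q≢p w p∉ with path-flip symE S
    ... | zs , T , τ = p ∷ zs , T , unique-∷ (λ r → p∉ (there (∈-resp-↭ τ r))) (unique-resp-↭ (↭-sym τ) (unique-tail w)) ,
      (λ { (here r) → q≢p r ; (there r) → unique-head w (∈-resp-↭ τ r) }) , cong suc (↭-length τ)
    orient : SamePair a b p q →
             ∃ λ ys → Path E a ys b × Unique ys × b ∉ ys × suc (length ys) ≡ length (ps ++ p ∷ qs)
    orient (inj₁ (refl , refl)) with flipped S (λ r → a≢b (sym r)) (unique-tail u′) (unique-head u′)
    ... | zs , T , w , q∉ , l = zs , T , w , q∉ , trans (cong suc l) (sym (↭-length σ))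
    orient (inj₂ (refl , refl)) = qs ++ ps , S , unique-tail u′ , unique-head u′ , sym (↭-length σ)

-- The Erdős–Gallai bound for graphs without long paths

indicator : {P : Set} → Dec P → ℕ
indicator (yes _) = 1
indicator (no _) = 0

indicator≤1 : {P : Set} (P? : Dec P) → indicator P? ≤ 1
indicator≤1 (yes _) = ≤-refl
indicator≤1 (no _) = z≤n

indicator-yes : {P : Set} (P? : Dec P) → P → indicator P? ≡ 1
indicator-yes (yes _) p = ≡.refl
indicator-yes (no ¬p) p = ⊥-elim (¬p p)

indicator-no : {P : Set} (P? : Dec P) → ¬ P → indicator P? ≡ 0
indicator-no (yes p) ¬p = ⊥-elim (¬p p)
indicator-no (no _) ¬p = ≡.refl

module _ {A : Set} where

  sumOver : List A → (A → ℕ) → ℕ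
  sumOver [] f = 0
  sumOver (x ∷ xs) f = f x + sumOver xs f

  sumOver-++ : ∀ xs {ys} f → sumOver (xs ++ ys) f ≡ sumOver xs f + sumOver ys f
  sumOver-++ [] f = ≡.refl
  sumOver-++ (x ∷ xs) f = ≡.trans (cong (f x +_) (sumOver-++ xs f)) (≡.sym (+-assoc (f x) _ _))

  sumOver-+ : ∀ xs f g → sumOver xs (λ x → f x + g x) ≡ sumOver xs f + sumOver xs g
  sumOver-+ [] f g = ≡.refl
  sumOver-+ (x ∷ xs) f g = ≡.trans (cong (f x + g x +_) (sumOver-+ xs f g))
    (solve 4 (λ a b c d → (a :+ b) :+ (c :+ d) := (a :+ c) :+ (b :+ d)) ≡.refl (f x) (g x) (sumOver xs f) (sumOver xs g))
    where open +-*-Solver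

  sumOver-mono : ∀ xs {f g} → (∀ {x} → x ∈ xs → f x ≤ g x) → sumOver xs f ≤ sumOver xs g
  sumOver-mono [] h = z≤n
  sumOver-mono (x ∷ xs) h = +-mono-≤ (h (here ≡.refl)) (sumOver-mono xs (λ x∈ → h (there x∈)))

  sumOver-cong : ∀ xs {f g} → (∀ x → f x ≡ g x) → sumOver xs f ≡ sumOver xs g
  sumOver-cong [] h = ≡.refl
  sumOver-cong (x ∷ xs) h = cong₂ _+_ (h x) (sumOver-cong xs h)

  sumOver-const : ∀ xs c → sumOver xs (λ _ → c) ≡ length xs * c
  sumOver-const [] c = ≡.refl
  sumOver-const (x ∷ xs) c = cong (c +_) (sumOver-const xs c)

  sumOver-zero : ∀ xs {f} → (∀ {x} → x ∈ xs → f x ≡ 0) → sumOver xs f ≡ 0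
  sumOver-zero [] h = ≡.refl
  sumOver-zero (x ∷ xs) h = cong₂ _+_ (h (here ≡.refl)) (sumOver-zero xs (λ x∈ → h (there x∈)))

  sumOver-↭ : ∀ {xs ys} f → xs ↭ ys → sumOver xs f ≡ sumOver ys f
  sumOver-↭ f ↭.refl = ≡.refl
  sumOver-↭ f (prep x p) = cong (f x +_) (sumOver-↭ f p)
  sumOver-↭ f (swap {xs} {ys} x y p) = ≡.trans (cong (λ s → f x + (f y + s)) (sumOver-↭ f p))
    (solve 3 (λ a b c → a :+ (b :+ c) := b :+ (a :+ c)) ≡.refl (f x) (f y) (sumOver ys f))
    where open +-*-Solver
  sumOver-↭ f (↭.trans p q) = ≡.trans (sumOver-↭ f p) (sumOver-↭ f q)

  member-↭ : ∀ {x : A} {xs} → x ∈ xs → ∃ λ ys → xs ↭ x ∷ ys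
  member-↭ {x} x∈ with ∈-∃++ x∈
  ... | ps , qs , ≡.refl = ps ++ qs , shift x ps qs

  subset-↭ : ∀ {xs ys : List A} → Unique xs → All (_∈ ys) xs → ∃ λ zs → ys ↭ xs ++ zs
  subset-↭ {ys = ys} [] [] = ys , ↭-refl
  subset-↭ {x ∷ xs} u (x∈ ∷ xs⊆) with member-↭ x∈
  ... | ys′ , σ with subset-↭ (unique-tail u) (All.tabulate (λ {y} y∈ → inside y∈ (∈-resp-↭ σ (All.lookup xs⊆ y∈))))
    where
    inside : ∀ {y} → y ∈ xs → y ∈ x ∷ ys′ → y ∈ ys′
    inside y∈ (here ≡.refl) = ⊥-elim (unique-head u y∈)
    inside y∈ (there q) = q
  ... | zs , τ = zs , ↭-trans σ (prep x τ)

  sumOver-support : ∀ {xs ys : List A} {f} → Unique xs → (∀ {x} → x ∈ xs → f x ≢ 0 → x ∈ ys) →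
                    sumOver xs f ≤ sumOver ys f
  sumOver-support {[]} u h = z≤n
  sumOver-support {x ∷ xs} {ys} {f} u h with f x in eq
  ... | zero = sumOver-support (unique-tail u) (λ x∈ → h (there x∈))
  ... | suc m with member-↭ (h (here ≡.refl) (λ r → 0≢1+n (≡.trans (≡.sym r) eq)))
  ... | ys′ , σ = subst (suc m + sumOver xs f ≤_) (≡.sym (≡.trans (sumOver-↭ f σ) (cong (_+ sumOver ys′ f) eq)))
                    (+-monoʳ-≤ (suc m) (sumOver-support (unique-tail u) inside))
    where
    inside : ∀ {y} → y ∈ xs → f y ≢ 0 → y ∈ ys′
    inside y∈ fy with ∈-resp-↭ σ (h (there y∈) fy)
    ... | here ≡.refl = ⊥-elim (unique-head u y∈)
    ... | there q = q

sumOver-swap : ∀ {A B : Set} xs ys (f : A → B → ℕ) →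
               sumOver xs (λ x → sumOver ys (f x)) ≡ sumOver ys (λ y → sumOver xs (λ x → f x y))
sumOver-swap [] ys f = ≡.sym (sumOver-zero ys (λ _ → ≡.refl))
sumOver-swap (x ∷ xs) ys f = ≡.trans (cong (sumOver ys (f x) +_) (sumOver-swap xs ys f))
  (≡.sym (sumOver-+ ys (f x) (λ y → sumOver xs (λ x₁ → f x₁ y))))

module ErdősGallai {V : Set} (_≟_ : DecidableEquality V) (E : V → V → Set) (E? : ∀ x y → Dec (E x y))
                   (symE : ∀ {x y} → E x y → E y x) (irreflE : ∀ {x} → ¬ E x x) where

  open DecMembership _≟_ using (_∈?_)

  e : V → V → ℕ
  e x y = indicator (E? x y)

  degree : List V → V → ℕ
  degree vs x = sumOver vs (e x)

  -- Ordered pairs are counted, so `count vs vs` is twice the number of edges inside `vs`.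
  count : List V → List V → ℕ
  count xs ys = sumOver xs (degree ys)

  e-sym : ∀ x y → e x y ≡ e y x
  e-sym x y with E? x y | E? y x
  ... | yes _ | yes _ = ≡.refl
  ... | no _ | no _ = ≡.refl
  ... | yes p | no q = ⊥-elim (q (symE p))
  ... | no p | yes q = ⊥-elim (p (symE q))

  e≢0⇒E : ∀ {x y} → e x y ≢ 0 → E x y
  e≢0⇒E {x} {y} h with E? x y
  ... | yes p = p
  ... | no _ = ⊥-elim (h ≡.refl)

  count-sym : ∀ xs ys → count xs ys ≡ count ys xs
  count-sym xs ys = ≡.trans (sumOver-swap xs ys e)
    (sumOver-cong ys (λ y → sumOver-cong xs (λ x → e-sym x y)))

  count-++ : ∀ xs ys → count (xs ++ ys) (xs ++ ys) ≡ count xs xs + 2 * count xs ys + count ys ys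
  count-++ xs ys = begin
    count (xs ++ ys) (xs ++ ys)
      ≡⟨ sumOver-++ xs _ ⟩
    count xs (xs ++ ys) + count ys (xs ++ ys)
      ≡⟨ cong₂ _+_ (row xs) (row ys) ⟩
    (count xs xs + count xs ys) + (count ys xs + count ys ys)
      ≡⟨ cong (λ c → count xs xs + count xs ys + (c + count ys ys)) (count-sym ys xs) ⟩
    (count xs xs + count xs ys) + (count xs ys + count ys ys)
      ≡⟨ solve 3 (λ a b c → (a :+ b) :+ (b :+ c) := a :+ con 2 :* b :+ c) ≡.refl (count xs xs) (count xs ys) (count ys ys) ⟩
    count xs xs + 2 * count xs ys + count ys ys ∎
    where
    open ≡.≡-Reasoning
    open +-*-Solver
    row : ∀ zs → count zs (xs ++ ys) ≡ count zs xs + count zs ys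
    row zs = ≡.trans (sumOver-cong zs (λ z → sumOver-++ xs (e z))) (sumOver-+ zs _ _)

  count-↭ : ∀ {xs ys} → xs ↭ ys → count xs xs ≡ count ys ys
  count-↭ {xs} {ys} σ = ≡.trans (sumOver-cong xs (λ x → sumOver-↭ (e x) σ)) (sumOver-↭ (degree ys) σ)

  -- Dropping the last edge makes the last listed vertex the unlisted end. Applied to a cycle, this
  -- gives a path on the same vertices.
  path-init : ∀ {x xs z} → Path E x (x ∷ xs) z → ∃₂ λ ys l → Path E x ys l × (x ∷ xs) ↭ (l ∷ ys)
  path-init (_ ◅ ε) = [] , _ , ε , ↭-refl
  path-init {x} (f ◅ P@(_ ◅ _)) with path-init P
  ... | ys , l , Q , σ = x ∷ ys , l , f ◅ Q , ↭-trans (prep x σ) (swap x l ↭-refl)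

  -- The count from Dirac's theorem: an edge of the path from x to y scores once if x is adjacent to
  -- `b` and once if y is adjacent to `a`. An edge that scores twice closes the path to a cycle on
  -- the same vertices: from `a` to x, across to `b`, back to y, across to `a`.
  crossSum : V → ∀ {x xs b} → Path E x xs b → ℕ
  crossSum a ε = 0
  crossSum a {x} {b = b} (_◅_ {b = y} _ P) = e b x + e a y + crossSum a P

  crossSum-degrees : ∀ {a x xs b} (P : Path E x xs b) →
                     e a x + crossSum a P ≡ degree (b ∷ xs) a + degree xs b
  crossSum-degrees {a} {b = b} ε = ≡.sym (+-identityʳ _)
  crossSum-degrees {a} {x} {b = b} (_◅_ {b = y} {xs = xs} f P) = begin
    e a x + (e b x + e a y + crossSum a P)
      ≡⟨ solve 4 (λ p q r s → p :+ (q :+ r :+ s) := (p :+ q) :+ (r :+ s)) ≡.refl (e a x) (e b x) (e a y) (crossSum a P) ⟩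
    (e a x + e b x) + (e a y + crossSum a P)
      ≡⟨ cong (e a x + e b x +_) (crossSum-degrees P) ⟩
    (e a x + e b x) + ((e a b + degree xs a) + degree xs b)
      ≡⟨ solve 5 (λ p q r s t → (p :+ q) :+ ((r :+ s) :+ t) := (r :+ (p :+ s)) :+ (q :+ t)) ≡.refl
           (e a x) (e b x) (e a b) (degree xs a) (degree xs b) ⟩
    (e a b + (e a x + degree xs a)) + (e b x + degree xs b) ∎
    where
    open ≡.≡-Reasoning
    open +-*-Solver

  -- Pigeonhole: `length xs` is the number of edges of the path.
  crossing : ∀ {a x xs b} (P : Path E x xs b) → length xs < crossSum a P →
             ∃₂ λ ps p → ∃₂ λ q qs → xs ≡ ps ++ p ∷ qs × Path E x ps p × Path E q qs b × E p b × E q a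
  crossing {a} {x} {b = b} (_◅_ {b = y} f P) h with E? b x | E? a y
  ... | yes bx | yes ay = [] , x , y , _ , ≡.refl , ε , P , symE bx , symE ay
  crossing {a} {x} (f ◅ P) h | yes _ | no _ with crossing P (s≤s⁻¹ h)
  ... | ps , p , q , qs , ≡.refl , Q , rest = x ∷ ps , p , q , qs , ≡.refl , f ◅ Q , rest
  crossing {a} {x} (f ◅ P) h | no _ | yes _ with crossing P (s≤s⁻¹ h)
  ... | ps , p , q , qs , ≡.refl , Q , rest = x ∷ ps , p , q , qs , ≡.refl , f ◅ Q , rest
  crossing {a} {x} (f ◅ P) h | no _ | no _ with crossing P (≤-trans (n≤1+n _) h)
  ... | ps , p , q , qs , ≡.refl , Q , rest = x ∷ ps , p , q , qs , ≡.refl , f ◅ Q , rest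

  module _ (d : ℕ) (short : ∀ {a xs b} → Path E a xs b → Unique xs → b ∉ xs → length xs ≤ d) where

    -- The left side is twice the number of edges meeting `x ∷ xs`. Deleting such a nonempty set
    -- reduces the bound to the remaining vertices.
    Removable : List V → Set
    Removable vs = ∃₂ λ x xs → ∃ λ ys → vs ↭ (x ∷ xs) ++ ys ×
                   count (x ∷ xs) (x ∷ xs) + 2 * count (x ∷ xs) ys ≤ length (x ∷ xs) * d

    low-degree : ∀ {vs x} → x ∈ vs → 2 * degree vs x ≤ d → Removable vs
    low-degree {vs} {x} x∈ h with member-↭ x∈
    ... | ys , σ = x , [] , ys , σ , (begin
      e x x + 0 + 0 + 2 * (degree ys x + 0) ≡⟨ cong₂ (λ i j → i + 0 + 0 + 2 * j) exx (+-identityʳ (degree ys x)) ⟩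
      2 * degree ys x                       ≤⟨ *-monoʳ-≤ 2 (m≤n+m (degree ys x) (e x x)) ⟩
      2 * (e x x + degree ys x)             ≡⟨ cong (2 *_) (sumOver-↭ (e x) σ) ⟨
      2 * degree vs x                       ≤⟨ h ⟩
      d                                     ≡⟨ +-identityʳ d ⟨
      1 * d                                 ∎)
      where
      open ≤-Reasoning
      exx : e x x ≡ 0
      exx = indicator-no (E? x x) irreflE

    -- No edge leaves the set, and its at most `d + 1` vertices have degree at most `d`.
    closed-set : ∀ {vs x xs} → Unique (x ∷ xs) → All (_∈ vs) (x ∷ xs) → length xs ≤ d →
                 (∀ {y w} → y ∈ x ∷ xs → w ∈ vs → w ∉ x ∷ xs → ¬ E y w) → Unique vs → Removable vs
    closed-set {vs} {x} {xs} u ⊆vs l closed uvs with subset-↭ u ⊆vs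
    ... | ys , σ = x , xs , ys , σ , (begin
      count L L + 2 * count L ys ≡⟨ cong (λ c → count L L + 2 * c) none ⟩
      count L L + 0              ≡⟨ +-identityʳ _ ⟩
      count L L                  ≤⟨ sumOver-mono L row ⟩
      sumOver L (λ _ → d)        ≡⟨ sumOver-const L d ⟩
      length L * d               ∎)
      where
      open ≤-Reasoning
      L = x ∷ xs
      u′ : Unique (L ++ ys)
      u′ = unique-resp-↭ σ uvs
      none : count L ys ≡ 0
      none = sumOver-zero L (λ {y} y∈ → sumOver-zero ys (λ {w} w∈ →
        indicator-no (E? y w) (closed y∈ (∈-resp-↭ (↭-sym σ) (∈-++⁺ʳ L w∈)) (λ w∈L → unique-disjoint L u′ w∈L w∈))))
      row : ∀ {y} → y ∈ L → degree L y ≤ d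
      row {y} y∈ with member-↭ y∈
      ... | zs , τ = begin
        degree L y             ≡⟨ sumOver-↭ (e y) τ ⟩
        e y y + degree zs y    ≡⟨ cong (_+ degree zs y) (indicator-no (E? y y) irreflE) ⟩
        degree zs y            ≤⟨ sumOver-mono zs (λ {w} _ → indicator≤1 (E? y w)) ⟩
        sumOver zs (λ _ → 1)   ≡⟨ sumOver-const zs 1 ⟩
        length zs * 1          ≡⟨ *-identityʳ _ ⟩
        length zs              ≡⟨ suc-injective (↭-length τ) ⟨
        length xs              ≤⟨ l ⟩
        d                      ∎

    -- Every call has a longer path, until `short` is contradicted. If the path cannot be prolonged,
    -- all neighbours of its ends lie on it. Then either an end has degree at most `d / 2`, or the
    -- path closes to a cycle on its vertices. An edge leaving the cycle yields a longer path;
    -- without one, the cycle is cut off from the rest.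
    removable : ∀ {vs} fuel {a xs b} → Unique vs → Path E a xs b → Unique (b ∷ xs) → All (_∈ vs) (b ∷ xs) →
                d < fuel + length xs → Removable vs
    removable zero uvs P u ⊆vs h = ⊥-elim (<⇒≱ h (short P (unique-tail u) (unique-head u)))
    removable {vs} (suc fuel) {a} {xs} {b} uvs P u ⊆vs h
      with Any.any? (λ w → ¬? (w ∈? b ∷ xs) ×-dec E? w a) vs
    ... | yes front with find front
    ... | w , w∈ , w∉ , wa = removable fuel uvs (wa ◅ P) (unique-resp-↭ (swap w b ↭-refl) (unique-∷ w∉ u))
            (All.head ⊆vs ∷ w∈ ∷ All.tail ⊆vs) (subst (d <_) (≡.sym (+-suc fuel (length xs))) h)
    removable {vs} (suc fuel) {a} {xs} {b} uvs P u ⊆vs h | no ¬front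
      with Any.any? (λ w → ¬? (w ∈? b ∷ xs) ×-dec E? b w) vs
    ... | yes back with find back
    ... | w , w∈ , w∉ , bw = removable fuel uvs (P ◅◅ (bw ◅ ε))
            (unique-resp-↭ (prep w (++-comm (b ∷ []) xs)) (unique-∷ w∉ u))
            (w∈ ∷ All.++⁺ (All.tail ⊆vs) (All.head ⊆vs ∷ []))
            (subst (d <_) (≡.trans (≡.sym (+-suc fuel (length xs))) (cong (fuel +_) (↭-length (++-comm (b ∷ []) xs)))) h)
    removable {vs} (suc fuel) {a} {xs} {b} uvs P u ⊆vs h | no ¬front | no ¬back
      with 2 * degree vs a ≤? d | 2 * degree vs b ≤? d
    ... | yes low | _ = low-degree (All.lookup ⊆vs a∈) low
      where
      a∈ : a ∈ b ∷ xs
      a∈ with a ≟ b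
      ... | yes ≡.refl = here ≡.refl
      ... | no a≢b = there (path-start P a≢b)
    ... | no _ | yes low = low-degree (All.lookup ⊆vs (here ≡.refl)) low
    ... | no high-a | no high-b with crossing {a} P cross
      where
      a-inside : degree vs a ≤ degree (b ∷ xs) a
      a-inside = sumOver-support uvs inside
        where
        inside : ∀ {w} → w ∈ vs → e a w ≢ 0 → w ∈ b ∷ xs
        inside {w} w∈ aw with w ∈? b ∷ xs
        ... | yes q = q
        ... | no w∉ = ⊥-elim (¬front (lose w∈ (w∉ , symE (e≢0⇒E aw))))
      b-inside : degree vs b ≤ degree xs b
      b-inside = sumOver-support uvs inside
        where
        inside : ∀ {w} → w ∈ vs → e b w ≢ 0 → w ∈ xs
        inside {w} w∈ bw with w ∈? b ∷ xs
        ... | yes (here ≡.refl) = ⊥-elim (irreflE (e≢0⇒E bw))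
        ... | yes (there q) = q
        ... | no w∉ = ⊥-elim (¬back (lose w∈ (w∉ , e≢0⇒E bw)))
      cross : length xs < crossSum a P
      cross = begin-strict
        length xs                       ≤⟨ short P (unique-tail u) (unique-head u) ⟩
        d                               <⟨ *-cancelˡ-< 2 d _ (begin-strict
          2 * d                           <⟨ n<1+n _ ⟩
          suc (2 * d)                     <⟨ n<1+n _ ⟩
          2 + 2 * d                       ≡⟨ solve 1 (λ x → con 2 :+ con 2 :* x := (con 1 :+ x) :+ (con 1 :+ x)) ≡.refl d ⟩
          suc d + suc d                   ≤⟨ +-mono-≤ (≰⇒> high-a) (≰⇒> high-b) ⟩
          2 * degree vs a + 2 * degree vs b ≡⟨ *-distribˡ-+ 2 (degree vs a) (degree vs b) ⟨
          2 * (degree vs a + degree vs b) ∎) ⟩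
        degree vs a + degree vs b       ≤⟨ +-mono-≤ a-inside b-inside ⟩
        degree (b ∷ xs) a + degree xs b ≡⟨ crossSum-degrees P ⟨
        e a a + crossSum a P            ≡⟨ cong (_+ crossSum a P) (indicator-no (E? a a) irreflE) ⟩
        crossSum a P                    ∎
        where
        open ≤-Reasoning
        open +-*-Solver
    ... | ps , p , q , qs , ≡.refl , Q , R , pb , qa with path-reverse symE R (qa ◅ ε)
    ... | zs , R′ , σ₀ with Any.any? (λ y → Any.any? (λ w → ¬? (w ∈? b ∷ ps ++ p ∷ qs) ×-dec E? w y) vs) (b ∷ ps ++ p ∷ qs)
    ... | no ¬exit = closed-set u ⊆vs (short P (unique-tail u) (unique-head u))
            (λ y∈ w∈ w∉ yw → ¬exit (lose y∈ (lose w∈ (w∉ , symE yw)))) uvs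
    ... | yes exit with find exit
    ... | y , y∈ , exit′ with find exit′
    ... | w , w∈ , w∉ , wy with ∈-∃++ (∈-resp-↭ (↭-sym σ) y∈)
      where
      σ : ps ++ p ∷ b ∷ zs ↭ b ∷ ps ++ p ∷ qs
      σ = ↭-trans (++⁺ˡ ps (prep p (prep b (subst (zs ↭_) (++-identityʳ qs) σ₀))))
            (↭-trans (++⁺ˡ ps (swap p b ↭-refl)) (shift b ps (p ∷ qs)))
    -- The cycle is opened just before `y`, so that `y` starts a path and `w` can be put in front of
    -- it.
    ... | cs , ds , eq with path-rotate cs (subst (λ l → Path E a l a) eq (Q ◅◅ pb ◅ R′))
    ... | C with path-init C
    ... | init , l , I , τ = removable fuel uvs (wy ◅ I)
            (unique-resp-↭ (swap w l ↭-refl) (unique-∷ (λ r → w∉ (∈-resp-↭ (↭-sym ρ) r)) (unique-resp-↭ ρ u)))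
            (All.head ⊆′ ∷ w∈ ∷ All.tail ⊆′)
            (subst (d <_) (≡.trans (cong (λ m → fuel + m) (↭-length ρ)) ≡.refl) (subst (d <_) (≡.sym (+-suc fuel _)) h))
      where
      ρ : b ∷ ps ++ p ∷ qs ↭ l ∷ init
      ρ = ↭-trans (↭-sym (↭-trans (++⁺ˡ ps (prep p (prep b (subst (zs ↭_) (++-identityʳ qs) σ₀))))
            (↭-trans (++⁺ˡ ps (swap p b ↭-refl)) (shift b ps (p ∷ qs)))))
            (↭-trans (subst (_↭ cs ++ y ∷ ds) (≡.sym eq) ↭-refl) (↭-trans (++-comm cs (y ∷ ds)) τ))
      ⊆′ : All (_∈ vs) (l ∷ init)
      ⊆′ = All-resp-↭ ρ ⊆vs

    erdős-gallai : ∀ fuel vs → length vs ≤ fuel → Unique vs → count vs vs ≤ length vs * d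
    erdős-gallai fuel [] _ u = z≤n
    erdős-gallai (suc fuel) vs@(v ∷ vs₀) l u
      with removable (suc d) u (ε {a = v}) ([] ∷ []) (here ≡.refl ∷ []) (m≤m+n (suc d) 0)
    ... | x , xs , ys , σ , h = begin
      count vs vs                                      ≡⟨ count-↭ σ ⟩
      count (L ++ ys) (L ++ ys)                        ≡⟨ count-++ L ys ⟩
      count L L + 2 * count L ys + count ys ys         ≤⟨ +-mono-≤ h (erdős-gallai fuel ys ys≤ (unique-++ʳ L (unique-resp-↭ σ u))) ⟩
      length L * d + length ys * d                     ≡⟨ *-distribʳ-+ d (length L) (length ys) ⟨
      (length L + length ys) * d                       ≡⟨ cong (_* d) (≡.trans (↭-length σ) (length-++ L)) ⟨
      length vs * d                                    ∎
      where
      open ≤-Reasoning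
      L = x ∷ xs
      ys≤ : length ys ≤ fuel
      ys≤ = s≤s⁻¹ (≤-trans (s≤s (m≤n+m (length ys) (length xs)))
        (subst (_≤ suc fuel) (≡.trans (↭-length σ) (length-++ L)) l))

-- Simple graphs and their cycles

adj? : ∀ {n} (G : Graph n) x y → Dec (Adj G x y)
adj? G x y = (x , y) ∈? G ⊎-dec (y , x) ∈? G
  where open DecMembership (≡-dec _≟_ _≟_) using (_∈?_)

adj-sym : ∀ {n} (G : Graph n) {x y} → Adj G x y → Adj G y x
adj-sym G (inj₁ p) = inj₂ p
adj-sym G (inj₂ p) = inj₁ p

data Simple {n} : Graph n → Set where
  []  : Simple []
  _∷_ : ∀ {G u v} → u ≢ v × ¬ Adj G u v → Simple G → Simple (addEdge u v G)

simple-irrefl : ∀ {n} {G : Graph n} → Simple G → ∀ {x} → ¬ Adj G x x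
simple-irrefl ((u≢v , _) ∷ s) (inj₁ (here refl)) = u≢v refl
simple-irrefl ((u≢v , _) ∷ s) (inj₂ (here refl)) = u≢v refl
simple-irrefl (_ ∷ s) (inj₁ (there p)) = simple-irrefl s (inj₁ p)
simple-irrefl (_ ∷ s) (inj₂ (there p)) = simple-irrefl s (inj₂ p)

-- Forgets the orientation of the new edge in the list, so that either end may be taken as the
-- first.
record Extends {n} (G : Graph n) (a b : Fin n) (H : Graph n) : Set where
  field
    old   : ∀ {x y} → Adj G x y → Adj H x y
    new   : Adj H a b
    cases : ∀ {x y} → Adj H x y → Adj G x y ⊎ SamePair a b x y

extends-addEdge : ∀ {n} (G : Graph n) a b → Extends G a b (addEdge a b G)
extends-addEdge G a b = record
  { old = λ { (inj₁ p) → inj₁ (there p) ; (inj₂ p) → inj₂ (there p) }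
  ; new = inj₁ (here refl)
  ; cases = λ { (inj₁ (here refl)) → inj₂ (inj₁ (refl , refl))
              ; (inj₁ (there p)) → inj₁ (inj₁ p)
              ; (inj₂ (here refl)) → inj₂ (inj₂ (refl , refl))
              ; (inj₂ (there p)) → inj₁ (inj₂ p) } }

extends-sym : ∀ {n} {G : Graph n} {a b H} → Extends G a b H → Extends G b a H
extends-sym {H = H} X = record
  { old = old ; new = adj-sym H new
  ; cases = λ h → [ inj₁ , (λ { (inj₁ p) → inj₂ (inj₂ p) ; (inj₂ p) → inj₂ (inj₁ p) }) ]′ (cases h) }
  where open Extends X

-- Closed paths, unlike functions on `Fin`, can be split, rotated and concatenated.
Cycle : ∀ {n} → Graph n → ℕ → Set
Cycle G ℓ = ∃₂ λ x xs → Path (Adj G) x xs x × Unique xs × length xs ≡ ℓ × 3 ≤ ℓ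

hasCycle⇒cycle : ∀ {n} {G : Graph n} ℓ → HasCycle G ℓ → Cycle G ℓ
hasCycle⇒cycle {G = G} (suc m) (2≤m , f , f-inj , steps , close) =
  f zero , tabulate f , walk f steps close , Unique.tabulate⁺ f-inj , length-tabulate f , s≤s 2≤m
  where
  walk : ∀ {m b} (f : Fin (suc m) → _) → (∀ i → Adj G (f (inject₁ i)) (f (suc i))) → Adj G (f (fromℕ m)) b →
         Path (Adj G) (f zero) (tabulate f) b
  walk {zero} f steps last = last ◅ ε
  walk {suc m} f steps last = steps zero ◅ walk (λ i → f (suc i)) (λ i → steps (suc i)) last

unique-lookup : ∀ {A : Set} {xs : List A} → Unique xs → ∀ {i j} → lookup xs i ≡ lookup xs j → i ≡ j
unique-lookup {xs = x ∷ xs} u {zero} {zero} eq = refl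
unique-lookup {xs = x ∷ xs} u {zero} {suc j} eq = ⊥-elim (unique-head u (subst (_∈ xs) (sym eq) (∈-lookup j)))
unique-lookup {xs = x ∷ xs} u {suc i} {zero} eq = ⊥-elim (unique-head u (subst (_∈ xs) eq (∈-lookup i)))
unique-lookup {xs = x ∷ xs} u {suc i} {suc j} eq = cong suc (unique-lookup (unique-tail u) eq)

cycle⇒hasCycle : ∀ {n} {G : Graph n} {ℓ} → Cycle G ℓ → HasCycle G ℓ
cycle⇒hasCycle {G = G} (x , y ∷ xs , P , u , refl , s≤s 2≤) =
  2≤ , lookup (y ∷ xs) , unique-lookup u , steps P , subst (Adj G _) (path-head P) (last P)
  where
  steps : ∀ {x y xs b} → Path (Adj G) x (y ∷ xs) b →
          ∀ i → Adj G (lookup (y ∷ xs) (inject₁ i)) (lookup (y ∷ xs) (suc i))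
  steps (e ◅ P@(_ ◅ _)) zero = e
  steps (e ◅ P@(_ ◅ _)) (suc i) = steps P i
  last : ∀ {x y xs b} → Path (Adj G) x (y ∷ xs) b → Adj G (lookup (y ∷ xs) (fromℕ (length xs))) b
  last (e ◅ ε) = e
  last (e ◅ P@(_ ◅ _)) = last P

-- Deciding the existence of paths and cycles

list-search : ∀ {n} m {P : List (Fin n) → Set} → (∀ xs → Dec (P xs)) → Dec (∃ λ xs → P xs × length xs ≡ m)
list-search zero {P} P? = map′ (λ p → [] , p , refl) (λ { ([] , p , _) → p }) (P? [])
list-search (suc m) {P} P? =
  map′ (λ { (x , xs , p , l) → x ∷ xs , p , cong suc l }) (λ { (x ∷ xs , p , refl) → x , xs , p , refl })
    (any? (λ x → list-search m (λ xs → P? (x ∷ xs))))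

path? : ∀ {n} {E : Fin n → Fin n → Set} → (∀ x y → Dec (E x y)) → ∀ a xs b → Dec (Path E a xs b)
path? E? a [] b = map′ (λ { refl → ε }) (λ { ε → refl }) (a ≟ b)
path? E? a (x ∷ []) b = map′ (λ { (refl , e) → e ◅ ε }) (λ { (e ◅ ε) → refl , e }) (a ≟ x ×-dec E? a b)
path? E? a (x ∷ y ∷ xs) b =
  map′ (λ { (refl , e , p) → e ◅ p }) (λ { (e ◅ p@(_ ◅ _)) → refl , e , p })
    (a ≟ x ×-dec E? a y ×-dec path? E? y (y ∷ xs) b)

unique? : ∀ {n} (xs : List (Fin n)) → Dec (Unique xs)
unique? [] = yes []
unique? (x ∷ xs) = map′ (λ (p , q) → unique-∷ p q) (λ u → unique-head u , unique-tail u) (¬? (x ∈? xs) ×-dec unique? xs)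
  where open DecMembership _≟_ using (_∈?_)

cycle? : ∀ {n} (G : Graph n) ℓ → Dec (Cycle G ℓ)
cycle? G ℓ = map′ (λ { (x , xs , (p , u , l) , eq) → x , xs , p , u , eq , l })
                  (λ { (x , xs , p , u , eq , l) → x , xs , (p , u , l) , eq })
  (any? (λ x → list-search ℓ (λ xs → path? (adj? G) x xs x ×-dec unique? xs ×-dec 3 ≤? ℓ)))

-- Counting edges by ordered pairs

module _ {n : ℕ} where

  private
    V : List (Fin n)
    V = allFin n

  adjSum : Graph n → ℕ
  adjSum G = sumOver V (λ x → sumOver V (λ y → indicator (adj? G x y)))

  sumOver-member : ∀ {A : Set} {xs : List A} {x} f → x ∈ xs → f x ≤ sumOver xs f
  sumOver-member f (here refl) = m≤m+n _ _
  sumOver-member {xs = y ∷ ys} f (there x∈) = ≤-trans (sumOver-member f x∈) (m≤n+m _ (f y))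

  adjSum-edge : ∀ {G u v} → u ≢ v → ¬ Adj G u v → 2 + adjSum G ≤ adjSum (addEdge u v G)
  adjSum-edge {G} {u} {v} u≢v ¬uv = begin
    1 + (1 + adjSum G)
      ≤⟨ +-mono-≤ (one u v) (+-monoˡ-≤ (adjSum G) (one v u)) ⟩
    pairs u v + (pairs v u + adjSum G)
      ≡⟨ cong (pairs u v +_) (sum₂-+ (is v u) (λ x y → indicator (adj? G x y))) ⟨
    pairs u v + sumOver V (λ x → sumOver V (λ y → is v u x y + indicator (adj? G x y)))
      ≡⟨ sum₂-+ (is u v) _ ⟨
    sumOver V (λ x → sumOver V (λ y → is u v x y + (is v u x y + indicator (adj? G x y))))
      ≤⟨ sumOver-mono V (λ {x} _ → sumOver-mono V (λ {y} _ → pointwise x y)) ⟩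
    adjSum (addEdge u v G) ∎
    where
    open ≤-Reasoning
    is : Fin n → Fin n → Fin n → Fin n → ℕ
    is u v x y = indicator (x ≟ u ×-dec y ≟ v)
    pairs : Fin n → Fin n → ℕ
    pairs u v = sumOver V (λ x → sumOver V (is u v x))
    sum₂-+ : ∀ (f g : Fin n → Fin n → ℕ) → sumOver V (λ x → sumOver V (λ y → f x y + g x y)) ≡
             sumOver V (λ x → sumOver V (f x)) + sumOver V (λ x → sumOver V (g x))
    sum₂-+ f g = ≡.trans (sumOver-cong V (λ x → sumOver-+ V (f x) (g x))) (sumOver-+ V _ _)
    one : ∀ u v → 1 ≤ pairs u v
    one u v = begin
      1                     ≡⟨ indicator-yes (u ≟ u ×-dec v ≟ v) (refl , refl) ⟨
      is u v u v            ≤⟨ sumOver-member (is u v u) (∈-allFin v) ⟩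
      sumOver V (is u v u)  ≤⟨ sumOver-member (λ x → sumOver V (is u v x)) (∈-allFin u) ⟩
      pairs u v             ∎
    pointwise : ∀ x y → is u v x y + (is v u x y + indicator (adj? G x y)) ≤ indicator (adj? (addEdge u v G) x y)
    pointwise x y with x ≟ u ×-dec y ≟ v | x ≟ v ×-dec y ≟ u | adj? G x y
    ... | yes (refl , refl) | yes (refl , _) | _ = ⊥-elim (u≢v refl)
    ... | yes (refl , refl) | _ | yes h = ⊥-elim (¬uv h)
    ... | no _ | yes (refl , refl) | yes h = ⊥-elim (¬uv (adj-sym G h))
    ... | yes (refl , refl) | no _ | no _ = ≤-reflexive (sym (indicator-yes (adj? (addEdge u v G) x y) (inj₁ (here refl))))
    ... | no _ | yes (refl , refl) | no _ = ≤-reflexive (sym (indicator-yes (adj? (addEdge u v G) x y) (inj₂ (here refl))))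
    ... | no _ | no _ | yes h = ≤-reflexive (sym (indicator-yes (adj? (addEdge u v G) x y) (Extends.old (extends-addEdge G u v) h)))
    ... | no _ | no _ | no _ = z≤n

  2*edges≤adjSum : ∀ {G : Graph n} → Simple G → 2 * numEdges G ≤ adjSum G
  2*edges≤adjSum [] = z≤n
  2*edges≤adjSum (_∷_ {G} {u} {v} (u≢v , ¬uv) s) = begin
    2 * suc (numEdges G)   ≡⟨ *-suc 2 (numEdges G) ⟩
    2 + 2 * numEdges G     ≤⟨ +-monoʳ-≤ 2 (2*edges≤adjSum s) ⟩
    2 + adjSum G           ≤⟨ adjSum-edge u≢v ¬uv ⟩
    adjSum (addEdge u v G) ∎
    where open ≤-Reasoning

  length-allFin : length V ≡ n
  length-allFin = length-tabulate (λ i → i)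

  -- A crude bound that makes the game finite.
  edges≤n*n : ∀ {G : Graph n} → Simple G → numEdges G ≤ n * n
  edges≤n*n {G} s = begin
    numEdges G                        ≤⟨ m≤m+n _ _ ⟩
    2 * numEdges G                    ≤⟨ 2*edges≤adjSum s ⟩
    adjSum G                          ≤⟨ sumOver-mono V (λ {x} _ → sumOver-mono V (λ {y} _ → indicator≤1 (adj? G x y))) ⟩
    sumOver V (λ _ → sumOver V (λ _ → 1)) ≡⟨ sumOver-cong V (λ _ → ≡.trans (sumOver-const V 1) (≡.trans (*-identityʳ _) length-allFin)) ⟩
    sumOver V (λ _ → n)               ≡⟨ sumOver-const V n ⟩
    length V * n                      ≡⟨ cong (_* n) length-allFin ⟩
    n * n                             ∎
    where open ≤-Reasoning

-- Rooted tree structures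

-- Bookkeeping separate from the graph: `par x` need not be adjacent to `x`, every vertex has a
-- depth from the start, and `par root` is arbitrary.
record Shape (n : ℕ) : Set where
  field
    root     : Fin n
    par      : Fin n → Fin n
    dep      : Fin n → ℕ
    dep-root : dep root ≡ 0
    dep-par  : ∀ {x} → x ≢ root → dep x ≡ suc (dep (par x))

module ShapeLemmas {n} (S : Shape n) where
  open Shape S public

  Child : Fin n → Fin n → Set
  Child p x = x ≢ root × par x ≡ p

  child? : ∀ p x → Dec (Child p x)
  child? p x = ¬? (x ≟ root) ×-dec par x ≟ p

  child-dep : ∀ {p x} → Child p x → dep x ≡ suc (dep p)
  child-dep (x≢r , refl) = dep-par x≢r

  child≢parent : ∀ {p x} → Child p x → x ≢ p
  child≢parent c refl = 1+n≢n (sym (child-dep c))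

  data Up : ℕ → Fin n → Fin n → Set where
    stop : ∀ {a} → Up 0 a a
    step : ∀ {t a b} → a ≢ root → Up t (par a) b → Up (suc t) a b

  up-dep : ∀ {t a b} → Up t a b → dep a ≡ t + dep b
  up-dep stop = refl
  up-dep (step a≢r u) = trans (dep-par a≢r) (cong suc (up-dep u))

  up-unique : ∀ {t a b c} → Up t a b → Up t a c → b ≡ c
  up-unique stop stop = refl
  up-unique (step _ u) (step _ v) = up-unique u v

  up-nonroot : ∀ {t a b} → Up t a b → t ≢ 0 → a ≢ root
  up-nonroot stop t≢0 = ⊥-elim (t≢0 refl)
  up-nonroot (step a≢r _) _ = a≢r

  Below : Fin n → Fin n → Set
  Below c y = ∃ λ t → Up (suc t) y c

  below-dep : ∀ {c y} → Below c y → dep c < dep y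
  below-dep {c} (t , u) = subst (dep c <_) (sym (up-dep u)) (s≤s (m≤n+m (dep c) t))

  below-disjoint : ∀ {c d y} → c ≢ d → dep c ≡ dep d → Below c y → Below d y → ⊥
  below-disjoint {c} {d} c≢d eq (t , u) (s , v)
    with suc-injective (+-cancelʳ-≡ (dep d) (suc t) (suc s)
           (trans (sym (trans (up-dep u) (cong (suc t +_) eq))) (up-dep v)))
  ... | refl = c≢d (up-unique u v)

  -- In `fork`, `c` and `d` are the ancestors of `a` and `b`, or these vertices themselves, just
  -- below the lowest common ancestor.
  data Related (a b : Fin n) : Set where
    above : ∀ {t} → Up (suc t) a b → Related a b
    below : ∀ {t} → Up (suc t) b a → Related a b
    fork  : ∀ {i j c d} → Up i a c → Up j b d → Child (par d) c → d ≢ root → c ≢ d → Related a b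

  related-sym : ∀ {a b} → Related a b → Related b a
  related-sym (above u) = below u
  related-sym (below u) = above u
  related-sym (fork u v (c≢r , eq) d≢r c≢d) = fork v u (d≢r , sym eq) c≢r (λ e → c≢d (sym e))

  deeper≢root : ∀ {a m} → m < dep a → a ≢ root
  deeper≢root h refl = <⇒≢ (≤-trans (s≤s z≤n) h) (sym dep-root)

  -- Induction on the sum of the depths: the deeper vertex is replaced by its parent, and at equal
  -- depth both are.
  related-bounded : ∀ f {a b} → dep a + dep b ≤ f → a ≢ b → Related a b
  related-below : ∀ f {a b} → dep a + dep b ≤ suc f → dep b < dep a → Related a b

  related-below f {a} {b} h lt with deeper≢root lt | par a ≟ b
  ... | a≢r | yes refl = above (step a≢r stop)
  ... | a≢r | no pa≢b with related-bounded f (s≤s⁻¹ (subst (λ m → m + dep b ≤ suc f) (dep-par a≢r) h)) pa≢b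
  ... | above u = above (step a≢r u)
  ... | fork u v ch d≢r c≢d = fork (step a≢r u) v ch d≢r c≢d
  ... | below {t} u = ⊥-elim (<⇒≱ lt (subst (dep a ≤_) (sym (trans (up-dep u) (trans (sym (+-suc t _)) (cong (t +_) (sym (dep-par a≢r))))))
                        (m≤n+m (dep a) t)))

  related-bounded f {a} {b} h a≢b with <-cmp (dep a) (dep b)
  related-bounded zero h a≢b | tri< lt _ _ = ⊥-elim (<⇒≱ (≤-trans (s≤s z≤n) lt) (≤-trans (m≤n+m _ _) h))
  related-bounded zero h a≢b | tri> _ _ gt = ⊥-elim (<⇒≱ (≤-trans (s≤s z≤n) gt) (≤-trans (m≤m+n _ _) h))
  related-bounded (suc f) {a} {b} h a≢b | tri< lt _ _ = related-sym (related-below f (subst (_≤ suc f) (+-comm (dep a) (dep b)) h) lt)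
  related-bounded (suc f) h a≢b | tri> _ _ gt = related-below f h gt
  related-bounded f {a} {b} h a≢b | tri≈ _ eq _ with a ≟ root | b ≟ root
  ... | yes refl | yes refl = ⊥-elim (a≢b refl)
  ... | yes refl | no b≢r = ⊥-elim (0≢1+n (trans (sym dep-root) (trans eq (dep-par b≢r))))
  ... | no a≢r | yes refl = ⊥-elim (0≢1+n (trans (sym dep-root) (trans (sym eq) (dep-par a≢r))))
  ... | no a≢r | no b≢r with par a ≟ par b
  ... | yes e = fork stop stop (a≢r , e) b≢r a≢b
  related-bounded zero {a} {b} h a≢b | tri≈ _ eq _ | no a≢r | no b≢r | no _ =
    ⊥-elim (<⇒≱ (subst (0 <_) (sym (dep-par a≢r)) (s≤s z≤n)) (≤-trans (m≤m+n _ _) h))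
  related-bounded (suc f) {a} {b} h a≢b | tri≈ _ eq _ | no a≢r | no b≢r | no e
    with related-bounded f (≤-trans (+-mono-≤ (≤-reflexive refl) (n≤1+n (dep (par b))))
           (s≤s⁻¹ (subst (_≤ suc f) (cong₂ _+_ (dep-par a≢r) (dep-par b≢r)) h))) e
  ... | fork u v ch d≢r c≢d = fork (step a≢r u) (step b≢r v) ch d≢r c≢d
  ... | above {t} u = ⊥-elim (m+1+n≢n t (trans (+-suc t _) (trans (sym (up-dep u)) eq′)))
    where
    eq′ : dep (par a) ≡ dep (par b)
    eq′ = suc-injective (trans (sym (dep-par a≢r)) (trans eq (dep-par b≢r)))
  ... | below {t} u = ⊥-elim (m+1+n≢n t (trans (+-suc t _) (trans (sym (up-dep u)) (sym eq′))))
    where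
    eq′ : dep (par a) ≡ dep (par b)
    eq′ = suc-injective (trans (sym (dep-par a≢r)) (trans eq (dep-par b≢r)))

  related : ∀ {a b} → a ≢ b → Related a b
  related = related-bounded _ ≤-refl

  EdgeOK : Fin n → Fin n → Set
  EdgeOK x y = Child y x ⊎ Child x y ⊎ (Child (par y) x × y ≢ root)

  edgeOK-sym : ∀ {x y} → EdgeOK x y → EdgeOK y x
  edgeOK-sym (inj₁ c) = inj₂ (inj₁ c)
  edgeOK-sym (inj₂ (inj₁ c)) = inj₁ c
  edgeOK-sym (inj₂ (inj₂ ((x≢r , eq) , y≢r))) = inj₂ (inj₂ ((y≢r , sym eq) , x≢r))

  module _ {E : Fin n → Fin n → Set} (ok : ∀ {x y} → E x y → EdgeOK x y) where

    below-step : ∀ {x y w} → Below x y → E y w → w ≡ x ⊎ Below x w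
    below-step (t , u) f with ok f
    below-step (zero , step _ stop) f | inj₁ (_ , refl) = inj₁ refl
    below-step (suc t , step _ u) f | inj₁ (_ , refl) = inj₂ (t , u)
    below-step (t , u) f | inj₂ (inj₁ (w≢r , refl)) = inj₂ (suc t , step w≢r u)
    below-step (t , step _ u) f | inj₂ (inj₂ ((_ , eq) , w≢r)) = inj₂ (t , step w≢r (subst (λ p → Up t p _) eq u))

    -- The only way out of the subtree below `x` is through `x` itself.
    stuck-below : ∀ {x y ys q} → Below x y → Path E y ys q → x ∉ ys → q ≢ x → Below x q
    stuck-below b ε x∉ q≢x = b
    stuck-below b (f ◅ P) x∉ q≢x with below-step b f
    stuck-below b (f ◅ ε) x∉ q≢x | inj₁ refl = ⊥-elim (q≢x refl)
    stuck-below b (f ◅ (_ ◅ _)) x∉ q≢x | inj₁ refl = ⊥-elim (x∉ (there (here refl)))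
    ... | inj₂ b′ = stuck-below b′ P (λ r → x∉ (there r)) q≢x

    -- A path among the descendants of p ending in p cannot descend below a child x
    -- of p, since it would have to come back through x.
    confined : ∀ {x xs p} → Child p x → Path E x xs p → Unique xs → p ∉ xs → All (Child p) xs
    confined ch ε u p∉ = []
    confined {x} {p = p} ch (_◅_ {b = y} f P) u p∉ with y ≟ p | ok f
    ... | yes refl | _ = ch ∷ returned P (λ r → p∉ (there r))
      where
      returned : ∀ {ys} → Path E p ys p → p ∉ ys → All (Child p) ys
      returned ε _ = []
      returned (_ ◅ _) q∉ = ⊥-elim (q∉ (here refl))
    ... | no y≢p | inj₁ (_ , eq) = ⊥-elim (y≢p (trans (sym eq) (proj₂ ch)))
    ... | no y≢p | inj₂ (inj₁ (y≢r , eq)) = ⊥-elim (<-asym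
          (below-dep (stuck-below (0 , step y≢r (subst (λ q → Up 0 q x) (sym eq) stop)) P (unique-head u) (λ e → p∉ (here e))))
          (subst (dep p <_) (sym (child-dep ch)) (n<1+n (dep p))))
    ... | no y≢p | inj₂ (inj₂ ((_ , eq) , y≢r)) =
      ch ∷ confined (y≢r , trans (sym eq) (proj₂ ch)) P (unique-tail u) (λ r → p∉ (there r))

-- Paths of every length along closed vertices

Flex : ∀ {V : Set} → (V → V → Set) → (V → Set) → V → V → ℕ → ℕ → Set
Flex E R a b lo hi = ∀ m → lo ≤ m → m ≤ hi → ∃ λ xs → Path E a xs b × Unique xs × All R xs × length xs ≡ m

flex-++ : ∀ {V : Set} {E : V → V → Set} {R₁ R₂ R : V → Set} {a b c l₁ h₁ l₂ h₂} →
          l₁ ≤ h₁ → l₂ ≤ h₂ → (∀ {x} → R₁ x → R₂ x → ⊥) → (∀ {x} → R₁ x → R x) → (∀ {x} → R₂ x → R x) →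
          Flex E R₁ a b l₁ h₁ → Flex E R₂ b c l₂ h₂ → Flex E R a c (l₁ + l₂) (h₁ + h₂)
flex-++ lh₁ lh₂ dis in₁ in₂ F G m lo hi with between-sum lh₁ lh₂ lo hi
... | i , j , refl , (l₁≤ , ≤h₁) , (l₂≤ , ≤h₂) with F i l₁≤ ≤h₁ | G j l₂≤ ≤h₂
... | xs , P , u , as , refl | ys , Q , v , bs , refl =
  xs ++ ys , P ◅◅ Q , unique-++ u v (λ p q → dis (All.lookup as p) (All.lookup bs q)) ,
  All.++⁺ (All.map in₁ as) (All.map in₂ bs) , length-++ xs

module Trees (κ : ℕ) where

  W : ℕ
  W = 3 + κ

  -- c starts a path of k - 2 vertices among the children of its parent; hence all lengths
  -- from 2 to k - 1 occur on the way from c to its parent.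
  Closed : ∀ {n} → Shape n → Graph n → Fin n → Set
  Closed S G c = c ≢ root × ∃ λ xs → (Path (Adj G) c xs (par c) × Unique xs ×
                   All (λ x → Child (par c) x × Adj G x (par c)) xs) × length xs ≡ W
    where open ShapeLemmas S

  closed? : ∀ {n} (S : Shape n) (G : Graph n) c → Dec (Closed S G c)
  closed? S G c = ¬? (c ≟ root) ×-dec list-search W (λ xs → path? (adj? G) c xs (par c) ×-dec unique? xs ×-dec
                    All.all? (λ x → child? (par c) x ×-dec adj? G x (par c)) xs)
    where open ShapeLemmas S

  -- Isolated vertices are included: they are regarded as children of the root too.
  Unattached : ∀ {n} → Shape n → Graph n → Fin n → Set
  Unattached S G v = Child root v × ¬ Adj G v root
    where open ShapeLemmas S

  unattached? : ∀ {n} (S : Shape n) (G : Graph n) v → Dec (Unattached S G v)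
  unattached? S G v = child? root v ×-dec ¬? (adj? G v root)
    where open ShapeLemmas S

  record Tree {n} (S : Shape n) (G : Graph n) : Set where
    open ShapeLemmas S
    field
      edges         : ∀ {x y} → Adj G x y → EdgeOK x y
      attached      : ∀ {x} → x ≢ root → par x ≢ root → Adj G x (par x)
      closed-parent : ∀ {x} → x ≢ root → par x ≢ root → Closed S G (par x)

  module TreeLemmas {n} {S : Shape n} {G : Graph n} (T : Tree S G) where
    open ShapeLemmas S public
    open Tree T public

    symG : ∀ {x y} → Adj G x y → Adj G y x
    symG = adj-sym G

    adj-parent : ∀ {x} → x ≢ root → ¬ Unattached S G x → Adj G x (par x)
    adj-parent {x} x≢r ¬un with par x ≟ root
    ... | no p≢r = attached x≢r p≢r
    ... | yes eq with adj? G x (par x)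
    ... | yes h = h
    ... | no ¬h = ⊥-elim (¬un ((x≢r , eq) , λ h → ¬h (subst (Adj G x) (sym eq) h)))

    closed-attached : ∀ {c} → Closed S G c → Adj G c (par c)
    closed-attached (c≢r , [] , _ , ())
    closed-attached (c≢r , x ∷ xs , (P , _ , (_ , h) ∷ _) , _) with path-head P
    ... | refl = h

    -- A parent other than the root is closed, and the path witnessing closedness begins with the
    -- closed vertex, which is therefore attached.
    unattached-childless : ∀ {x y} → Unattached S G x → Child x y → ⊥
    unattached-childless ((x≢r , eq) , ¬h) (y≢r , refl) =
      ¬h (subst (Adj G _) eq (closed-attached (closed-parent y≢r x≢r)))

    unattached-neighbour : ∀ {x y} → Unattached S G x → Adj G x y → Child root y
    unattached-neighbour un@((x≢r , eq) , ¬h) h with edges h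
    ... | inj₁ (_ , refl) = ⊥-elim (¬h (subst (Adj G _) eq h))
    ... | inj₂ (inj₁ ch) = ⊥-elim (unattached-childless un ch)
    ... | inj₂ (inj₂ ((_ , e) , y≢r)) = y≢r , trans (sym e) eq

    parent∉children : ∀ {p} {Q : Fin n → Set} {xs} → All (λ x → Child p x × Q x) xs → p ∉ xs
    parent∉children as p∈ = child≢parent (proj₁ (All.lookup as p∈)) refl

    closed-flex : ∀ {c} → Closed S G c → Flex (Adj G) (Child (par c)) c (par c) 1 W
    closed-flex (_ , xs , (P , u , as) , l) m lo hi
      with fan-prefix P (All.map proj₂ as) lo (subst (m ≤_) (sym l) hi)
    ... | ys , zs , refl , l′ , Q = ys , Q , unique-++ˡ ys u , All.map proj₁ (All.++⁻ˡ ys as) , l′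

    Around : Fin n → Fin n → Set
    Around p y = y ≡ p ⊎ (Child p y × Adj G y p)

    around-dep : ∀ {p y} → Around p y → dep y ≤ suc (dep p)
    around-dep (inj₁ refl) = n≤1+n _
    around-dep (inj₂ (ch , _)) = ≤-reflexive (child-dep ch)

    closed-cross : ∀ {c d} → Closed S G c → Child (par c) d → d ≢ c → Adj G d (par c) →
                   Flex (Adj G) (λ y → y ≢ d × Around (par c) y) c d 2 W
    closed-cross {c} {d} (_ , xs , (P , u , as) , l) ch d≢c h m lo hi
      with fan-cross symG P (All.map proj₂ as) u (parent∉children as) (symG h) d≢c (child≢parent ch) (d ∈? xs)
             lo (subst (m ≤_) (sym l) hi)
      where open DecMembership _≟_ using (_∈?_)
    ... | ys , Q , v , d∉ , bs , l′ = ys , Q , v ,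
      All.tabulate (λ {y} y∈ → (λ { refl → d∉ y∈ }) ,
        [ inj₁ , (λ q → inj₂ (All.lookup as q)) ]′ (All.lookup bs y∈)) , l′

    -- The depth bound serves disjointness: what follows the first level of a climb stays strictly
    -- closer to the root than that level.
    Between : Fin n → Fin n → Fin n → Set
    Between x c y = Below c y × dep y ≤ dep x

    -- Each of the `t` levels contributes between 1 and `W` vertices, by `closed-flex`.
    climb : ∀ {t x c} → Up t x c → (t ≢ 0 → Closed S G x) → Flex (Adj G) (Between x c) x c t (t * W)
    climb stop cl zero lo hi = [] , ε , [] , [] , refl
    climb {suc t} {x} {c} (step x≢r u) cl =
      flex-++ (s≤s z≤n) (m≤m*n t W) disjoint first rest (closed-flex (cl (λ ()))) (climb u parent-closed)
      where
      parent-closed : t ≢ 0 → Closed S G (par x)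
      parent-closed t≢0 = closed-parent x≢r (up-nonroot u t≢0)
      disjoint : ∀ {y} → Child (par x) y → Between (par x) c y → ⊥
      disjoint ch (_ , le) = <⇒≱ (≤-reflexive (sym (child-dep ch))) le
      first : ∀ {y} → Child (par x) y → Between x c y
      first ch@(y≢r , eq) = (t , step y≢r (subst (λ p → Up t p c) (sym eq) u)) ,
        ≤-reflexive (trans (child-dep ch) (sym (dep-par x≢r)))
      rest : ∀ {y} → Between (par x) c y → Between x c y
      rest (b , le) = b , ≤-trans le (≤-trans (n≤1+n _) (≤-reflexive (sym (dep-par x≢r))))

    -- The start `a` need not be closed, so its own level contributes exactly one vertex; the `t`
    -- levels above contribute up to `W` each.
    ascend : ∀ {t a c} → Up (suc t) a c → Adj G a (par a) → Flex (Adj G) (Below c) a c (1 + t) (1 + t * W)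
    ascend {t} {a} {c} (step a≢r u) h =
      flex-++ (s≤s z≤n) (m≤m*n t W) disjoint first proj₁ start (climb u parent-closed)
      where
      parent-closed : t ≢ 0 → Closed S G (par a)
      parent-closed t≢0 = closed-parent a≢r (up-nonroot u t≢0)
      start : Flex (Adj G) (_≡ a) a (par a) 1 1
      start (suc zero) lo hi = a ∷ [] , h ◅ ε , [] ∷ [] , refl ∷ [] , refl
      start (suc (suc m)) lo (s≤s ())
      disjoint : ∀ {y} → y ≡ a → Between (par a) c y → ⊥
      disjoint refl (_ , le) = <⇒≱ (≤-reflexive (sym (dep-par a≢r))) le
      first : ∀ {y} → y ≡ a → Below c y
      first refl = t , step a≢r u

-- Moves between distant vertices

module DistantMoves (κ : ℕ) (𝒞 : CycleFamily) (𝒞-k : 𝒞 (5 + κ))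
  (dense : ∀ s → ∃ λ ℓ → 5 + s ≤ ℓ × ℓ ≤ 3 + suc s * (3 + κ) × 𝒞 ℓ) where

  open Trees κ

  k : ℕ
  k = 5 + κ

  module _ {n} {G H : Graph n} {a b : Fin n} (X : Extends G a b H) where
    open Extends X

    meet : ∀ {d xs ys} → Path (Adj G) a xs d → Path (Adj G) b ys d → Unique xs → Unique ys →
           (∀ {x} → x ∈ xs → x ∈ ys → ⊥) → d ∉ xs → d ∉ ys → 2 ≤ length xs + length ys →
           Cycle H (suc (length xs + length ys))
    meet {d} {xs} {ys} P Q u v dis d∉xs d∉ys 2≤
      with path-reverse (adj-sym H) (path-map (λ _ _ → old) Q) (adj-sym H new ◅ ε)
    ... | zs , R , σ₀ = a , xs ++ d ∷ zs , path-map (λ _ _ → old) P ◅◅ R ,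
      unique-++ u (unique-∷ (λ r → d∉ys (∈-resp-↭ σ r)) (unique-resp-↭ (↭-sym σ) v))
        (λ { p (here refl) → d∉xs p ; p (there q) → dis p (∈-resp-↭ σ q) }) ,
      trans (length-++ xs) (trans (+-suc (length xs) (length zs)) (cong (λ m → suc (length xs + m)) (↭-length σ))) , s≤s 2≤
      where
      σ : zs ↭ ys
      σ = subst (zs ↭_) (++-identityʳ ys) σ₀

    CycleRange : ℕ → ℕ → Set
    CycleRange lo hi = ∀ ℓ → lo ≤ ℓ → ℓ ≤ hi → Cycle H ℓ

    range-k : ∀ {lo hi} → lo ≤ k → k ≤ hi → CycleRange lo hi → ContainsMember 𝒞 H
    range-k p q F = k , 𝒞-k , cycle⇒hasCycle (F k p q)

    range-dense : ∀ {lo hi} s → lo ≤ 5 + s → 3 + suc s * W ≤ hi → CycleRange lo hi → ContainsMember 𝒞 H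
    range-dense s p q F with dense s
    ... | ℓ , lo , hi , c = ℓ , c , cycle⇒hasCycle (F ℓ (≤-trans p lo) (≤-trans hi q))

    meet-at-end : ∀ {R lo hi} → Flex (Adj G) R a b (2 + lo) hi → ¬ R b → CycleRange (3 + lo) (suc hi)
    meet-at-end {R} F b∉ (suc ℓ) (s≤s lo) (s≤s hi) with F ℓ lo hi
    ... | xs , P , u , as , refl =
      subst (Cycle H) (cong suc (+-identityʳ (length xs)))
        (meet P ε u [] (λ _ ()) (λ r → b∉ (All.lookup as r)) (λ ())
          (subst (2 ≤_) (sym (+-identityʳ (length xs))) (≤-trans (m≤m+n 2 _) lo)))

    meet-in-middle : ∀ {d R₁ R₂ l₁ h₁ l₂ h₂} → Flex (Adj G) R₁ a d (2 + l₁) h₁ → Flex (Adj G) R₂ b d l₂ h₂ →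
                     2 + l₁ ≤ h₁ → l₂ ≤ h₂ → (∀ {x} → R₁ x → R₂ x → ⊥) → ¬ R₁ d → ¬ R₂ d →
                     CycleRange (3 + l₁ + l₂) (suc (h₁ + h₂))
    meet-in-middle F₁ F₂ lh₁ lh₂ dis d∉₁ d∉₂ (suc ℓ) (s≤s lo) (s≤s hi) with between-sum lh₁ lh₂ lo hi
    ... | i , j , refl , (l₁≤ , ≤h₁) , (l₂≤ , ≤h₂) with F₁ i l₁≤ ≤h₁ | F₂ j l₂≤ ≤h₂
    ... | xs , P , u , as , refl | ys , Q , v , bs , refl =
      meet P Q u v (λ p q → dis (All.lookup as p) (All.lookup bs q)) (λ r → d∉₁ (All.lookup as r))
        (λ r → d∉₂ (All.lookup bs r)) (≤-trans (≤-trans (m≤m+n 2 _) l₁≤) (m≤m+n _ _))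

  module _ {n} {S : Shape n} {G : Graph n} (T : Tree S G) where
    open TreeLemmas T

    parent-of-closed : ∀ {t a c} → Up (suc t) a c → c ≢ root → Closed S G c
    parent-of-closed (step a≢r stop) c≢r = closed-parent a≢r c≢r
    parent-of-closed (step _ u@(step _ _)) c≢r = parent-of-closed u c≢r

    parent≢root : ∀ {t a c} → Up (suc t) a c → c ≢ root → par a ≢ root
    parent≢root (step _ stop) c≢r = c≢r
    parent≢root (step _ (step p≢r _)) _ = p≢r

    -- Every other move closes cycles of all lengths in an interval that contains k or
    -- meets 𝒞 by density.
    data Local (a b : Fin n) : Set where
      attach  : Unattached S G a → b ≡ root → Local a b
      sibling : Child (par b) a → b ≢ root → Local a b
      hang    : a ≢ root → par a ≢ root → Unattached S G b → (∀ y → ¬ Adj G b y) → Local a b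

    module _ {H : Graph n} (free : ¬ ContainsMember 𝒞 H)
             (independent : ∀ {v w} → Unattached S G v → Unattached S G w → ¬ Adj G v w)
             (normal : ∀ {v c} → Unattached S G v → Adj G v c → ¬ Closed S G c) where

      -- An edge to the vertex two levels up closes all lengths from 3 to k. From `3 + t` levels the
      -- lengths run from `4 + t` to `2 + (2 + t) * W`, which covers the dense interval for `t`.
      up-local : ∀ {a b t} → Extends G a b H → ¬ Adj G a b → Up (suc t) a b → Local a b
      up-local {a} X ¬ab (step a≢r stop) with unattached? S G a
      ... | yes un = attach un (proj₂ (proj₁ un))
      ... | no ¬un = ⊥-elim (¬ab (adj-parent a≢r ¬un))
      up-local {a} {b} X ¬ab up@(step {t = suc t} a≢r (step p≢r _)) = ⊥-elim (free (reach t up))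
        where
        b∉ : ¬ Below b b
        b∉ q = <-irrefl refl (below-dep q)
        reach : ∀ t → Up (2 + t) a b → ContainsMember 𝒞 H
        reach zero up = range-k X (s≤s (s≤s (s≤s z≤n))) (≤-reflexive (cong (2 +_) (sym (*-identityˡ W))))
          (meet-at-end X (ascend up (attached a≢r p≢r)) b∉)
        reach (suc t) up = range-dense X t (n≤1+n _) (+-monoʳ-≤ 2 (+-monoˡ-≤ (suc t * W) (s≤s (z≤n {2 + κ}))))
          (meet-at-end X (ascend up (attached a≢r p≢r)) b∉)

      -- The route from `a` climbs to `c`, which is closed because it has descendants, and crosses
      -- through the common parent to a sibling. The cases differ in how `b` is reached from there.
      fork-local : ∀ {a b c d i j} → Extends G a b H → Up (suc i) a c → Up j b d →
                   Child (par d) c → d ≢ root → c ≢ d → Local a b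
      fork-local {a} {b} {c} {d} {i} {j} X up-a up-b (c≢r , eq) d≢r c≢d = go up-b
        where
        c-closed : Closed S G c
        c-closed = parent-of-closed up-a c≢r
        a-attached : Adj G a (par a)
        a-attached = attached a≢r (parent≢root up-a c≢r)
          where
          a≢r : a ≢ root
          a≢r = up-nonroot up-a (λ ())
        d-dep : dep c ≡ dep d
        d-dep = trans (dep-par c≢r) (trans (cong suc (cong dep eq)) (sym (dep-par d≢r)))
        Half : Fin n → Fin n → Set
        Half d y = Below c y ⊎ (y ≢ d × Around (par c) y)
        low : ∀ {y} → Around (par c) y → dep y ≤ dep c
        low r = ≤-trans (around-dep r) (≤-reflexive (sym (dep-par c≢r)))
        half : ∀ {d} → Child (par c) d → d ≢ c → Adj G d (par c) →
               Flex (Adj G) (Half d) a d (1 + i + 2) (1 + i * W + W)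
        half ch d≢c h = flex-++ (s≤s (m≤m*n i W)) (s≤s (s≤s z≤n)) (λ p q → <⇒≱ (below-dep p) (low (proj₂ q))) inj₁ inj₂
          (ascend up-a a-attached) (closed-cross c-closed ch d≢c h)
        not-half : ∀ {d} → Child (par c) d → ¬ Half d d
        not-half ch (inj₁ p) = <⇒≢ (below-dep p) (trans (dep-par c≢r) (sym (child-dep ch)))
        not-half ch (inj₂ (d≢d , _)) = d≢d refl
        half-size : 1 + i + 2 ≡ 2 + (1 + i)
        half-size = solve 1 (λ x → con 1 :+ x :+ con 2 := con 2 :+ (con 1 :+ x)) refl i
          where open +-*-Solver
        half′ : ∀ {d} → Child (par c) d → d ≢ c → Adj G d (par c) →
                Flex (Adj G) (Half d) a d (2 + (1 + i)) (1 + i * W + W)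
        half′ {d} ch d≢c h = subst (λ l → Flex (Adj G) (Half d) a d l (1 + i * W + W)) half-size (half ch d≢c h)
        d-child : Child (par c) d
        d-child = d≢r , sym eq
        -- For `i = 0` the range ends at `2 + W = k`; for `i = suc i′` it covers the dense interval
        -- for `i′`.
        near : ∀ i′ → i′ ≡ i → (∀ {lo hi} → lo ≡ 4 + i′ → hi ≡ 2 + (W + i′ * W) → CycleRange X lo hi) → ContainsMember 𝒞 H
        near zero _ F = range-k X (s≤s (s≤s (s≤s (s≤s z≤n)))) (≤-reflexive (cong (2 +_) (sym (+-identityʳ W)))) (F refl refl)
        near (suc i′) _ F = range-dense X i′ ≤-refl (+-monoʳ-≤ 2 (+-monoˡ-≤ (suc i′ * W) (s≤s (z≤n {2 + κ})))) (F refl refl)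
        go : ∀ {j} → Up j b d → Local a b
        go stop with unattached? S G b
        ... | no ¬un = ⊥-elim (free (near i refl (λ { refl refl → subst (CycleRange X (4 + i)) (cong (2 +_) (+-comm (i * W) W))
                (meet-at-end X (half′ d-child (λ e → c≢d (sym e)) (subst (Adj G b) (sym eq) (adj-parent d≢r ¬un)))
                  (not-half d-child)) })))
        ... | yes un with any? (adj? G b)
        ...   | no iso = hang (up-nonroot up-a (λ ())) (parent≢root up-a c≢r) un (λ y h → iso (y , h))
        -- An unattached `b` is reached through a neighbour `d′`, which is attached by `independent`
        -- and differs from the closed `c` by `normal`. The extra vertex makes the range exactly the
        -- dense interval for `i`.
        ...   | yes (d′ , h) = ⊥-elim (free (range-dense X i (≤-reflexive (cong (4 +_) (+-comm i 1))) (≤-reflexive hi-eq)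
                  (meet-at-end X longer b∉)))
          where
          par-c : par c ≡ root
          par-c = trans eq (proj₂ (proj₁ un))
          d′-child : Child (par c) d′
          d′-child with unattached-neighbour un h
          ... | d′≢r , e = d′≢r , trans e (sym par-c)
          d′-attached : Adj G d′ (par c)
          d′-attached with unattached? S G d′
          ... | yes un′ = ⊥-elim (independent un un′ h)
          ... | no ¬un′ = subst (Adj G d′) (proj₂ d′-child) (adj-parent (proj₁ d′-child) ¬un′)
          b-unattached : ¬ Adj G b (par c)
          b-unattached e = proj₂ un (subst (Adj G b) par-c e)
          b∉half : ¬ Half d′ b
          b∉half (inj₁ p) = <⇒≢ (below-dep p) d-dep
          b∉half (inj₂ (_ , inj₁ refl)) = child≢parent d-child refl
          b∉half (inj₂ (_ , inj₂ (_ , e))) = b-unattached e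
          last : Flex (Adj G) (_≡ d′) d′ b 1 1
          last (suc zero) lo hi = d′ ∷ [] , symG h ◅ ε , [] ∷ [] , refl ∷ [] , refl
          last (suc (suc m)) lo (s≤s ())
          longer : Flex (Adj G) (λ y → Half d′ y ⊎ y ≡ d′) a b (2 + (1 + i) + 1) (1 + i * W + W + 1)
          longer = flex-++ (subst (_≤ 1 + i * W + W) half-size (+-mono-≤ (s≤s (m≤m*n i W)) (s≤s (s≤s z≤n)))) ≤-refl
            (λ { p refl → not-half d′-child p }) inj₁ inj₂
            (half′ d′-child (λ { refl → normal un h c-closed }) d′-attached) last
          b∉ : ¬ (Half d′ b ⊎ b ≡ d′)
          b∉ (inj₁ p) = b∉half p
          b∉ (inj₂ refl) = independent un un h
          hi-eq : 3 + suc i * W ≡ suc (1 + i * W + W + 1)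
          hi-eq = solve 2 (λ x w → con 3 :+ (w :+ x :* w) := con 1 :+ (con 1 :+ x :* w :+ w :+ con 1)) refl i W
            where open +-*-Solver
        -- Both ends climb and the routes meet in `d`; the range is exactly the dense interval for
        -- `i + j`.
        go {suc j} up-b@(step b≢r _) = ⊥-elim (free (range-dense X (i + j) (≤-reflexive lo-eq) (≤-reflexive hi-eq)
            (meet-in-middle X (half′ d-child (λ e → c≢d (sym e)) (subst (Adj G d) (sym eq) (closed-attached d-closed)))
              (ascend up-b (attached b≢r (parent≢root up-b d≢r)))
              (subst (_≤ 1 + i * W + W) half-size (+-mono-≤ (s≤s (m≤m*n i W)) (s≤s (s≤s z≤n)))) (s≤s (m≤m*n j W))
              (λ { (inj₁ p) q → below-disjoint c≢d d-dep p q
                 ; (inj₂ (_ , r)) q → <⇒≱ (below-dep q) (≤-trans (low r) (≤-reflexive d-dep)) })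
              (not-half d-child) (λ q → <-irrefl refl (below-dep q)))))
          where
          d-closed : Closed S G d
          d-closed = parent-of-closed up-b d≢r
          lo-eq : 3 + (1 + i) + (1 + j) ≡ 5 + (i + j)
          lo-eq = cong (4 +_) (+-suc i j)
          hi-eq : 3 + suc (i + j) * W ≡ suc (1 + i * W + W + (1 + j * W))
          hi-eq = solve 3 (λ x y w → con 3 :+ (w :+ (x :+ y) :* w) := con 1 :+ (con 1 :+ x :* w :+ w :+ (con 1 :+ y :* w))) refl i j W
            where open +-*-Solver

      local : ∀ {a b} → Extends G a b H → a ≢ b → ¬ Adj G a b → Local a b ⊎ Local b a
      local X a≢b ¬ab with related a≢b
      ... | above u = inj₁ (up-local X ¬ab u)
      ... | below u = inj₂ (up-local (extends-sym X) (λ h → ¬ab (symG h)) u)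
      ... | fork stop stop ch d≢r _ = inj₁ (sibling ch d≢r)
      ... | fork u@(step _ _) v ch d≢r c≢d = inj₁ (fork-local X u v ch d≢r c≢d)
      ... | fork u@stop v@(step _ _) (c≢r , eq) d≢r c≢d =
        inj₂ (fork-local (extends-sym X) v u (d≢r , sym eq) c≢r (λ e → c≢d (sym e)))

-- Moving leaves of the tree to new parents, and normalisation

maybe-view : ∀ {A : Set} (m : Maybe A) → m ≡ nothing ⊎ ∃ λ a → m ≡ just a
maybe-view nothing = inj₁ refl
maybe-view (just a) = inj₂ (a , refl)

-- Moved vertices are childless and new parents stay in place, so only the moved vertices change
-- depth and all moves can be made at once.
module Reparent {n} (S : Shape n) (mv : Fin n → Maybe (Fin n))
  (ok : ∀ {x c} → mv x ≡ just c → x ≢ Shape.root S × (∀ {y} → ¬ ShapeLemmas.Child S x y) × mv c ≡ nothing) where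

  open ShapeLemmas S

  par′ : Fin n → Fin n
  par′ x = maybe′ (λ c → c) (par x) (mv x)

  dep′ : Fin n → ℕ
  dep′ x = maybe′ (λ c → suc (dep c)) (dep x) (mv x)

  par-moved : ∀ {x c} → mv x ≡ just c → par′ x ≡ c
  par-moved eq rewrite eq = refl

  par-kept : ∀ {x} → mv x ≡ nothing → par′ x ≡ par x
  par-kept eq rewrite eq = refl

  dep-kept : ∀ {x} → mv x ≡ nothing → dep′ x ≡ dep x
  dep-kept eq rewrite eq = refl

  root-kept : mv root ≡ nothing
  root-kept with mv root in eq
  ... | nothing = refl
  ... | just c = ⊥-elim (proj₁ (ok eq) refl)

  parent-kept : ∀ {x} → x ≢ root → mv (par x) ≡ nothing
  parent-kept {x} x≢r with mv (par x) in eq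
  ... | nothing = refl
  ... | just c = ⊥-elim (proj₁ (proj₂ (ok eq)) (x≢r , refl))

  dep-par′ : ∀ {x} → x ≢ root → dep′ x ≡ suc (dep′ (par′ x))
  dep-par′ {x} x≢r with mv x in eq
  ... | just c = cong suc (sym (dep-kept (proj₂ (proj₂ (ok eq)))))
  ... | nothing = trans (dep-par x≢r) (cong suc (sym (dep-kept (parent-kept x≢r))))

  S′ : Shape n
  S′ = record { root = root ; par = par′ ; dep = dep′
              ; dep-root = trans (dep-kept root-kept) dep-root ; dep-par = dep-par′ }

  module S′ = ShapeLemmas S′

  child-kept : ∀ {p x} → mv x ≡ nothing → Child p x → S′.Child p x
  child-kept eq (x≢r , e) = x≢r , trans (par-kept eq) e

  child-unmoved : ∀ {p x} → mv x ≡ nothing → S′.Child p x → Child p x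
  child-unmoved eq (x≢r , e) = x≢r , trans (sym (par-kept eq)) e

  child-moved : ∀ {x c} → mv x ≡ just c → S′.Child c x
  child-moved eq = proj₁ (ok eq) , par-moved eq

  edge-kept : ∀ {x y} → mv x ≡ nothing → mv y ≡ nothing → EdgeOK x y → S′.EdgeOK x y
  edge-kept ex ey (inj₁ ch) = inj₁ (child-kept ex ch)
  edge-kept ex ey (inj₂ (inj₁ ch)) = inj₂ (inj₁ (child-kept ey ch))
  edge-kept ex ey (inj₂ (inj₂ (ch , y≢r))) =
    inj₂ (inj₂ (subst (λ p → S′.Child p _) (sym (par-kept ey)) (child-kept ex ch) , y≢r))

module Normalise (κ : ℕ) where

  open Trees κ

  module _ {n} {S S′ : Shape n} {G G′ : Graph n} where

    private
      module S = ShapeLemmas S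
      module S′ = ShapeLemmas S′

    -- Closedness depends only on the attached children of the parent and the edges among these and
    -- to the parent, so it survives changes elsewhere.
    closed-transport : ∀ {c} → c ≢ S′.root → S′.par c ≡ S.par c →
      (∀ {x} → S.Child (S.par c) x × Adj G x (S.par c) → S′.Child (S.par c) x) →
      (∀ {x y} → S.Child (S.par c) x × Adj G x (S.par c) →
                 (S.Child (S.par c) y × Adj G y (S.par c)) ⊎ y ≡ S.par c → Adj G x y → Adj G′ x y) →
      Closed S G c → Closed S′ G′ c
    closed-transport {c} c≢r eq child adj (_ , xs , (P , u , as) , l) =
      c≢r , xs , (subst (Path (Adj G′) c xs) (sym eq) P′ , u ,
        subst (λ p → All (λ x → S′.Child p x × Adj G′ x p) xs) (sym eq) as′) , l
      where
      P′ : Path (Adj G′) c xs (S.par c)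
      P′ = path-map (λ x∈ y∈ → adj (All.lookup as x∈) ([ (λ y∈ → inj₁ (All.lookup as y∈)) , inj₂ ]′ y∈)) P
      as′ : All (λ x → S′.Child (S.par c) x × Adj G′ x (S.par c)) xs
      as′ = All.map (λ q → child q , adj q (inj₂ refl) (proj₂ q)) as

  closed-extend : ∀ {n} {S : Shape n} {G G′ : Graph n} → (∀ {x y} → Adj G x y → Adj G′ x y) →
                  ∀ {c} → Closed S G c → Closed S G′ c
  closed-extend {S = S} old cl = closed-transport {S = S} {S′ = S} (proj₁ cl) refl proj₁ (λ _ _ → old) cl

  tree-extend : ∀ {n} {S : Shape n} {G H : Graph n} {a b} → Tree S G → Extends G a b H →
                ShapeLemmas.EdgeOK S a b → Tree S H
  tree-extend {S = S} {G} {H} {a} {b} T X ab = record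
    { edges = λ h → [ edges , pair ]′ (cases h)
    ; attached = λ x≢r p≢r → old (attached x≢r p≢r)
    ; closed-parent = λ x≢r p≢r → closed-extend {S = S} old (closed-parent x≢r p≢r) }
    where
    open TreeLemmas T
    open Extends X
    pair : ∀ {x y} → SamePair a b x y → EdgeOK x y
    pair (inj₁ (refl , refl)) = ab
    pair (inj₂ (refl , refl)) = edgeOK-sym ab

  module _ (𝒞 : CycleFamily) (𝒞-k : 𝒞 (5 + κ)) {n} {S : Shape n} {G : Graph n} (T : Tree S G)
           (simple : Simple G) (free : ¬ ContainsMember 𝒞 G) where
    open TreeLemmas T

    module _ (independent : ∀ {v w} → Unattached S G v → Unattached S G w → ¬ Adj G v w) where

      neighbour-attached : ∀ {x y} → Unattached S G x → Adj G x y → Adj G y root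
      neighbour-attached {x} {y} un h with unattached? S G y
      ... | yes un′ = ⊥-elim (independent un un′ h)
      ... | no ¬un = subst (Adj G y) (proj₂ ch) (adj-parent (proj₁ ch) ¬un)
        where
        ch : Child root y
        ch = unattached-neighbour un h

      -- A second neighbour y of x would close a cycle of length k through c, y and x.
      only-closed-neighbour : ∀ {x c y} → Unattached S G x → Adj G x c → Closed S G c → Adj G x y → y ≡ c
      only-closed-neighbour {x} {c} {y} un xc cl xy with y ≟ c
      ... | yes eq = eq
      ... | no y≢c with closed-cross cl (subst (λ p → Child p y) (sym pc) (unattached-neighbour un xy)) y≢c
                          (subst (Adj G y) (sym pc) (neighbour-attached un xy)) W (s≤s (s≤s z≤n)) ≤-refl
        where
        pc : par c ≡ root
        pc = proj₂ (unattached-neighbour un xc)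
      ... | ys , P , u , as , l = ⊥-elim (free (5 + κ , 𝒞-k , cycle⇒hasCycle
              (c , ys ++ y ∷ x ∷ [] , P ◅◅ symG xy ◅ xc ◅ ε , unique-++ u
                (unique-∷ (λ { (here refl) → simple-irrefl simple xy }) ([] ∷ []))
                (λ { p (here refl) → proj₁ (All.lookup as p) refl
                   ; p (there (here refl)) → away (proj₂ (All.lookup as p)) }) ,
              trans (length-++ ys) (trans (cong (_+ 2) l) (+-comm W 2)) , s≤s (s≤s (s≤s z≤n)))))
        where
        pc : par c ≡ root
        pc = proj₂ (unattached-neighbour un xc)
        away : ¬ Around (par c) x
        away (inj₁ e) = proj₁ (proj₁ un) (trans e pc)
        away (inj₂ (_ , h)) = proj₂ un (subst (Adj G x) pc h)

      abstract
        target : Fin n → Maybe (Fin n)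
        target x with unattached? S G x | any? (λ c → adj? G x c ×-dec closed? S G c)
        ... | yes _ | yes (c , _) = just c
        ... | _ | _ = nothing

        target-just : ∀ {x c} → target x ≡ just c → Unattached S G x × Adj G x c × Closed S G c
        target-just {x} eq with unattached? S G x | any? (λ c → adj? G x c ×-dec closed? S G c)
        target-just refl | yes un | yes (c , h , cl) = un , h , cl

        target-nothing : ∀ {x c} → target x ≡ nothing → Unattached S G x → Adj G x c → ¬ Closed S G c
        target-nothing {x} eq un h cl with unattached? S G x | any? (λ c → adj? G x c ×-dec closed? S G c)
        target-nothing () un h cl | yes _ | yes _
        ... | yes _ | no ¬p = ¬p (_ , h , cl)
        ... | no ¬un | _ = ¬un un

      attached-unmoved : ∀ {x} → Adj G x (par x) → target x ≡ nothing
      attached-unmoved {x} h with maybe-view (target x)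
      ... | inj₁ eq = eq
      ... | inj₂ (c , eq) with target-just eq
      ... | ((_ , e) , ¬h) , _ = ⊥-elim (¬h (subst (Adj G x) e h))

      target-ok : ∀ {x c} → target x ≡ just c → x ≢ root × (∀ {y} → ¬ Child x y) × target c ≡ nothing
      target-ok eq = let (un , h , cl) = target-just eq in
        proj₁ (proj₁ un) , unattached-childless un , attached-unmoved (closed-attached cl)

      open Reparent S target target-ok
        using (S′; par′; par-moved; par-kept; child-kept; child-moved; child-unmoved; edge-kept; module S′) public

      closed-forward : ∀ {c} → Closed S G c → Closed S′ G c
      closed-forward cl = closed-transport {S = S} {S′ = S′} (proj₁ cl) (par-kept (attached-unmoved (closed-attached cl)))
        (λ (ch , h) → child-kept (attached-unmoved (subst (Adj G _) (sym (proj₂ ch)) h)) ch)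
        (λ _ _ h → h) cl

      normal-tree : Tree S′ G
      normal-tree = record { edges = edges′ ; attached = attached′ ; closed-parent = closed-parent′ }
        where
        edges′ : ∀ {x y} → Adj G x y → S′.EdgeOK x y
        edges′ {x} {y} h with maybe-view (target x) | maybe-view (target y)
        ... | inj₁ ex | inj₁ ey = edge-kept ex ey (edges h)
        ... | inj₂ (c , ex) | _ = let (un , xc , cl) = target-just ex in
          inj₁ (subst (λ z → S′.Child z x) (sym (only-closed-neighbour un xc cl h)) (child-moved ex))
        ... | inj₁ _ | inj₂ (c , ey) = let (un , yc , cl) = target-just ey in
          inj₂ (inj₁ (subst (λ z → S′.Child z y) (sym (only-closed-neighbour un yc cl (symG h))) (child-moved ey)))
        attached′ : ∀ {x} → x ≢ root → par′ x ≢ root → Adj G x (par′ x)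
        attached′ {x} x≢r p≢r with maybe-view (target x)
        ... | inj₁ eq = subst (Adj G x) (sym (par-kept eq)) (attached x≢r (λ e → p≢r (trans (par-kept eq) e)))
        ... | inj₂ (c , eq) = subst (Adj G x) (sym (par-moved eq)) (proj₁ (proj₂ (target-just eq)))
        closed-parent′ : ∀ {x} → x ≢ root → par′ x ≢ root → Closed S′ G (par′ x)
        closed-parent′ {x} x≢r p≢r with maybe-view (target x)
        ... | inj₁ eq = subst (Closed S′ G) (sym (par-kept eq)) (closed-forward (closed-parent x≢r (λ e → p≢r (trans (par-kept eq) e))))
        ... | inj₂ (c , eq) = subst (Closed S′ G) (sym (par-moved eq)) (closed-forward (proj₂ (proj₂ (target-just eq))))

      child-of-root : ∀ {x} → S′.Child root x → target x ≡ nothing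
      child-of-root {x} (_ , e) with maybe-view (target x)
      ... | inj₁ eq = eq
      ... | inj₂ (c , eq) = ⊥-elim (proj₁ (proj₂ (proj₂ (target-just eq))) (trans (sym (par-moved eq)) e))

      root-child-backward : ∀ {x} → S′.Child root x → Child root x
      root-child-backward ch = child-unmoved (child-of-root ch) ch

      unattached-backward : ∀ {x} → Unattached S′ G x → Unattached S G x
      unattached-backward (ch , ¬h) = root-child-backward ch , ¬h

      -- One round suffices. Reparenting only takes vertices away from the children of the root, so
      -- a child of the root that is closed afterwards was closed before and would have made `v`
      -- move.
      normal : ∀ {v c} → Unattached S′ G v → Adj G v c → ¬ Closed S′ G c
      normal {v} {c} un′ h cl′ = target-nothing (child-of-root (proj₁ un′)) un h cl
        where
        un : Unattached S G v
        un = unattached-backward un′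
        ch : Child root c
        ch = unattached-neighbour un h
        eq : par′ c ≡ par c
        eq = par-kept (attached-unmoved (subst (Adj G c) (sym (proj₂ ch)) (neighbour-attached un h)))
        eq′ : par′ c ≡ root
        eq′ = trans eq (proj₂ ch)
        cl : Closed S G c
        cl = closed-transport {S = S′} {S′ = S} (proj₁ cl′) (sym eq)
          (λ (ch′ , _) → subst (λ p → Child p _) (sym eq′) (root-child-backward (subst (λ p → S′.Child p _) eq′ ch′)))
          (λ _ _ h → h) cl′

-- A prefix of k - 1 vertices is closed up through the centre `p`.
fan-cycle : ∀ {n κ} {G : Graph n} {c xs e p} → Path (Adj G) c xs e → Unique xs → p ∉ xs → All (λ x → Adj G x p) xs →
            4 + κ ≤ length xs → Cycle G (5 + κ)
fan-cycle {G = G} P u p∉ as long with fan-prefix P as (s≤s z≤n) long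
... | y ∷ ys , zs , refl , l , Q with path-head Q
... | refl = _ , _ ∷ y ∷ ys , adj-sym G (All.head as) ◅ Q ,
  unique-∷ (λ r → p∉ (∈-++⁺ˡ r)) (unique-++ˡ (y ∷ ys) u) , cong suc l , s≤s (s≤s (s≤s z≤n))

-- Legality of Mini's moves

module Legality (κ : ℕ) (𝒞 : CycleFamily) (𝒞-k : 𝒞 (5 + κ)) (𝒞-min : ∀ {ℓ} → 3 ≤ ℓ → ℓ < 5 + κ → ¬ 𝒞 ℓ) where

  open Trees κ
  open Normalise κ

  Multi : ∀ {n} → Graph n → Fin n → Set
  Multi G v = ∃₂ λ x y → x ≢ y × Adj G v x × Adj G v y

  multi? : ∀ {n} (G : Graph n) v → Dec (Multi G v)
  multi? G v = any? (λ x → any? (λ y → ¬? (x ≟ y) ×-dec adj? G v x ×-dec adj? G v y))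

  member-large : ∀ {n} {G : Graph n} → ContainsMember 𝒞 G → ∃ λ ℓ → 𝒞 ℓ × Cycle G ℓ × 5 + κ ≤ ℓ
  member-large (ℓ , c , h) with hasCycle⇒cycle ℓ h
  ... | C@(_ , _ , _ , _ , _ , 3≤) = ℓ , c , C , ≮⇒≥ (λ lt → 𝒞-min 3≤ lt c)

  -- By minimality a forbidden cycle has length at least k, and it must use the new edge; removing
  -- that edge leaves the path, whose end `p` is not listed.
  chord-path : ∀ {n} {G H : Graph n} {p v} → Extends G v p H → v ≢ p → ¬ ContainsMember 𝒞 G → ContainsMember 𝒞 H →
               ∃ λ xs → Path (Adj G) v xs p × Unique xs × p ∉ xs × 4 + κ ≤ length xs
  chord-path {G = G} X v≢p free mem with member-large mem
  ... | ℓ , c , (x , xs , P , u , refl , 3≤) , k≤ with NewEdge.cycle-through v≢p (adj-sym G) (Extends.cases X) P u 3≤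
  ... | inj₁ Q = ⊥-elim (free (_ , c , cycle⇒hasCycle (x , xs , Q , u , refl , 3≤)))
  ... | inj₂ (ys , Q , w , p∉ , l) = ys , Q , w , p∉ , s≤s⁻¹ (subst (5 + κ ≤_) (sym l) k≤)

  labels-along : ∀ {V L : Set} {E : V → V → Set} {Q : V → Set} {lab : V → L} →
                 (∀ {x y} → Q x → Q y → E x y → lab x ≡ lab y) →
                 ∀ {x xs z} → Path E x xs z → All Q xs → All (λ y → lab x ≡ lab y) xs
  labels-along same ε [] = []
  labels-along same (e ◅ ε) (q ∷ []) = refl ∷ []
  labels-along same (e ◅ P@(_ ◅ _)) (q ∷ qs@(q′ ∷ _)) =
    refl ∷ All.map (trans (same q q′ e)) (labels-along same P qs)

  -- The vertices before and after `w` on the path are two neighbours; `w` is not the last listed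
  -- vertex, as that one is adjacent to `z`.
  interior : ∀ {n} {G : Graph n} {v ys z w} → Path (Adj G) v (v ∷ ys) z → Unique (v ∷ ys) → w ∈ ys → ¬ Adj G w z → Multi G w
  interior {G = G} {v} P u w∈ ¬wz with ∈-∃++ w∈
  ... | as , bs , refl with path-splitAt (v ∷ as) P
  ... | P₁ , (e ◅ ε) = ⊥-elim (¬wz e)
  ... | P₁ , (e ◅ (_ ◅ _)) with path-last P₁
  ... | x , x∈ , e′ = x , _ , (λ { refl → unique-disjoint (v ∷ as) u x∈ (there (here refl)) }) , adj-sym G e′ , e

  module _ {n} {S : Shape n} {G : Graph n} (T : Tree S G) where
    open TreeLemmas T

    closed-intro : ∀ {p c xs} → Child p c → Path (Adj G) c xs p → Unique xs →
                   All (λ x → Child p x × Adj G x p) xs → W ≤ length xs → Closed S G c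
    closed-intro (c≢r , refl) P u as W≤ with fan-prefix P (All.map proj₂ as) (s≤s z≤n) W≤
    ... | ys , zs , refl , l , Q = c≢r , ys , (Q , unique-++ˡ ys u , All.++⁻ˡ ys as) , l

    module Pay {H : Graph n} {v} (free : ¬ ContainsMember 𝒞 G) (un : Unattached S G v)
               (X : Extends G v root H) (normal : ∀ {c} → Adj G v c → ¬ Closed S G c)
               (lab : Fin n → Fin n) (lab-edge : ∀ {x y} → Child root x → Child root y → Adj G x y → lab x ≡ lab y) where

      v≢r : v ≢ root
      v≢r = proj₁ (proj₁ un)

      module _ {ys} (P : Path (Adj G) v (v ∷ ys) root) (u : Unique (v ∷ ys)) (ch : All (Child root) (v ∷ ys)) where

        attached-on : ∀ {w} → w ∈ ys → ¬ Unattached S G w → Child root w × Adj G w root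
        attached-on {w} w∈ ¬un = let (w≢r , e) = All.lookup ch (there w∈) in
          (w≢r , e) , subst (Adj G w) e (adj-parent w≢r ¬un)

        -- Otherwise the successor of `v` would start a path of `W` attached children of the root
        -- and be closed, against `normal`.
        not-all-attached : W ≤ length ys → ¬ All (λ w → Child root w × Adj G w root) ys
        not-all-attached W≤ as = successor P u as W≤
          where
          successor : ∀ {ys} → Path (Adj G) v (v ∷ ys) root → Unique (v ∷ ys) →
                      All (λ w → Child root w × Adj G w root) ys → W ≤ length ys → ⊥
          successor (e ◅ ε) _ as ()
          successor (e ◅ Q@(_ ◅ _)) u as W≤ = normal e (closed-intro (proj₁ (All.head as)) Q (unique-tail u) as W≤)

      long-path : ContainsMember 𝒞 H → ∃ λ ys → Path (Adj G) v (v ∷ ys) root × Unique (v ∷ ys) ×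
                  All (Child root) (v ∷ ys) × W ≤ length ys
      long-path mem with chord-path X v≢r free mem
      ... | x ∷ ys , P , u , r∉ , s≤s W≤ with path-head P
      ... | refl = ys , P , u , confined edges (proj₁ un) P u r∉ , W≤

      -- Another unattached vertex on the blocking path has the label of `v` and, not being adjacent
      -- to the root, lies in the interior of the path, hence has two neighbours.
      pay-safe : (∀ {w} → Unattached S G w → lab w ≡ lab v → w ≢ v → ¬ Multi G w) → ¬ ContainsMember 𝒞 H
      pay-safe others mem with long-path mem
      ... | ys , P , u , ch , W≤ = not-all-attached P u ch W≤ (All.tabulate (λ {w} w∈ → attached-on P u ch w∈
        (λ un′ → others un′ (sym (All.lookup (labels-along lab-edge P ch) (there w∈)))
          (λ { refl → unique-head u w∈ }) (interior P u w∈ (proj₂ un′)))))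

      module _ (𝒞-k+1 : 𝒞 (6 + κ)) (irrefl : ∀ {x} → ¬ Adj G x x) {v′}
               (only : ∀ {w} → Unattached S G w → lab w ≡ lab v → w ≡ v ⊎ w ≡ v′)
               (separate : ∀ {t zs} → Adj G t v → Adj G t v′ → Path (Adj G) v′ zs v → t ∉ zs → t ≢ v →
                           All (Child root) zs → ⊥)
               (multi : Multi G v) where

        open DecMembership {A = Fin n} _≟_ using (_∈?_)

        -- The values k - 1 and k count the vertices of a cycle other than the root.
        Near : ℕ → Set
        Near m = m ≡ 4 + κ ⊎ m ≡ 5 + κ

        near-member : ∀ {x xs} → Path (Adj G) x xs x → Unique xs → ∀ {m} → length xs ≡ suc m → Near m → ⊥
        near-member {x} {xs} C u l (inj₁ refl) = free (5 + κ , 𝒞-k , cycle⇒hasCycle (x , xs , C , u , l , s≤s (s≤s (s≤s z≤n))))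
        near-member {x} {xs} C u l (inj₂ refl) = free (6 + κ , 𝒞-k+1 , cycle⇒hasCycle (x , xs , C , u , l , s≤s (s≤s (s≤s z≤n))))

        -- A second neighbour t of v either extends the path at its start, or allows
        -- to rotate it; both close a cycle of length k or k + 1 through the root.
        module _ {q X Y} (P : Path (Adj G) v (v ∷ q ∷ X) root) (u : Unique (v ∷ q ∷ X)) (ch : All (Child root) (v ∷ q ∷ X))
                 (X-near : Near (2 + length X)) (only-X : ∀ {w} → w ∈ q ∷ X → Unattached S G w → w ≡ v′)
                 (Q : Path (Adj G) v (v ∷ Y) root) (Y-near : Near (2 + length Y)) (Y-unique : Unique (v ∷ Y))
                 (Y⊆ : ∀ {w} → w ∈ Y → w ∈ q ∷ X) where

          attached-X : ∀ {w} → w ∈ q ∷ X → w ≢ v′ → Adj G w root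
          attached-X w∈ w≢ = proj₂ (attached-on P u ch w∈ (λ un′ → w≢ (only-X w∈ un′)))

          v′∈X : v′ ∈ q ∷ X
          v′∈X with v′ ∈? q ∷ X
          ... | yes v′∈ = v′∈
          ... | no v′∉ = ⊥-elim (not-all-attached P u ch (big X-near)
            (All.tabulate (λ w∈ → attached-on P u ch w∈ (λ un′ → v′∉ (subst (_∈ q ∷ X) (only-X w∈ un′) w∈)))))
            where
            big : Near (2 + length X) → W ≤ suc (length X)
            big (inj₁ e) = ≤-reflexive (sym (suc-injective e))
            big (inj₂ e) = ≤-trans (n≤1+n _) (≤-reflexive (sym (suc-injective e)))

          root∉ : ∀ {xs} → All (Child root) xs → root ∉ xs
          root∉ cs r∈ = proj₁ (All.lookup cs r∈) refl

          -- The cycle is root, `t`, `v`, `Y`. Here `t` is attached, because the only other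
          -- candidate for an unattached vertex, `v′`, lies on the path.
          extend : ∀ {t} → Adj G v t → t ∉ q ∷ X → ⊥
          extend {t} vt t∉ = near-member (symG t-attached ◅ symG vt ◅ Q)
            (unique-∷ (root∉ (t-child ∷ v-child ∷ All.tabulate (λ w∈ → All.lookup ch (there (Y⊆ w∈)))))
              (unique-∷ (λ { (here refl) → irrefl vt ; (there w∈) → t∉ (Y⊆ w∈) }) Y-unique)) refl Y-near
            where
            v-child : Child root v
            v-child = proj₁ un
            t-child : Child root t
            t-child = unattached-neighbour un vt
            t-attached : Adj G t root
            t-attached with unattached? S G t
            ... | no ¬un = subst (Adj G t) (proj₂ t-child) (adj-parent (proj₁ t-child) ¬un)
            ... | yes un′ with only un′ (sym (lab-edge v-child t-child vt))
            ... | inj₁ refl = ⊥-elim (irrefl vt)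
            ... | inj₂ refl = ⊥-elim (t∉ v′∈X)

          -- With `m` the predecessor of `t`, the cycle runs from the root to `m`, back along the
          -- path to `v`, across to `t` and on to the root. If `m` is the possibly unattached `v′`,
          -- then `t` is a common neighbour of `v` and `v′`, which `separate` excludes.
          rotate : ∀ {t} → Adj G v t → t ≢ q → t ∈ q ∷ X → ⊥
          rotate {t} vt t≢q t∈ with ∈-∃++ t∈
          ... | [] , bs , refl = t≢q refl
          ... | as@(a ∷ as₀) , bs , eq with path-splitAt (v ∷ as) (subst (λ l → Path (Adj G) v (v ∷ l) root) eq P)
          ... | Pa , Pb with path-flip symG Pa
          ... | [] , _ , σ with ↭-length σ
          ... | ()
          rotate {t} vt t≢q t∈ | as@(a ∷ as₀) , bs , eq | Pa , Pb | m ∷ zs , (f ◅ R) , σ with path-head R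
          ... | refl with v′ ≟ m
          ... | yes refl = separate (symG vt) f R (λ t∈zs → unique-disjoint as as-bs (∈-resp-↭ σ t∈zs) (here refl))
                  (λ { refl → irrefl vt }) (All.tabulate (λ w∈ → All.lookup ch (there (in-X (∈-++⁺ˡ (∈-resp-↭ σ w∈))))))
            where
            in-X : ∀ {w} → w ∈ as ++ t ∷ bs → w ∈ q ∷ X
            in-X {w} = subst (w ∈_) (sym eq)
            as-bs : Unique (as ++ t ∷ bs)
            as-bs = subst Unique eq (unique-tail u)
          ... | no v′≢m = near-member (symG (attached-X (in-X (∈-++⁺ˡ (∈-resp-↭ σ (here refl)))) (λ e → v′≢m (sym e))) ◅ (R ◅◅ vt ◅ Pb))
                  (unique-∷ (λ r → root∉ ch (∈-resp-↭ τ r)) (unique-resp-↭ (↭-sym τ) u)) (cong suc (↭-length τ)) X-near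
            where
            in-X : ∀ {w} → w ∈ as ++ t ∷ bs → w ∈ q ∷ X
            in-X {w} = subst (w ∈_) (sym eq)
            τ : (m ∷ zs) ++ v ∷ t ∷ bs ↭ v ∷ q ∷ X
            τ = ↭-trans (shift v (m ∷ zs) (t ∷ bs)) (prep v (↭-trans (++⁺ʳ (t ∷ bs) σ) (subst (_↭ q ∷ X) eq ↭-refl)))

          impossible : ⊥
          impossible = two-neighbours multi
            where
            two-neighbours : Multi G v → ⊥
            two-neighbours (x , y , x≢y , vx , vy) with x ≟ q
            two-neighbours (x , y , x≢y , vx , vy) | yes refl with y ∈? q ∷ X
            ... | yes y∈ = rotate vy (λ e → x≢y (sym e)) y∈
            ... | no y∉ = extend vy y∉
            two-neighbours (x , y , x≢y , vx , vy) | no x≢q with x ∈? q ∷ X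
            ... | yes x∈ = rotate vx x≢q x∈
            ... | no x∉ = extend vx x∉

        -- If `z₂` is attached, the blocking path is cut after it, at k - 1 vertices: rotation gives
        -- length k and extension k + 1. Otherwise `z₂` is `v′`. Then one more vertex `r` is kept
        -- for rotation, giving k + 1, and the path for extension stops at `z₁`, giving k.
        pay-multi : ¬ ContainsMember 𝒞 H
        pay-multi mem with long-path mem
        ... | ys , P , u , ch , W≤ with take-split (1 + κ) ys (≤-trans (m≤n+m (1 + κ) 2) W≤)
        ... | ps , [] , refl , l = ⊥-elim (<⇒≱ (n≤1+n (2 + κ)) (≤-trans W≤ (≤-reflexive (trans (length-++ ps) (trans (+-identityʳ _) l)))))
        ... | ps , _ ∷ [] , refl , l = ⊥-elim (<⇒≱ (n<1+n (2 + κ)) (≤-trans W≤ (≤-reflexive (trans (length-++ ps) (trans (+-comm _ 1) (cong suc l))))))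
        ... | [] , z₁ ∷ z₂ ∷ rs , refl , ()
        ... | p ∷ ps , z₁ ∷ z₂ ∷ rs , refl , l with path-splitAt (v ∷ p ∷ ps) P
        ... | P₀ , (e₁ ◅ R) with path-head R
        pay-multi mem | ys , P , u , ch , W≤ | p ∷ ps , z₁ ∷ z₂ ∷ rs , refl , l | P₀ , (e₁ ◅ (e₂ ◅ R)) | refl = last-two e₂ R
          where
          only-ys : ∀ {w} → w ∈ ys → Unattached S G w → w ≡ v′
          only-ys w∈ un′ with only un′ (sym (All.lookup (labels-along lab-edge P ch) (there w∈)))
          ... | inj₁ refl = ⊥-elim (unique-head u w∈)
          ... | inj₂ e = e
          attached-ys : ∀ {w} → w ∈ ys → w ≢ v′ → Adj G w root
          attached-ys w∈ w≢ = proj₂ (attached-on P u ch w∈ (λ un′ → w≢ (only-ys w∈ un′)))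
          size : ∀ zs → length (ps ++ zs) ≡ κ + length zs
          size zs = trans (length-++ ps) (cong (_+ length zs) (suc-injective l))
          z₁∈ : z₁ ∈ ys
          z₁∈ = ∈-++⁺ʳ (p ∷ ps) (here refl)
          z₂∈ : z₂ ∈ ys
          z₂∈ = ∈-++⁺ʳ (p ∷ ps) (there (here refl))
          module Prefix (zs ws : List (Fin n)) (eq : z₁ ∷ z₂ ∷ rs ≡ zs ++ ws) where
            eq′ : v ∷ ys ≡ (v ∷ p ∷ ps ++ zs) ++ ws
            eq′ = trans (cong (λ l → v ∷ p ∷ ps ++ l) eq) (sym (++-assoc (v ∷ p ∷ ps) zs ws))
            unique : Unique (v ∷ p ∷ ps ++ zs)
            unique = unique-++ˡ (v ∷ p ∷ ps ++ zs) (subst Unique eq′ u)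
            children : All (Child root) (v ∷ p ∷ ps ++ zs)
            children = All.++⁻ˡ (v ∷ p ∷ ps ++ zs) (subst (All (Child root)) eq′ ch)
            inside : ∀ {w} → w ∈ p ∷ ps ++ zs → w ∈ ys
            inside {w} w∈ = subst (w ∈_) (sym (∷-injectiveʳ eq′)) (∈-++⁺ˡ w∈)
          last-two : ∀ {r} → Adj G z₂ r → Path (Adj G) r rs root → ⊥
          last-two e₂ R with adj? G z₂ root
          ... | yes h = impossible (P₀ ◅◅ e₁ ◅ h ◅ ε) unique children
                  (inj₁ (cong (2 +_) (trans (size (z₁ ∷ z₂ ∷ [])) (+-comm κ 2)))) (λ w∈ → only-ys (inside w∈))
                  (P₀ ◅◅ e₁ ◅ h ◅ ε) (inj₂ (cong (3 +_) (trans (size (z₁ ∷ z₂ ∷ [])) (+-comm κ 2)))) unique (λ w∈ → w∈)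
            where open Prefix (z₁ ∷ z₂ ∷ []) rs refl
          last-two e₂ ε | no ¬h = ¬h e₂
          last-two e₂ (_◅_ {a = r} {xs = rs′} f R) | no ¬h =
            impossible (P₀ ◅◅ e₁ ◅ e₂ ◅ r-attached ◅ ε) unique children
              (inj₂ (cong (2 +_) (trans (size (z₁ ∷ z₂ ∷ r ∷ [])) (+-comm κ 3)))) (λ w∈ → only-ys (inside w∈))
              (P₀ ◅◅ z₁-attached ◅ ε) (inj₁ (cong (3 +_) (trans (size (z₁ ∷ [])) (+-comm κ 1)))) Short.unique
              (λ w∈ → shorter w∈)
            where
            open Prefix (z₁ ∷ z₂ ∷ r ∷ []) rs′ refl
            module Short = Prefix (z₁ ∷ []) (z₂ ∷ r ∷ rs′) refl
            shorter : ∀ {w} → w ∈ p ∷ ps ++ z₁ ∷ [] → w ∈ p ∷ ps ++ z₁ ∷ z₂ ∷ r ∷ []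
            shorter {w} w∈ = subst (w ∈_) (++-assoc (p ∷ ps) (z₁ ∷ []) (z₂ ∷ r ∷ [])) (∈-++⁺ˡ w∈)
            tail-unique : Unique (z₁ ∷ z₂ ∷ r ∷ rs′)
            tail-unique = unique-++ʳ (v ∷ p ∷ ps) u
            z₂≡v′ : z₂ ≡ v′
            z₂≡v′ with unattached? S G z₂
            ... | yes un′ = only-ys z₂∈ un′
            ... | no ¬un = ⊥-elim (¬h (proj₂ (attached-on P u ch z₂∈ ¬un)))
            z₁-attached : Adj G z₁ root
            z₁-attached = attached-ys z₁∈ (λ e → unique-head tail-unique (here (trans e (sym z₂≡v′))))
            r-attached : Adj G r root
            r-attached = attached-ys (∈-++⁺ʳ (p ∷ ps) (there (there (here refl))))
              (λ e → unique-head (unique-tail tail-unique) (here (trans z₂≡v′ (sym e))))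

  -- Sibling edges and hanging vertices

  module _ {n} {S : Shape n} {G H : Graph n} (T : Tree S G) (free : ¬ ContainsMember 𝒞 G) where
    open TreeLemmas T

    -- A forbidden cycle of any length yields one of length exactly k. If it avoids the parent, its
    -- vertices already form a fan in `G`. If it passes through the parent, deleting the parent
    -- leaves a path of at least k - 1 children in `H`, part of which closes up through the parent.
    sibling-safe : ∀ {a b} → (∀ {x} → x ≢ root → Adj G x (par x)) → Extends G a b H → a ≢ b →
                   Child (par b) a → b ≢ root → ¬ Cycle H (5 + κ) → ¬ ContainsMember 𝒞 H
    sibling-safe {a} {b} all-attached X a≢b a-child b≢r no-cycle mem with chord-path X a≢b free mem
    ... | ys , P , u , b∉ , long with par b ∈? ys
      where open DecMembership _≟_ using (_∈?_)
    ... | no p∉ = free (5 + κ , 𝒞-k , cycle⇒hasCycle (fan-cycle P′ u′ p∉′ (All.map child-adj children) long′))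
      where
      child-adj : ∀ {x} → Child (par b) x → Adj G x (par b)
      child-adj (x≢r , e) = subst (Adj G _) e (all-attached x≢r)
      b-child : Child (par b) b
      b-child = b≢r , refl
      P′ : Path (Adj G) a (ys ++ b ∷ []) (par b)
      P′ = P ◅◅ all-attached b≢r ◅ ε
      u′ : Unique (ys ++ b ∷ [])
      u′ = unique-++ u ([] ∷ []) (λ { p (here refl) → b∉ p })
      p∉′ : par b ∉ ys ++ b ∷ []
      p∉′ q = [ p∉ , (λ { (here e) → child≢parent b-child (sym e) }) ]′ (∈-++⁻ ys q)
      children : All (Child (par b)) (ys ++ b ∷ [])
      children = confined edges a-child P′ u′ p∉′
      long′ : 4 + κ ≤ length (ys ++ b ∷ [])
      long′ = ≤-trans long (≤-trans (m≤m+n _ _) (≤-reflexive (sym (length-++ ys))))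
    ... | yes p∈ with ∈-∃++ p∈
    ... | us , ws , refl with path-splitAt us P
    ... | P₁ , P₂@(_ ◅ R) with path-flip symG P₂
    ... | zs , F , σ = no-cycle (fan-cycle (path-map (λ _ _ → old) R ◅◅ adj-sym H new ◅ path-map (λ _ _ → old) P₁)
            (unique-resp-↭ (↭-sym τ) (unique-tail ρ-unique)) (λ r → unique-head ρ-unique (∈-resp-↭ τ r))
            (All.map child-adj (All.++⁺ ws-children ((b≢r , refl) ∷ us-children)))
            (≤-trans long (≤-reflexive (trans (suc-injective (↭-length ρ)) (sym (↭-length τ))))))
      where
      open Extends X
      child-adj : ∀ {x} → Child (par b) x → Adj H x (par b)
      child-adj (x≢r , e) = old (subst (Adj G _) e (all-attached x≢r))
      ρ : b ∷ us ++ par b ∷ ws ↭ par b ∷ b ∷ us ++ ws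
      ρ = ↭-trans (prep b (shift (par b) us ws)) (swap b (par b) ↭-refl)
      ρ-unique : Unique (par b ∷ b ∷ us ++ ws)
      ρ-unique = unique-resp-↭ ρ (unique-∷ b∉ u)
      τ : ws ++ b ∷ us ↭ b ∷ us ++ ws
      τ = ++-comm ws (b ∷ us)
      us-children : All (Child (par b)) us
      us-children = confined edges a-child P₁ (unique-++ˡ us u) (λ r → unique-disjoint us u r (here refl))
      zs-children : All (Child (par b)) (b ∷ zs)
      zs-children = confined edges (b≢r , refl) F
        (unique-∷ (λ r → unique-head (unique-tail ρ-unique) (∈-++⁺ʳ us (∈-resp-↭ σ r)))
          (unique-resp-↭ (↭-sym σ) (unique-++ʳ us (unique-tail (unique-tail ρ-unique)))))
        (λ { (here e) → unique-head ρ-unique (here e) ; (there r) → unique-head ρ-unique (there (∈-++⁺ʳ us (∈-resp-↭ σ r))) })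
      ws-children : All (Child (par b)) ws
      ws-children = All-resp-↭ σ (All.tail zs-children)

  -- The path left by a forbidden cycle must go from `b` to its only neighbour `a`; the rest shows
  -- that `a` starts a long path among the children of `p`.
  hang-path : ∀ {n} {S : Shape n} {G H : Graph n} {p a b} → let open ShapeLemmas S in
              (∀ {x y} → Adj G x y → EdgeOK x y) → Extends G b p H → Child p b → (∀ {y} → Adj G b y → y ≡ a) → a ≢ p →
              ¬ ContainsMember 𝒞 G → ContainsMember 𝒞 H →
              ∃ λ xs → Path (Adj G) a xs p × Unique (b ∷ xs) × All (Child p) xs × W ≤ length xs
  hang-path {S = S} edges X b-child only a≢p free mem with chord-path X (ShapeLemmas.child≢parent S b-child) free mem
  ... | _ , (f ◅ ε) , _ , _ , s≤s ()
  ... | _ , (_◅_ {xs = xs} f P@(_ ◅ _)) , u , p∉ , s≤s W≤ with only f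
  ... | refl = xs , P , u , All.tail (ShapeLemmas.confined S edges b-child (f ◅ P) u p∉) , W≤

-- The size of the final graph

module EdgeBound (κ : ℕ) {n} {S : Shape n} {G : Graph n} (T : Trees.Tree κ S G) (simple : Simple G)
                 (no-cycle : ¬ Cycle G (5 + κ))
                 (all-attached : ∀ {x} → x ≢ Shape.root S → Adj G x (Shape.par S x)) where

  open Trees κ
  open TreeLemmas T

  Sibling : Fin n → Fin n → Set
  Sibling x y = Adj G x y × Child (par y) x × y ≢ root

  sibling? : ∀ x y → Dec (Sibling x y)
  sibling? x y = adj? G x y ×-dec child? (par y) x ×-dec ¬? (y ≟ root)

  sibling-sym : ∀ {x y} → Sibling x y → Sibling y x
  sibling-sym (h , (x≢r , e) , y≢r) = symG h , (y≢r , sym e) , x≢r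

  open ErdősGallai _≟_ Sibling sibling? sibling-sym (λ (h , _) → simple-irrefl simple h)

  one-level : ∀ {a x xs b} → Path Sibling a (x ∷ xs) b → All (Child (par b)) (x ∷ xs) × b ≢ root
  one-level ((_ , ch , b≢r) ◅ ε) = ch ∷ [] , b≢r
  one-level ((_ , (x≢r , e) , _) ◅ P@(_ ◅ _)) with one-level P
  ... | cs@((_ , e′) ∷ _) , b≢r = (x≢r , trans e e′) ∷ cs , b≢r

  -- With its unlisted end such a path has at most k - 2 vertices, as k - 1 siblings and their
  -- parent would give a k-cycle.
  siblings-short : ∀ {a xs b} → Path Sibling a xs b → Unique xs → b ∉ xs → length xs ≤ 2 + κ
  siblings-short {xs = []} P u b∉ = z≤n
  siblings-short {xs = xs@(_ ∷ _)} {b} P u b∉ = ≮⇒≥ (λ long → no-cycle (close long))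
    where
    b≢r : b ≢ root
    b≢r = proj₂ (one-level P)
    children : All (Child (par b)) (xs ++ b ∷ [])
    children = All.++⁺ (proj₁ (one-level P)) ((b≢r , refl) ∷ [])
    close : 3 + κ ≤ length xs → Cycle G (5 + κ)
    close long = fan-cycle (path-map (λ _ _ → proj₁) P ◅◅ all-attached b≢r ◅ ε)
      (unique-++ u ([] ∷ []) (λ { p (here refl) → b∉ p }))
      (λ p∈ → child≢parent (All.lookup children p∈) refl)
      (All.map (λ (x≢r , e) → subst (Adj G _) e (all-attached x≢r)) children)
      (≤-trans (s≤s long) (≤-reflexive (sym (trans (length-++ xs) (+-comm (length xs) 1)))))

  private
    V vs : List (Fin n)
    V = allFin n
    vs = proj₁ (member-↭ (∈-allFin root))
    V↭ : V ↭ root ∷ vs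
    V↭ = proj₂ (member-↭ (∈-allFin root))
    V-unique : Unique V
    V-unique = Unique.allFin⁺ n

  length-vs : length vs ≡ n ∸ 1
  length-vs = cong (_∸ 1) {x = suc (length vs)} (trans (sym (↭-length V↭)) (length-allFin {n}))

  isParent : Fin n → Fin n → ℕ
  isParent x y = indicator (child? y x)

  parents : ℕ
  parents = sumOver V (λ x → sumOver V (isParent x))

  parents≤ : parents ≤ length vs
  parents≤ = begin
    parents
      ≡⟨ sumOver-↭ _ V↭ ⟩
    sumOver V (isParent root) + sumOver vs (λ x → sumOver V (isParent x))
      ≡⟨ cong (_+ sumOver vs (λ x → sumOver V (isParent x)))
           (sumOver-zero V (λ {y} _ → indicator-no (child? y root) (λ (r≢r , _) → r≢r refl))) ⟩
    sumOver vs (λ x → sumOver V (isParent x))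
      ≤⟨ sumOver-mono vs (λ {x} _ → ≤-trans (sumOver-support {ys = par x ∷ []} V-unique (λ _ → only-parent x))
           (≤-trans (≤-reflexive (+-identityʳ _)) (indicator≤1 (child? (par x) x)))) ⟩
    sumOver vs (λ _ → 1)
      ≡⟨ trans (sumOver-const vs 1) (*-identityʳ _) ⟩
    length vs ∎
    where
    open ≤-Reasoning
    only-parent : ∀ x {y} → isParent x y ≢ 0 → y ∈ par x ∷ []
    only-parent x {y} h with child? y x
    ... | yes (_ , refl) = here refl
    ... | no _ = ⊥-elim (h refl)

  siblings≤ : count V V ≤ length vs * (2 + κ)
  siblings≤ = begin
    count V V
      ≡⟨ count-↭ V↭ ⟩
    count (root ∷ vs) (root ∷ vs)
      ≡⟨ count-++ (root ∷ []) vs ⟩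
    count (root ∷ []) (root ∷ []) + 2 * count (root ∷ []) vs + count vs vs
      ≡⟨ cong₂ (λ i j → i + 2 * j + count vs vs) (root-row (root ∷ [])) (root-row vs) ⟩
    count vs vs
      ≤⟨ erdős-gallai (2 + κ) siblings-short (length vs) vs ≤-refl (unique-tail (unique-resp-↭ V↭ V-unique)) ⟩
    length vs * (2 + κ) ∎
    where
    open ≤-Reasoning
    root-row : ∀ ws → count (root ∷ []) ws ≡ 0
    root-row ws = trans (+-identityʳ _) (sumOver-zero ws (λ {y} _ → indicator-no (sibling? root y) (λ (_ , (r≢r , _) , _) → r≢r refl)))

  indicator-split : ∀ {A B C D : Set} (A? : Dec A) (B? : Dec B) (C? : Dec C) (D? : Dec D) →
                    (A → B ⊎ C ⊎ D) → indicator A? ≤ indicator B? + (indicator C? + indicator D?)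
  indicator-split (no _) _ _ _ f = z≤n
  indicator-split (yes a) B? C? D? f with f a
  ... | inj₁ b rewrite indicator-yes B? b = s≤s z≤n
  ... | inj₂ (inj₁ c) rewrite indicator-yes C? c = ≤-trans (s≤s z≤n) (m≤n+m _ (indicator B?))
  ... | inj₂ (inj₂ d) rewrite indicator-yes D? d = ≤-trans (m≤n+m 1 (indicator C?)) (m≤n+m _ (indicator B?))

  adjacency-split : ∀ x y → indicator (adj? G x y) ≤ e x y + (isParent x y + isParent y x)
  adjacency-split x y = indicator-split (adj? G x y) (sibling? x y) (child? y x) (child? x y)
    (λ h → [ (λ c → inj₂ (inj₁ c)) , [ (λ c → inj₂ (inj₂ c)) , (λ (c , y≢r) → inj₁ (h , c , y≢r)) ]′ ]′ (edges h))

  -- Over ordered pairs, each vertex other than the root accounts for k - 3 by Erdős-Gallai and for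
  -- 2 by its parent edge.
  edge-bound : 2 * numEdges G ≤ (4 + κ) * (n ∸ 1)
  edge-bound = begin
    2 * numEdges G
      ≤⟨ 2*edges≤adjSum simple ⟩
    adjSum G
      ≤⟨ sumOver-mono V (λ {x} _ → sumOver-mono V (λ {y} _ → adjacency-split x y)) ⟩
    sumOver V (λ x → sumOver V (λ y → e x y + (isParent x y + isParent y x)))
      ≡⟨ sumOver-cong V (λ x → trans (sumOver-+ V (e x) _) (cong (sumOver V (e x) +_) (sumOver-+ V _ _))) ⟩
    sumOver V (λ x → sumOver V (e x) + (sumOver V (isParent x) + sumOver V (λ y → isParent y x)))
      ≡⟨ trans (sumOver-+ V _ _) (cong (count V V +_) (sumOver-+ V _ _)) ⟩
    count V V + (parents + sumOver V (λ x → sumOver V (λ y → isParent y x)))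
      ≡⟨ cong (λ m → count V V + (parents + m)) (sumOver-swap V V isParent) ⟨
    count V V + (parents + parents)
      ≤⟨ +-mono-≤ siblings≤ (+-mono-≤ parents≤ parents≤) ⟩
    length vs * (2 + κ) + (length vs + length vs)
      ≡⟨ solve 2 (λ m c → m :* (con 2 :+ c) :+ (m :+ m) := (con 4 :+ c) :* m) refl (length vs) κ ⟩
    (4 + κ) * length vs
      ≡⟨ cong ((4 + κ) *_) length-vs ⟩
    (4 + κ) * (n ∸ 1) ∎
    where
    open ≤-Reasoning
    open +-*-Solver

-- The strategy

module Strategy (κ : ℕ) (𝒞 : CycleFamily) (𝒞-k : 𝒞 (5 + κ)) (𝒞-k+1 : κ ≢ 0 → 𝒞 (6 + κ))
  (𝒞-min : ∀ {ℓ} → 3 ≤ ℓ → ℓ < 5 + κ → ¬ 𝒞 ℓ)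
  (dense : ∀ s → ∃ λ ℓ → 5 + s ≤ ℓ × ℓ ≤ 3 + suc s * (3 + κ) × 𝒞 ℓ) where

  open Trees κ
  open Normalise κ using (closed-transport; tree-extend)
  module N = Normalise κ
  open Legality κ 𝒞 𝒞-k 𝒞-min
  open DistantMoves κ 𝒞 𝒞-k dense using (local; Local; attach; sibling; hang)

  -- lab is constant on the components of the graph on the children of the root, so each
  -- of these contains at most one unattached vertex.
  record Position {n} (G : Graph n) : Set where
    field
      shape    : Shape n
    open ShapeLemmas shape using (Child; root)
    field
      tree     : Tree shape G
      simple   : Simple G
      free     : ¬ ContainsMember 𝒞 G
      lab      : Fin n → Fin n
      lab-edge : ∀ {x y} → Child root x → Child root y → Adj G x y → lab x ≡ lab y
      lab-one  : ∀ {v w} → Unattached shape G v → Unattached shape G w → lab v ≡ lab w → v ≡ w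
      normal   : ∀ {v c} → Unattached shape G v → Adj G v c → ¬ Closed shape G c

  -- For k = 5 the cycle of length k + 1 need not be forbidden, and Mini keeps
  -- unattached vertices of degree at most one instead.
  Leafy : ∀ {n} {G : Graph n} → Position G → Set
  Leafy {G = G} P = κ ≡ 0 → ∀ {v} → Unattached (Position.shape P) G v → ¬ Multi G v

  -- For k = 5 a move of Max may leave one unattached vertex with two neighbours; attaching it
  -- restores `Leafy`.
  AlmostLeafy : ∀ {n} {G : Graph n} → Position G → Set
  AlmostLeafy {G = G} P = κ ≡ 0 → ∀ {v w} → Unattached (Position.shape P) G v → Unattached (Position.shape P) G w →
                          Multi G v → Multi G w → v ≡ w

  GoodMove : ∀ {n} → Graph n → Set
  GoodMove G = ∃₂ λ u v → Legal 𝒞 G u v × Σ (Position (addEdge u v G)) Leafy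

  multi-old : ∀ {n} {G H : Graph n} {a b w} → Extends G a b H → w ≢ a → w ≢ b → Multi H w → Multi G w
  multi-old {G = G} {a = a} {b} {w} X w≢a w≢b (x , y , x≢y , hx , hy) = x , y , x≢y , back hx , back hy
    where
    back : ∀ {x} → Adj _ w x → Adj G w x
    back h with Extends.cases X h
    ... | inj₁ g = g
    ... | inj₂ (inj₁ (e , _)) = ⊥-elim (w≢a e)
    ... | inj₂ (inj₂ (e , _)) = ⊥-elim (w≢b e)

  module _ {n} {S : Shape n} {H : Graph n} (T : Tree S H) (simple : Simple H) (lab : Fin n → Fin n) where
    open TreeLemmas T

    -- The label conditions refer to the shape before normalisation, which only takes vertices away
    -- from the children of the root.
    establish : ¬ ContainsMember 𝒞 H → (∀ {x y} → Child root x → Child root y → Adj H x y → lab x ≡ lab y) →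
                (∀ {v w} → Unattached S H v → Unattached S H w → lab v ≡ lab w → v ≡ w) →
                Σ (Position H) λ P → ∀ {v} → Unattached (Position.shape P) H v → Unattached S H v
    establish free lab-edge lab-one = record
      { shape = N.S′ 𝒞 𝒞-k T simple free independent
      ; tree = N.normal-tree 𝒞 𝒞-k T simple free independent
      ; simple = simple ; free = free ; lab = lab
      ; lab-edge = λ cx cy → lab-edge (backward cx) (backward cy)
      ; lab-one = λ v w → lab-one (unattached-backward v) (unattached-backward w)
      ; normal = N.normal 𝒞 𝒞-k T simple free independent } , unattached-backward
      where
      independent : ∀ {v w} → Unattached S H v → Unattached S H w → ¬ Adj H v w
      independent v w h with lab-one v w (lab-edge (proj₁ v) (proj₁ w) h)
      ... | refl = simple-irrefl simple h
      backward : ∀ {x} → ShapeLemmas.Child (N.S′ 𝒞 𝒞-k T simple free independent) root x → Child root x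
      backward = N.root-child-backward 𝒞 𝒞-k T simple free independent
      unattached-backward : ∀ {x} → Unattached (N.S′ 𝒞 𝒞-k T simple free independent) H x → Unattached S H x
      unattached-backward = N.unattached-backward 𝒞 𝒞-k T simple free independent

  module _ {n} {S : Shape n} {H : Graph n} (T : Tree S H) (simple : Simple H) (lab : Fin n → Fin n) where
    open TreeLemmas T

    pay : ∀ {v} → Unattached S H v → ¬ ContainsMember 𝒞 (addEdge root v H) → (∀ {x y} → Child root x → Child root y → Adj H x y → lab x ≡ lab y) →
          (∀ {w w′} → Unattached S H w → Unattached S H w′ → w ≢ v → w′ ≢ v → lab w ≡ lab w′ → w ≡ w′) →
          (κ ≡ 0 → ∀ {w} → Unattached S H w → w ≢ v → ¬ Multi H w) → GoodMove H
    pay {v} un@((v≢r , pv) , ¬vr) safe lab-edge lab-one leafy = root , v , legal , proj₁ established , leafy′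
      where
      X : Extends H root v (addEdge root v H)
      X = extends-addEdge H root v
      legal : Legal 𝒞 H root v
      legal = (λ e → v≢r (sym e)) , (λ h → ¬vr (symG h)) , safe
      before : ∀ {w} → Unattached S (addEdge root v H) w → Unattached S H w × w ≢ v
      before (cw , ¬h) = (cw , λ h → ¬h (Extends.old X h)) , λ { refl → ¬h (adj-sym (addEdge root v H) (Extends.new X)) }
      lab-edge′ : ∀ {x y} → Child root x → Child root y → Adj (addEdge root v H) x y → lab x ≡ lab y
      lab-edge′ cx cy h with Extends.cases X h
      ... | inj₁ g = lab-edge cx cy g
      ... | inj₂ (inj₁ (e , _)) = ⊥-elim (proj₁ cx e)
      ... | inj₂ (inj₂ (_ , e)) = ⊥-elim (proj₁ cy e)
      established : Σ (Position (addEdge root v H)) λ P → ∀ {w} → Unattached (Position.shape P) (addEdge root v H) w →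
                    Unattached S (addEdge root v H) w
      established = establish (tree-extend T X (inj₂ (inj₁ (proj₁ un)))) ((proj₁ legal , proj₁ (proj₂ legal)) ∷ simple) lab
        safe lab-edge′ (λ w w′ → let (u , w≢v) = before w ; (u′ , w′≢v) = before w′ in lab-one u u′ w≢v w′≢v)
      leafy′ : Leafy (proj₁ established)
      leafy′ k≡5 w m with before (proj₂ established w)
      ... | u , w≢v = leafy k≡5 u w≢v (multi-old X (proj₁ (proj₁ u)) w≢v m)

  -- Mini's move from a position

  module StatusOf {n} {G : Graph n} (P : Position G) where
    open Position P hiding (shape)
    S : Shape n
    S = Position.shape P
    open TreeLemmas tree

    independent : ∀ {v w} → Unattached S G v → Unattached S G w → ¬ Adj G v w
    independent v w h with lab-one v w (lab-edge (proj₁ v) (proj₁ w) h)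
    ... | refl = simple-irrefl simple h

    -- The integer part of (k - 1)(n - 1)/2 + 1.
    bound : ℕ
    bound = ((4 + κ) * (n ∸ 1) + 2) / 2

    half-bound : ∀ {e m} → 2 * e ≤ m → e ≤ (m + 2) / 2
    half-bound {e} {m} h = ≤-trans (≤-reflexive (sym (m*n/n≡m e 2)))
      (/-monoˡ-≤ 2 (≤-trans (≤-reflexive (*-comm e 2)) (≤-trans h (m≤m+n m 2))))

    pay-status : ∀ {v} → Unattached S G v → (κ ≡ 0 → ∀ {w} → Unattached S G w → w ≢ v → ¬ Multi G w) → GoodMove G
    pay-status {v} un = pay tree simple lab un
      (Pay.pay-safe tree free un (extends-sym (extends-addEdge G root v)) (normal un) lab lab-edge
        (λ un′ e w≢v → ⊥-elim (w≢v (lab-one un′ un e))))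
      lab-edge (λ w w′ _ _ → lab-one w w′)

    Candidate : Fin n → Fin n → Set
    Candidate a b = a ≢ b × ¬ Adj G a b × Child (par b) a × b ≢ root × ¬ Cycle (addEdge a b G) (5 + κ)

    candidate? : ∀ a b → Dec (Candidate a b)
    candidate? a b = ¬? (a ≟ b) ×-dec ¬? (adj? G a b) ×-dec child? (par b) a ×-dec ¬? (b ≟ root) ×-dec
                     ¬? (cycle? (addEdge a b G) (5 + κ))

    cycle-flip : ∀ {a b ℓ} → Cycle (addEdge a b G) ℓ → Cycle (addEdge b a G) ℓ
    cycle-flip {a} {b} (x , xs , C , rest) = x , xs , path-map (λ _ _ → flip) C , rest
      where
      flip : ∀ {x y} → Adj (addEdge a b G) x y → Adj (addEdge b a G) x y
      flip h with Extends.cases (extends-addEdge G a b) h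
      ... | inj₁ g = Extends.old (extends-addEdge G b a) g
      ... | inj₂ (inj₁ (refl , refl)) = inj₂ (here refl)
      ... | inj₂ (inj₂ (refl , refl)) = inj₁ (here refl)

    module _ (none : ∀ {v} → ¬ Unattached S G v) where

      all-attached : ∀ {x} → x ≢ root → Adj G x (par x)
      all-attached x≢r = adj-parent x≢r none

      candidate-move : ∀ {a b} → Candidate a b → GoodMove G
      candidate-move {a} {b} (a≢b , ¬ab , a-child , b≢r , no-cycle) =
        a , b , (a≢b , ¬ab , safe) , proj₁ established , λ _ un → ⊥-elim (none (before (proj₂ established un)))
        where
        X : Extends G a b (addEdge a b G)
        X = extends-addEdge G a b
        safe : ¬ ContainsMember 𝒞 (addEdge a b G)
        safe = sibling-safe tree free all-attached X a≢b a-child b≢r no-cycle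
        before : ∀ {w} → Unattached S (addEdge a b G) w → Unattached S G w
        before (cw , ¬h) = cw , λ h → ¬h (Extends.old X h)
        established : Σ (Position (addEdge a b G)) λ Q → ∀ {w} → Unattached (Position.shape Q) (addEdge a b G) w →
                      Unattached S (addEdge a b G) w
        established = establish (tree-extend tree X (inj₂ (inj₂ (a-child , b≢r)))) ((a≢b , ¬ab) ∷ simple) (λ _ → root)
          safe (λ _ _ _ → refl) (λ w _ _ → ⊥-elim (none (before w)))

      -- Once nothing is unattached, `local` leaves only sibling edges, and a legal one closes no
      -- k-cycle, so it would be a candidate.
      saturated : (∀ a b → ¬ Candidate a b) → Saturated 𝒞 G
      saturated no-candidate u v (u≢v , ¬uv , safe) =
        [ blocked u≢v ¬uv , (λ l → blocked′ l) ]′ (local tree safe independent normal (extends-addEdge G u v) u≢v ¬uv)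
        where
        no-k : ¬ Cycle (addEdge u v G) (5 + κ)
        no-k C = safe (5 + κ , 𝒞-k , cycle⇒hasCycle C)
        blocked : u ≢ v → ¬ Adj G u v → Local tree u v → ⊥
        blocked _ _ (attach un _) = none un
        blocked _ _ (hang _ _ un _) = none un
        blocked u≢v ¬uv (sibling ch v≢r) = no-candidate u v (u≢v , ¬uv , ch , v≢r , no-k)
        blocked′ : Local tree v u → ⊥
        blocked′ (attach un _) = none un
        blocked′ (hang _ _ un _) = none un
        blocked′ (sibling ch u≢r) = no-candidate v u ((λ e → u≢v (sym e)) , (λ h → ¬uv (symG h)) , ch , u≢r ,
          λ C → no-k (cycle-flip C))

      small : numEdges G ≤ bound
      small = half-bound (EdgeBound.edge-bound κ tree simple (λ C → free (5 + κ , 𝒞-k , cycle⇒hasCycle C)) all-attached)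

    -- A vertex with two neighbours is attached first: for k = 5 it is the only exception to
    -- `Leafy`.
    status : AlmostLeafy P → GoodMove G ⊎ (Saturated 𝒞 G × numEdges G ≤ bound)
    status leafy with any? (λ v → unattached? S G v ×-dec multi? G v)
    ... | yes (v , un , m) = inj₁ (pay-status un (λ k≡5 un′ w≢v m′ → w≢v (leafy k≡5 un′ un m′ m)))
    ... | no ¬multi with any? (unattached? S G)
    ... | yes (v , un) = inj₁ (pay-status un (λ _ un′ _ m′ → ¬multi (_ , un′ , m′)))
    ... | no ¬un with any? (λ a → any? (candidate? a))
    ... | yes (a , b , c) = inj₁ (candidate-move (λ un → ¬un (_ , un)) c)
    ... | no ¬c = inj₂ (saturated (λ un → ¬un (_ , un)) (λ a b c → ¬c (a , b , c)) , small (λ un → ¬un (_ , un)))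

  -- Answers to a move of Max

  Reply : ∀ {n} → Graph n → Set
  Reply H = Σ (Position H) AlmostLeafy ⊎ GoodMove H

  module ReplyTo {n} {G : Graph n} (P : Position G) (leafy : Leafy P) {a b : Fin n} {H : Graph n}
                 (X : Extends G a b H) (simple-H : Simple H) (free-H : ¬ ContainsMember 𝒞 H) where
    open StatusOf P using (S; independent)
    open Position P hiding (shape)
    open TreeLemmas tree
    open Extends X using (old; new; cases)

    detached : ∀ {w} → Unattached S H w → Unattached S G w
    detached (cw , ¬h) = cw , λ h → ¬h (old h)

    keep : EdgeOK a b → (∀ {w} → Unattached S H w → w ≢ a × w ≢ b) → (Child root a → ¬ Child root b) → Reply H
    keep ok away split = inj₁ (proj₁ established , λ k≡5 u _ m _ →
        let u′ = proj₂ established u in ⊥-elim (leafy k≡5 (detached u′) (multi-old X (proj₁ (away u′)) (proj₂ (away u′)) m)))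
      where
      lab-edge′ : ∀ {x y} → Child root x → Child root y → Adj H x y → lab x ≡ lab y
      lab-edge′ cx cy h with cases h
      ... | inj₁ g = lab-edge cx cy g
      ... | inj₂ (inj₁ (refl , refl)) = ⊥-elim (split cx cy)
      ... | inj₂ (inj₂ (refl , refl)) = ⊥-elim (split cy cx)
      established : Σ (Position H) λ Q → ∀ {w} → Unattached (Position.shape Q) H w → Unattached S H w
      established = establish (tree-extend tree X ok) simple-H lab free-H lab-edge′
        (λ v w → lab-one (detached v) (detached w))

    reply-attach : Unattached S G a → b ≡ root → Reply H
    reply-attach un refl = keep (inj₁ (proj₁ un))
      (λ (cw , ¬h) → (λ { refl → ¬h new }) , proj₁ cw) (λ _ cb → proj₁ cb refl)

    reply-inner : Child (par b) a → b ≢ root → par b ≢ root → Reply H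
    reply-inner ch b≢r p≢r = keep (inj₂ (inj₂ (ch , b≢r)))
      (λ ((_ , e) , _) → (λ { refl → p≢r (trans (sym (proj₂ ch)) e) }) , (λ { refl → p≢r e })) (λ _ cb → p≢r (proj₂ cb))

    module _ (a≢r : a ≢ root) (pa≢r : par a ≢ root) (un-b : Unattached S G b) (isolated : ∀ y → ¬ Adj G b y) where

      b≢r : b ≢ root
      b≢r = proj₁ (proj₁ un-b)

      only-a : ∀ {y} → Adj H b y → y ≡ a
      only-a h with cases h
      ... | inj₁ g = ⊥-elim (isolated _ g)
      ... | inj₂ (inj₁ (e , e′)) = trans e′ e
      ... | inj₂ (inj₂ (_ , e)) = e

      a≢b : a ≢ b
      a≢b refl = pa≢r (proj₂ (proj₁ un-b))

      -- Both answers to a hanging move make `b` a child of a closed vertex `c`: of `a` if that is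
      -- closed, otherwise of the parent of `a`.
      module Hung (c : Fin n) (c≢b : c ≢ b) (c≢r : c ≢ root) (c-closed : Closed S G c) where

        abstract
          mv : Fin n → Maybe (Fin n)
          mv x with x ≟ b
          ... | yes _ = just c
          ... | no _ = nothing

          mv-b : mv b ≡ just c
          mv-b with b ≟ b
          ... | yes _ = refl
          ... | no ¬e = ⊥-elim (¬e refl)

          mv-other : ∀ {x} → x ≢ b → mv x ≡ nothing
          mv-other {x} x≢b with x ≟ b
          ... | yes e = ⊥-elim (x≢b e)
          ... | no _ = refl

          mv-just : ∀ {x d} → mv x ≡ just d → x ≡ b × d ≡ c
          mv-just {x} eq with x ≟ b
          mv-just refl | yes e = e , refl

        mv-ok : ∀ {x d} → mv x ≡ just d → x ≢ root × (∀ {y} → ¬ Child x y) × mv d ≡ nothing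
        mv-ok eq with mv-just eq
        ... | refl , refl = b≢r , unattached-childless un-b , mv-other c≢b

        open Reparent S mv mv-ok using (S′; par′; par-moved; par-kept; child-kept; child-moved; child-unmoved; edge-kept; module S′) public

        G-edge : ∀ {x y} → Adj G x y → S′.EdgeOK x y
        G-edge g = edge-kept (mv-other (λ { refl → isolated _ g })) (mv-other (λ { refl → isolated _ (symG g) })) (edges g)

        b-child : S′.Child c b
        b-child = child-moved mv-b

        closed-kept : ∀ {K} → (∀ {x y} → Adj G x y → Adj K x y) → ∀ {x} → Closed S G x → Closed S′ K x
        closed-kept inc {x} cl = closed-transport {S = S} {S′ = S′} (proj₁ cl) (par-kept (mv-other λ { refl → isolated _ (closed-attached cl) }))
          (λ (ch , h) → child-kept (mv-other (λ { refl → isolated _ h })) ch) (λ _ _ → inc) cl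

        tree′ : ∀ {K} → (∀ {x y} → Adj G x y → Adj K x y) → Adj K b c → (∀ {x y} → Adj K x y → S′.EdgeOK x y) → Tree S′ K
        tree′ {K} inc bc ok = record
          { edges = ok
          ; attached = λ {x} x≢r p≢r → attached′ x x≢r p≢r (x ≟ b)
          ; closed-parent = λ {x} x≢r p≢r → closed-parent′ x x≢r p≢r (x ≟ b) }
          where
          attached′ : ∀ x → x ≢ root → par′ x ≢ root → Dec (x ≡ b) → Adj K x (par′ x)
          attached′ x x≢r p≢r (yes refl) = subst (Adj K b) (sym (par-moved mv-b)) bc
          attached′ x x≢r p≢r (no x≢b) = subst (Adj K x) (sym (par-kept (mv-other x≢b)))
            (inc (attached x≢r (λ e → p≢r (trans (par-kept (mv-other x≢b)) e))))
          closed-parent′ : ∀ x → x ≢ root → par′ x ≢ root → Dec (x ≡ b) → Closed S′ K (par′ x)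
          closed-parent′ x x≢r p≢r (yes refl) = subst (Closed S′ K) (sym (par-moved mv-b)) (closed-kept inc c-closed)
          closed-parent′ x x≢r p≢r (no x≢b) = subst (Closed S′ K) (sym (par-kept (mv-other x≢b)))
            (closed-kept inc (closed-parent x≢r (λ e → p≢r (trans (par-kept (mv-other x≢b)) e))))

        root-child : ∀ {x} → S′.Child root x → x ≢ b × Child root x
        root-child {x} ch@(x≢r , e) with x ≟ b
        ... | yes refl = ⊥-elim (c≢r (trans (sym (par-moved mv-b)) e))
        ... | no x≢b = x≢b , child-unmoved (mv-other x≢b) ch

        hung : ∀ {K} → (T : Tree S′ K) → Simple K → ¬ ContainsMember 𝒞 K → (∀ {x y} → Adj G x y → Adj K x y) →
               (∀ {x y} → x ≢ b → y ≢ b → Adj K x y → Adj G x y) → (∀ {x} → Unattached S G x → x ≢ b → ¬ Adj K x b) →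
               Σ (Position K) Leafy
        hung {K} T simple-K free-K inc dec only = proj₁ established , leafy′
          where
          before : ∀ {w} → Unattached S′ K w → w ≢ b × Unattached S G w
          before (cw , ¬h) = let (w≢b , cw′) = root-child cw in w≢b , cw′ , λ h → ¬h (inc h)
          established : Σ (Position K) λ Q → ∀ {w} → Unattached (Position.shape Q) K w → Unattached S′ K w
          established = establish T simple-K lab free-K
            (λ cx cy h → let (x≢b , cx′) = root-child cx ; (y≢b , cy′) = root-child cy in lab-edge cx′ cy′ (dec x≢b y≢b h))
            (λ v w → lab-one (proj₂ (before v)) (proj₂ (before w)))
          leafy′ : Leafy (proj₁ established)
          leafy′ k≡5 u (x , y , x≢y , hx , hy) with before (proj₂ established u)
          ... | w≢b , u′ = leafy k≡5 u′ (x , y , x≢y , back hx , back hy)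
            where
            back : ∀ {x} → Adj K _ x → Adj G _ x
            back {x} h with x ≟ b
            ... | yes refl = ⊥-elim (only u′ w≢b h)
            ... | no x≢b = dec w≢b x≢b h

      H-old : ∀ {x y} → x ≢ b → y ≢ b → Adj H x y → Adj G x y
      H-old x≢b y≢b h with cases h
      ... | inj₁ g = g
      ... | inj₂ (inj₁ (_ , e)) = ⊥-elim (y≢b e)
      ... | inj₂ (inj₂ (e , _)) = ⊥-elim (x≢b e)

      apart : ∀ {x} → Unattached S G x → x ≢ a
      apart ((_ , e) , _) refl = pa≢r e

      reply-hang : Reply H
      reply-hang with closed? S G a
      ... | yes a-closed = inj₁ (proj₁ result , λ k≡5 u _ m _ → ⊥-elim (proj₂ result k≡5 u m))
        where
        open Hung a a≢b a≢r a-closed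
        edges-H : ∀ {x y} → Adj H x y → S′.EdgeOK x y
        edges-H h with cases h
        ... | inj₁ g = G-edge g
        ... | inj₂ (inj₁ (refl , refl)) = inj₂ (inj₁ b-child)
        ... | inj₂ (inj₂ (refl , refl)) = inj₁ b-child
        result : Σ (Position H) Leafy
        result = hung (tree′ old (adj-sym H new) edges-H) simple-H free-H old H-old
          (λ un _ h → apart un (only-a (adj-sym H h)))
      ... | no ¬a-closed = inj₂ (p , b , legal , result)
        where
        p : Fin n
        p = par a
        K : Graph n
        K = addEdge p b H
        Y : Extends H p b K
        Y = extends-addEdge H p b
        p≢b : p ≢ b
        p≢b e = unattached-childless un-b (a≢r , e)
        a≢p : a ≢ p
        a≢p = child≢parent (a≢r , refl)
        ¬pb : ¬ Adj H p b
        ¬pb h = a≢p (sym (only-a (adj-sym H h)))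
        open Hung p p≢b pa≢r (closed-parent a≢r pa≢r)
        a-child : S′.Child p a
        a-child = child-kept (mv-other a≢b) (a≢r , refl)
        a-b : S′.EdgeOK a b
        a-b = inj₂ (inj₂ (subst (λ q → S′.Child q a) (sym (par-moved mv-b)) a-child , b≢r))
        edges-H : ∀ {x y} → Adj H x y → S′.EdgeOK x y
        edges-H h with cases h
        ... | inj₁ g = G-edge g
        ... | inj₂ (inj₁ (refl , refl)) = a-b
        ... | inj₂ (inj₂ (refl , refl)) = S′.edgeOK-sym a-b
        edges-K : ∀ {x y} → Adj K x y → S′.EdgeOK x y
        edges-K h with Extends.cases Y h
        ... | inj₁ g = edges-H g
        ... | inj₂ (inj₁ (refl , refl)) = inj₂ (inj₁ b-child)
        ... | inj₂ (inj₂ (refl , refl)) = inj₁ b-child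
        safe : ¬ ContainsMember 𝒞 K
        safe mem with hang-path {S = S′} edges-H (extends-sym Y) b-child only-a a≢p free-H mem
        ... | xs , Q , u , ch , W≤ = ¬a-closed (closed-intro tree (a≢r , refl) (path-map back Q) (unique-tail u)
                (All.tabulate (λ {x} x∈ → in-G x∈)) W≤)
          where
          ≢b : ∀ {x} → x ∈ xs → x ≢ b
          ≢b x∈ refl = unique-head u x∈
          back : ∀ {x y} → x ∈ xs → y ∈ xs ⊎ y ≡ p → Adj H x y → Adj G x y
          back x∈ y∈ = H-old (≢b x∈) ([ ≢b , (λ { refl → p≢b }) ]′ y∈)
          in-G : ∀ {x} → x ∈ xs → Child p x × Adj G x p
          in-G {x} x∈ = let c@(x≢r , e) = child-unmoved (mv-other (≢b x∈)) (All.lookup ch x∈) in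
            c , subst (Adj G x) e (attached x≢r (λ e′ → pa≢r (trans (sym e) e′)))
        legal : Legal 𝒞 H p b
        legal = p≢b , ¬pb , safe
        K-old : ∀ {x y} → x ≢ b → y ≢ b → Adj K x y → Adj G x y
        K-old x≢b y≢b h with Extends.cases Y h
        ... | inj₁ g = H-old x≢b y≢b g
        ... | inj₂ (inj₁ (_ , e)) = ⊥-elim (y≢b e)
        ... | inj₂ (inj₂ (e , _)) = ⊥-elim (x≢b e)
        result : Σ (Position K) Leafy
        result = hung (tree′ (λ g → Extends.old Y (old g)) (adj-sym K (Extends.new Y)) edges-K) ((p≢b , ¬pb) ∷ simple-H) safe
          (λ g → Extends.old Y (old g)) K-old not-b
          where
          not-b : ∀ {x} → Unattached S G x → x ≢ b → ¬ Adj K x b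
          not-b {x} un x≢b h with Extends.cases Y h
          ... | inj₁ g = apart un (only-a (adj-sym H g))
          ... | inj₂ (inj₁ (refl , _)) = proj₂ un (subst (Adj G p) (proj₂ (proj₁ un)) (closed-attached (closed-parent a≢r pa≢r)))
          ... | inj₂ (inj₂ (e , _)) = x≢b e

    -- Joining two children of the root

    module _ (a-child : Child root a) (b-child : Child root b) where

      lab₁ : Fin n → Fin n
      lab₁ x with lab x ≟ lab b
      ... | yes _ = lab a
      ... | no _ = lab x

      lab₁-b : ∀ {x} → lab x ≡ lab b → lab₁ x ≡ lab a
      lab₁-b {x} e with lab x ≟ lab b
      ... | yes _ = refl
      ... | no ¬e = ⊥-elim (¬e e)

      lab₁-a : ∀ {x} → lab x ≡ lab a → lab₁ x ≡ lab a
      lab₁-a {x} e with lab x ≟ lab b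
      ... | yes _ = refl
      ... | no _ = e

      lab₁-cong : ∀ {x y} → lab x ≡ lab y → lab₁ x ≡ lab₁ y
      lab₁-cong {x} {y} e with lab x ≟ lab b | lab y ≟ lab b
      ... | yes _ | yes _ = refl
      ... | yes p | no ¬q = ⊥-elim (¬q (trans (sym e) p))
      ... | no ¬p | yes q = ⊥-elim (¬p (trans e q))
      ... | no _ | no _ = e

      lab₁-edge : ∀ {x y} → Child root x → Child root y → Adj H x y → lab₁ x ≡ lab₁ y
      lab₁-edge cx cy h with cases h
      ... | inj₁ g = lab₁-cong (lab-edge cx cy g)
      ... | inj₂ (inj₁ (refl , refl)) = trans (lab₁-a refl) (sym (lab₁-b refl))
      ... | inj₂ (inj₂ (refl , refl)) = trans (lab₁-b refl) (sym (lab₁-a refl))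

      lab₁-merged : ∀ {v w} → Unattached S G v → Unattached S G w → v ≢ w → lab₁ v ≡ lab₁ w →
                    (lab v ≡ lab a × lab w ≡ lab b) ⊎ (lab v ≡ lab b × lab w ≡ lab a)
      lab₁-merged {v} {w} uv uw v≢w e with lab v ≟ lab b | lab w ≟ lab b
      ... | yes p | yes q = ⊥-elim (v≢w (lab-one uv uw (trans p (sym q))))
      ... | yes p | no _ = inj₂ (p , sym e)
      ... | no _ | yes q = inj₁ (e , q)
      ... | no _ | no _ = ⊥-elim (v≢w (lab-one uv uw e))

      lab₁-common : ∀ {v w} → Unattached S G v → Unattached S G w → v ≢ w → lab₁ v ≡ lab₁ w → lab₁ v ≡ lab a
      lab₁-common uv uw v≢w e with lab₁-merged uv uw v≢w e
      ... | inj₁ (p , _) = lab₁-a p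
      ... | inj₂ (p , _) = lab₁-b p

      -- The merged class consists of two classes with at most one unattached vertex each.
      one-of : ∀ {v v′ w} → Unattached S G v → Unattached S G v′ → Unattached S G w → v ≢ v′ → lab₁ v ≡ lab₁ v′ →
               lab₁ w ≡ lab a → w ≡ v ⊎ w ≡ v′
      one-of {v} {v′} {w} uv uv′ uw v≢v′ e ew with w ≟ v
      ... | yes w≡v = inj₁ w≡v
      ... | no w≢v with lab₁-merged uw uv w≢v (trans ew (sym (lab₁-common uv uv′ v≢v′ e))) | lab₁-merged uv uv′ v≢v′ e
      ... | inj₁ (p , q) | inj₁ (r , s) = ⊥-elim (w≢v (lab-one uw uv (trans p (sym r))))
      ... | inj₁ (p , q) | inj₂ (r , s) = inj₂ (lab-one uw uv′ (trans p (sym s)))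
      ... | inj₂ (p , q) | inj₁ (r , s) = inj₂ (lab-one uw uv′ (trans p (sym s)))
      ... | inj₂ (p , q) | inj₂ (r , s) = ⊥-elim (w≢v (lab-one uw uv (trans p (sym r))))

      multi-new : κ ≡ 0 → ∀ {w} → Unattached S G w → Multi H w → w ≡ a ⊎ w ≡ b
      multi-new k≡5 {w} u m with w ≟ a | w ≟ b
      ... | yes e | _ = inj₁ e
      ... | no _ | yes e = inj₂ e
      ... | no w≢a | no w≢b = ⊥-elim (leafy k≡5 u (multi-old X w≢a w≢b m))

      multi-common : κ ≡ 0 → ∀ {w} → Unattached S G w → Multi H w → lab₁ w ≡ lab a
      multi-common k≡5 u m with multi-new k≡5 u m
      ... | inj₁ refl = lab₁-a refl
      ... | inj₂ refl = lab₁-b refl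

      Normalised : Shape n → Set
      Normalised S₁ = Tree S₁ H × (∀ {v c} → Unattached S₁ H v → Adj H v c → ¬ Closed S₁ H c) ×
                      (∀ {v} → Unattached S₁ H v → Unattached S H v) ×
                      (∀ {x} → ShapeLemmas.Child S₁ (Shape.root S₁) x → Child root x)

      H-tree : Tree S H
      H-tree = tree-extend tree X (inj₂ (inj₂ ((proj₁ a-child , trans (proj₂ a-child) (sym (proj₂ b-child))) , proj₁ b-child)))

      raised : ∀ {x} → Unattached S G x → Unattached S H x
      raised {x} (cx , ¬g) = cx , λ h → [ ¬g , [ (λ (_ , e) → proj₁ b-child (sym e)) , (λ (_ , e) → proj₁ a-child (sym e)) ]′ ]′ (cases h)

      closed⇒attached : ∀ {x} → Unattached S G x → ¬ Closed S H x
      closed⇒attached {x} u cl =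
        proj₂ (raised u) (subst (Adj H x) (proj₂ (proj₁ u)) (TreeLemmas.closed-attached H-tree cl))

      -- Normalisation requires unattached vertices to be pairwise non-adjacent, which can fail only
      -- if `a` and `b` are both unattached; then the old shape is kept.
      normalised : ∃ Normalised
      normalised with unattached? S G a ×-dec unattached? S G b
      ... | yes (un-a , un-b) = S , H-tree , normal-H , (λ u → u) , (λ c → c)
        where
        -- The new edge joins two unattached vertices, so closed vertices stay the same.
        normal-H : ∀ {v c} → Unattached S H v → Adj H v c → ¬ Closed S H c
        normal-H {v} {c} u h cl with cases h
        ... | inj₂ (inj₁ (_ , refl)) = closed⇒attached un-b cl
        ... | inj₂ (inj₂ (_ , refl)) = closed⇒attached un-a cl
        ... | inj₁ g = normal (detached u) g (closed-transport {S = S} {S′ = S} (proj₁ cl) refl proj₁ back cl)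
          where
          not-end : ∀ {x} → Unattached S G x → ¬ (Child (par c) x × Adj H x (par c))
          not-end {x} u′@((_ , e) , _) ((_ , e′) , h′) = proj₂ (raised u′) (subst (Adj H x) (trans (sym e′) e) h′)
          back : ∀ {x y} → Child (par c) x × Adj H x (par c) → (Child (par c) y × Adj H y (par c)) ⊎ y ≡ par c →
                 Adj H x y → Adj G x y
          back q _ h with cases h
          ... | inj₁ g = g
          ... | inj₂ (inj₁ (refl , _)) = ⊥-elim (not-end un-a q)
          ... | inj₂ (inj₂ (refl , _)) = ⊥-elim (not-end un-b q)
      ... | no ¬both = N.S′ 𝒞 𝒞-k H-tree simple-H free-H independent-H
          , N.normal-tree 𝒞 𝒞-k H-tree simple-H free-H independent-H
          , N.normal 𝒞 𝒞-k H-tree simple-H free-H independent-H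
          , N.unattached-backward 𝒞 𝒞-k H-tree simple-H free-H independent-H
          , N.root-child-backward 𝒞 𝒞-k H-tree simple-H free-H independent-H
        where
        independent-H : ∀ {v w} → Unattached S H v → Unattached S H w → ¬ Adj H v w
        independent-H uv uw h with cases h
        ... | inj₁ g = independent (detached uv) (detached uw) g
        ... | inj₂ (inj₁ (refl , refl)) = ¬both (detached uv , detached uw)
        ... | inj₂ (inj₂ (refl , refl)) = ¬both (detached uw , detached uv)

      module _ {S₁} (norm : Normalised S₁) where

        private
          T₁ : Tree S₁ H
          T₁ = proj₁ norm
          normal₁ : ∀ {v c} → Unattached S₁ H v → Adj H v c → ¬ Closed S₁ H c
          normal₁ = proj₁ (proj₂ norm)
          open ShapeLemmas S₁ using () renaming (root to root₁; Child to Child₁)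
          un-G : ∀ {v} → Unattached S₁ H v → Unattached S G v
          un-G u = detached (proj₁ (proj₂ (proj₂ norm)) u)
          child-G : ∀ {x} → Child₁ root₁ x → Child root x
          child-G = proj₂ (proj₂ (proj₂ norm))

        edge₁ : ∀ {x y} → Child₁ root₁ x → Child₁ root₁ y → Adj H x y → lab₁ x ≡ lab₁ y
        edge₁ cx cy = lab₁-edge (child-G cx) (child-G cy)

        Pair : Fin n → Fin n → Set
        Pair v w = Unattached S₁ H v × Unattached S₁ H w × v ≢ w × lab₁ v ≡ lab₁ w

        pair? : ∀ v w → Dec (Pair v w)
        pair? v w = unattached? S₁ H v ×-dec unattached? S₁ H w ×-dec ¬? (v ≟ w) ×-dec (lab₁ v ≟ lab₁ w)

        reply-unpaired : (∀ v w → ¬ Pair v w) → Reply H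
        reply-unpaired none = inj₁ (proj₁ established , λ k≡5 u w m m′ →
            let u′ = proj₂ established u ; w′ = proj₂ established w in
            lab₁-one u′ w′ (trans (multi-common k≡5 (un-G u′) m) (sym (multi-common k≡5 (un-G w′) m′))))
          where
          lab₁-one : ∀ {v w} → Unattached S₁ H v → Unattached S₁ H w → lab₁ v ≡ lab₁ w → v ≡ w
          lab₁-one {v} {w} uv uw e with v ≟ w
          ... | yes p = p
          ... | no v≢w = ⊥-elim (none v w (uv , uw , v≢w , e))
          established : Σ (Position H) λ Q → ∀ {w} → Unattached (Position.shape Q) H w → Unattached S₁ H w
          established = establish T₁ simple-H lab₁ free-H edge₁ lab₁-one

        module _ {v v′} (uv : Unattached S₁ H v) (uv′ : Unattached S₁ H v′) (v≢v′ : v ≢ v′) (same : lab₁ v ≡ lab₁ v′) where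

          X-pay : ∀ x → Extends H x root₁ (addEdge root₁ x H)
          X-pay x = extends-sym (extends-addEdge H root₁ x)

          only : ∀ {w} → Unattached S₁ H w → lab₁ w ≡ lab a → w ≡ v ⊎ w ≡ v′
          only uw = one-of (un-G uv) (un-G uv′) (un-G uw) v≢v′ same

          common : lab₁ v ≡ lab a
          common = lab₁-common (un-G uv) (un-G uv′) v≢v′ same

          -- Two unattached vertices of different classes of G can only be joined through ab.
          joined-through-end : ∀ {t y zs} → SamePair a b t y → Path (Adj H) v′ zs v → t ∉ zs → t ≢ v →
                               All (Child₁ root₁) zs → ⊥
          joined-through-end {t} {zs = zs} pair R t∉ t≢v ch = v≢v′ (sym (lab-one (un-G uv′) (un-G uv)
            (label-end (path-map (λ x∈ y∈ → avoid pair (≢t x∈) ([ ≢t , (λ { refl e → t≢v (sym e) }) ]′ y∈)) R) ch)))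
            where
            ≢t : ∀ {x} → x ∈ zs → x ≢ t
            ≢t x∈ refl = t∉ x∈
            avoid : ∀ {y} → SamePair a b t y → ∀ {x z} → x ≢ t → z ≢ t → Adj H x z → Adj G x z
            avoid p x≢t z≢t h with cases h
            ... | inj₁ g = g
            avoid (inj₁ (refl , _)) x≢t z≢t h | inj₂ (inj₁ (e , _)) = ⊥-elim (x≢t e)
            avoid (inj₁ (refl , _)) x≢t z≢t h | inj₂ (inj₂ (_ , e)) = ⊥-elim (z≢t e)
            avoid (inj₂ (refl , _)) x≢t z≢t h | inj₂ (inj₁ (_ , e)) = ⊥-elim (z≢t e)
            avoid (inj₂ (refl , _)) x≢t z≢t h | inj₂ (inj₂ (e , _)) = ⊥-elim (x≢t e)
            label-end : ∀ {x ys} → Path (Adj G) x ys v → All (Child₁ root₁) ys → lab x ≡ lab v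
            label-end ε _ = refl
            label-end (g ◅ ε) (c ∷ []) = lab-edge (child-G c) (proj₁ (un-G uv)) g
            label-end (g ◅ Q@(_ ◅ _)) (c ∷ cs@(c′ ∷ _)) = trans (lab-edge (child-G c) (child-G c′) g) (label-end Q cs)

          separate : ∀ {t zs} → Adj H t v → Adj H t v′ → Path (Adj H) v′ zs v → t ∉ zs → t ≢ v →
                     All (Child₁ root₁) zs → ⊥
          separate tv tv′ R t∉ t≢v ch with cases tv | cases tv′
          ... | inj₂ pair | _ = joined-through-end pair R t∉ t≢v ch
          ... | inj₁ _ | inj₂ pair = joined-through-end pair R t∉ t≢v ch
          ... | inj₁ g | inj₁ g′ = v≢v′ (lab-one (un-G uv) (un-G uv′)
                  (trans (sym (lab-edge ct (proj₁ (un-G uv)) g)) (lab-edge ct (proj₁ (un-G uv′)) g′)))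
            where
            ct : Child root _
            ct = unattached-neighbour (un-G uv) (symG g)

          pay-one : ∀ {x y} → (∀ {w} → Unattached S₁ H w → lab₁ w ≡ lab a → w ≡ x ⊎ w ≡ y) → Unattached S₁ H x →
                    ¬ ContainsMember 𝒞 (addEdge root₁ x H) → (κ ≡ 0 → ¬ Multi H y) → GoodMove H
          pay-one {x} {y} only-xy ux safe ¬multi = pay T₁ simple-H lab₁ ux safe edge₁ one-left
            (λ k≡5 uw w≢x m → ¬multi k≡5 (subst (Multi H) (left uw w≢x (multi-common k≡5 (un-G uw) m)) m))
            where
            left : ∀ {w} → Unattached S₁ H w → w ≢ x → lab₁ w ≡ lab a → w ≡ y
            left uw w≢x e with only-xy uw e
            ... | inj₁ p = ⊥-elim (w≢x p)
            ... | inj₂ p = p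
            one-left : ∀ {w w′} → Unattached S₁ H w → Unattached S₁ H w′ → w ≢ x → w′ ≢ x → lab₁ w ≡ lab₁ w′ → w ≡ w′
            one-left {w} {w′} uw uw′ w≢x w′≢x e with w ≟ w′
            ... | yes p = p
            ... | no w≢w′ = trans (left uw w≢x c) (sym (left uw′ w′≢x (trans (sym e) c)))
              where
              c : lab₁ w ≡ lab a
              c = lab₁-common (un-G uw) (un-G uw′) w≢w′ e

          safe-beside-leaf : ∀ {x y} → (∀ {w} → Unattached S₁ H w → lab₁ w ≡ lab a → w ≡ x ⊎ w ≡ y) →
                             Unattached S₁ H x → lab₁ x ≡ lab a → ¬ Multi H y → ¬ ContainsMember 𝒞 (addEdge root₁ x H)
          safe-beside-leaf {x} only-xy ux lx ¬multi = Pay.pay-safe T₁ free-H ux (X-pay x) (normal₁ ux) lab₁ edge₁ leaf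
            where
            leaf : ∀ {w} → Unattached S₁ H w → lab₁ w ≡ lab₁ x → w ≢ x → ¬ Multi H w
            leaf uw e w≢x m with only-xy uw (trans e lx)
            ... | inj₁ p = w≢x p
            ... | inj₂ refl = ¬multi m

          -- The further neighbours `u` of `a` and `w` of `b` are attached, so root, `u`, `a`, `b`,
          -- `w` is a cycle; `u ≡ w` would put `a` and `b` into one class of `G`.
          five-cycle : κ ≡ 0 → Unattached S G a → Unattached S G b → Multi H a → Multi H b → ⊥
          five-cycle k≡5 ua ub ma mb with other ma | other mb
            where
            other : ∀ {x y} → Multi H x → ∃ λ z → Adj H x z × z ≢ y
            other {y = y} (z , z′ , z≢z′ , h , h′) with z ≟ y
            ... | yes refl = z′ , h′ , λ e → z≢z′ (sym e)
            ... | no z≢y = z , h , z≢y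
          ... | u , au , u≢b | w , bw , w≢a = free-H (5 + κ , 𝒞-k , cycle⇒hasCycle
              (root , root ∷ u ∷ a ∷ b ∷ w ∷ [] ,
               old (symG u-attached) ◅ adj-sym H au ◅ new ◅ bw ◅ old w-attached ◅ ε ,
               unique-∷ (λ { (here e) → proj₁ u-child (sym e) ; (there (here e)) → proj₁ a-child (sym e)
                           ; (there (there (here e))) → proj₁ b-child (sym e)
                           ; (there (there (there (here e)))) → proj₁ w-child (sym e) })
                 (unique-∷ (λ { (here refl) → simple-irrefl simple-H au ; (there (here e)) → u≢b e
                              ; (there (there (here refl))) → u≢w refl })
                   (unique-∷ (λ { (here refl) → simple-irrefl simple-H new ; (there (here e)) → w≢a (sym e) })
                     (unique-∷ (λ { (here refl) → simple-irrefl simple-H bw }) ([] ∷ [])))) ,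
               cong (5 +_) (sym k≡5) , s≤s (s≤s (s≤s z≤n))))
            where
            au-G : Adj G a u
            au-G with cases au
            ... | inj₁ g = g
            ... | inj₂ (inj₁ (_ , e)) = ⊥-elim (u≢b e)
            ... | inj₂ (inj₂ (e , _)) = ⊥-elim (simple-irrefl simple-H (subst (λ z → Adj H z b) e new))
            bw-G : Adj G b w
            bw-G with cases bw
            ... | inj₁ g = g
            ... | inj₂ (inj₁ (e , _)) = ⊥-elim (simple-irrefl simple-H (subst (Adj H a) e new))
            ... | inj₂ (inj₂ (_ , e)) = ⊥-elim (w≢a e)
            u-child : Child root u
            u-child = unattached-neighbour ua au-G
            w-child : Child root w
            w-child = unattached-neighbour ub bw-G
            u-attached : Adj G u root
            u-attached = N.neighbour-attached 𝒞 𝒞-k tree simple free independent ua au-G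
            w-attached : Adj G w root
            w-attached = N.neighbour-attached 𝒞 𝒞-k tree simple free independent ub bw-G
            u≢w : u ≢ w
            u≢w refl = simple-irrefl simple-H (subst (Adj H a) (sym (lab-one ua ub
              (trans (lab-edge a-child u-child au-G) (sym (lab-edge b-child w-child bw-G))))) new)

          both-multi : κ ≡ 0 → Multi H v → Multi H v′ → ⊥
          both-multi k≡5 m m′ with multi-new k≡5 (un-G uv) m | multi-new k≡5 (un-G uv′) m′
          ... | inj₁ refl | inj₁ refl = v≢v′ refl
          ... | inj₂ refl | inj₂ refl = v≢v′ refl
          ... | inj₁ refl | inj₂ refl = five-cycle k≡5 (un-G uv) (un-G uv′) m m′
          ... | inj₂ refl | inj₁ refl = five-cycle k≡5 (un-G uv′) (un-G uv) m′ m

          -- A vertex with at most one neighbour cannot lie inside a blocking path, so its partner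
          -- may be attached. If both have two neighbours, then k is not 5 and the cycle of length k
          -- + 1 is forbidden too.
          reply-paired : GoodMove H
          reply-paired with multi? H v′ | multi? H v
          ... | no ¬m′ | _ = pay-one only uv (safe-beside-leaf only uv common ¬m′) (λ _ → ¬m′)
          ... | yes _ | no ¬m = pay-one only′ uv′ (safe-beside-leaf only′ uv′ (trans (sym same) common) ¬m) (λ _ → ¬m)
            where
            only′ : ∀ {w} → Unattached S₁ H w → lab₁ w ≡ lab a → w ≡ v′ ⊎ w ≡ v
            only′ uw e = [ inj₂ , inj₁ ]′ (only uw e)
          ... | yes m′ | yes m = pay-one only uv
                  (Pay.pay-multi T₁ free-H uv (X-pay v) (normal₁ uv) lab₁ edge₁ (𝒞-k+1 (λ k≡5 → both-multi k≡5 m m′))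
                    (simple-irrefl simple-H) (λ uw e → only uw (trans e common)) separate m)
                  (λ k≡5 _ → both-multi k≡5 m m′)

      reply-root : Reply H
      reply-root with normalised
      ... | S₁ , norm with any? (λ v → any? (pair? norm v))
      ... | yes (v , v′ , uv , uv′ , v≢v′ , same) = inj₂ (reply-paired norm uv uv′ v≢v′ same)
      ... | no none = reply-unpaired norm (λ v w p → none (v , w , p))

    reply-local : Local tree a b → Reply H
    reply-local (attach un e) = reply-attach un e
    reply-local (hang a≢r pa≢r un isolated) = reply-hang a≢r pa≢r un isolated
    reply-local (sibling ch b≢r) with par b ≟ root
    ... | yes e = reply-root (proj₁ ch , trans (proj₂ ch) e) (b≢r , e)
    ... | no p≢r = reply-inner ch b≢r p≢r

  -- The course of the game

  reply : ∀ {n} {G : Graph n} {u v} (P : Position G) → Leafy P → Legal 𝒞 G u v → Reply (addEdge u v G)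
  reply {G = G} {u} {v} P leafy (u≢v , ¬uv , safe) =
    [ ReplyTo.reply-local P leafy X simple′ safe , ReplyTo.reply-local P leafy (extends-sym X) simple′ safe ]′
      (local (Position.tree P) safe (StatusOf.independent P) (Position.normal P) X u≢v ¬uv)
    where
    X : Extends G u v (addEdge u v G)
    X = extends-addEdge G u v
    simple′ : Simple (addEdge u v G)
    simple′ = (u≢v , ¬uv) ∷ Position.simple P

  play : ∀ {n} fuel {G : Graph n} (P : Position G) → Leafy P → n * n < fuel + numEdges G →
         MiniForces 𝒞 (((4 + κ) * (n ∸ 1) + 2) / 2) G Max
  play zero P leafy h = ⊥-elim (<⇒≱ h (edges≤n*n (Position.simple P)))
  -- On Max's turn `status` only decides whether the game is over; its move merely witnesses that
  -- some move is legal.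
  play {n} (suc fuel) {G} P leafy h with StatusOf.status P (λ k≡5 u _ m _ → ⊥-elim (leafy k≡5 u m))
  ... | inj₂ (saturated , small) = done saturated small
  ... | inj₁ (u , v , legal , _) = maxMove (λ saturated → saturated u v legal) answer
    where
    -- A round adds two edges but costs one unit of fuel, so the bound holds with room to spare.
    next : n * n < fuel + (2 + numEdges G)
    next = ≤-trans h (≤-trans (≤-reflexive (sym (+-suc fuel (numEdges G)))) (+-monoʳ-≤ fuel (n≤1+n _)))
    move : ∀ {u v} → GoodMove (addEdge u v G) → MiniForces 𝒞 _ (addEdge u v G) Mini
    move (x , y , legal , Q , leafy′) = miniMove x y legal (play fuel Q leafy′ next)
    answer : ∀ u v → Legal 𝒞 G u v → MiniForces 𝒞 _ (addEdge u v G) Mini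
    answer u v legal with reply P leafy legal
    ... | inj₂ m = move m
    ... | inj₁ (Q , almost) with StatusOf.status Q almost
    ... | inj₁ m = move m
    ... | inj₂ (saturated , small) = done saturated small

  no-adj : ∀ {n} {x y : Fin n} → ¬ Adj emptyGraph x y
  no-adj (inj₁ ())
  no-adj (inj₂ ())

  start : ∀ {n} → Σ (Position {suc n} emptyGraph) Leafy
  start {n} = record
    { shape = record { root = zero ; par = λ _ → zero ; dep = λ { zero → 0 ; (suc _) → 1 }
                     ; dep-root = refl ; dep-par = λ { {zero} z≢z → ⊥-elim (z≢z refl) ; {suc _} _ → refl } }
    ; tree = record { edges = λ h → ⊥-elim (no-adj h) ; attached = λ _ p≢r → ⊥-elim (p≢r refl)
                    ; closed-parent = λ _ p≢r → ⊥-elim (p≢r refl) }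
    ; simple = [] ; free = empty-free ; lab = λ x → x
    ; lab-edge = λ _ _ h → ⊥-elim (no-adj h) ; lab-one = λ _ _ e → e
    ; normal = λ _ h → ⊥-elim (no-adj h) } , λ _ _ (_ , _ , _ , h , _) → no-adj h
    where
    empty-free : ¬ ContainsMember {suc n} 𝒞 emptyGraph
    empty-free (ℓ , _ , c) with hasCycle⇒cycle ℓ c
    ... | _ , [] , _ , _ , refl , ()
    ... | _ , _ ∷ _ , (h ◅ _) , _ = no-adj h

  strategy : ∀ n → SatGameAtMost 𝒞 n (((4 + κ) * (n ∸ 1) + 2) / 2)
  strategy zero = done (λ ()) z≤n
  strategy (suc n) = play (suc (suc n * suc n)) (proj₁ start) (proj₂ start) (m≤m+n _ 0)

theorem1p6 : (k : ℕ) → 5 ≤ k → (𝒞 : CycleFamily) → KDense k 𝒞 →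
    (n : ℕ) → SatGameAtMost 𝒞 n (((k ∸ 1) * (n ∸ 1) + 2) / 2)
theorem1p6 (suc (suc (suc (suc (suc κ))))) (s≤s (s≤s (s≤s (s≤s (s≤s z≤n))))) 𝒞 ((𝒞-k , 𝒞-k+1) , 𝒞-min , dense) =
  Strategy.strategy κ 𝒞 𝒞-k (λ κ≢0 → 𝒞-k+1 (λ e → κ≢0 (+-cancelˡ-≡ 5 κ 0 e))) (λ {ℓ} → 𝒞-min ℓ) dense′
  where
  dense′ : ∀ s → ∃ λ ℓ → 5 + s ≤ ℓ × ℓ ≤ 3 + suc s * (3 + κ) × 𝒞 ℓ
  -- Shifting the parameter of (3) by 3 removes the truncated subtractions.
  dense′ s with dense (3 + s) (s≤s (s≤s (s≤s z≤n)))
  ... | ℓ , lo , hi , c = ℓ , ≤-trans (≤-reflexive (cong (3 +_) (+-comm 2 s))) lo ,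
    ≤-trans hi (≤-reflexive (cong (3 +_) (*-comm (3 + κ) (suc s)))) , c
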